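{- For all $n\ge36$, let ${\mathcal X}$ be the family of edge sets of subgraphs of $K_n$ isomorphic to $K_4$ or to $K_{2,3}$, and let ${\mathcal U}$ be the matroid on $E(K_n)$ whose independent sets are the sets $F\subseteq E(K_n)$ with $|F|\le6$ and $F\notin{\mathcal X}$. Then the poset (under the weak order) of all partial elevations of ${\mathcal U}$ has two distinct maximal elements.
   Context: Weak order: ${\mathcal M}_1\preceq{\mathcal M}_2$ if every independent set of ${\mathcal M}_1$ is independent in ${\mathcal M}_2$. The truncation of a rank-$k$ matroid ${\mathcal M}_1$ is the rank-$(k-1)$ matroid whose independent sets are those of ${\mathcal M}_1$ of size at most $k-1$; ${\mathcal M}_1$ is an erection of ${\mathcal M}_0$ if ${\mathcal M}_0$ is the truncation of ${\mathcal M}_1$ (${\mathcal M}_0$ counts as a trivial erection of itself). A partial elevation of ${\mathcal M}_0$ is any matroid obtained from ${\mathcal M}_0$ by a sequence of erections. -}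

module Defs where

open import Data.Nat as ℕ using (ℕ; zero; suc; _≤_; _<_)
open import Data.Fin as Fin using (Fin; toℕ)
open import Data.Fin.Properties using (_≟_) renaming (_<?_ to _<ᶠ?_)
open import Data.Bool using (Bool; true; false; if_then_else_; _∨_; _∧_)
open import Data.List using (List; []; _∷_; concatMap; map; allFin)
open import Data.Nat.ListAction using (sum)
open import Data.List using () renaming ([_] to ⟦_⟧)
open import Data.Product using (Σ; Σ-syntax; ∃; ∃-syntax; _×_; _,_; proj₁; proj₂)
open import Data.Sum using (_⊎_)
open import Relation.Nullary using (¬_; yes; no; does)
open import Relation.Binary.PropositionalEquality using (_≡_; _≢_)
open import Relation.Binary.Construct.Closure.ReflexiveTransitive using (Star)
open import Function.Definitions using (Injective)
open import Level using (0ℓ)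

Edge : ℕ → Set
Edge n = Σ[ i ∈ Fin n ] Σ[ j ∈ Fin n ] (i Fin.< j)

src : ∀ {n} → Edge n → Fin n
src (i , _ , _) = i

tgt : ∀ {n} → Edge n → Fin n
tgt (_ , j , _) = j

allEdges : (n : ℕ) → List (Edge n)
allEdges n = concatMap (λ i → concatMap (λ j → pick i j) (allFin n)) (allFin n)
  where
  pick : (i j : Fin n) → List (Edge n)
  pick i j with i <ᶠ? j
  ... | yes p = ⟦ (i , j , p) ⟧
  ... | no _  = []

ESet : ℕ → Set
ESet n = Edge n → Bool

∅ : ∀ {n} → ESet n
∅ _ = false

size : ∀ {n} → ESet n → ℕ
size {n} S = sum (map (λ e → if S e then 1 else 0) (allEdges n))

_⊆_ : ∀ {n} → ESet n → ESet n → Set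
S ⊆ T = ∀ e → S e ≡ true → T e ≡ true

sameEdge : ∀ {n} → Edge n → Edge n → Bool
sameEdge e f = does (src e ≟ src f) ∧ does (tgt e ≟ tgt f)

insert : ∀ {n} → Edge n → ESet n → ESet n
insert e S x = S x ∨ sameEdge x e

IndPred : ℕ → Set₁
IndPred n = ESet n → Set

record IsMatroid {n : ℕ} (Ind : IndPred n) : Set where
  field
    ind-∅     : Ind ∅
    ind-down  : ∀ S T → S ⊆ T → Ind T → Ind S
    ind-exch  : ∀ S T → Ind S → Ind T → size S < size T →
                ∃[ e ] (T e ≡ true × S e ≡ false × Ind (insert e S))

_⪯_ : ∀ {n} → IndPred n → IndPred n → Set
M₁ ⪯ M₂ = ∀ S → M₁ S → M₂ S

_≅ₘ_ : ∀ {n} → IndPred n → IndPred n → Set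
M₁ ≅ₘ M₂ = M₁ ⪯ M₂ × M₂ ⪯ M₁

HasRank : ∀ {n} → IndPred n → ℕ → Set
HasRank M k = (∃[ S ] (M S × size S ≡ k)) × (∀ S → M S → size S ≤ k)

IsTruncationOf : ∀ {n} → IndPred n → IndPred n → Set
IsTruncationOf M₀ M₁ =
  IsMatroid M₁ × ∃[ k ] (HasRank M₁ (suc k) ×
    (∀ S → (M₀ S → M₁ S × size S ≤ k) × (M₁ S × size S ≤ k → M₀ S)))

-- M₁ is an erection of M₀ (including the trivial erection M₀ itself)
IsErectionOf : ∀ {n} → IndPred n → IndPred n → Set
IsErectionOf M₁ M₀ = IsTruncationOf M₀ M₁ ⊎ (M₀ ≅ₘ M₁)

Erects : ∀ {n} → IndPred n → IndPred n → Set
Erects M₀ M₁ = IsErectionOf M₁ M₀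

IsPartialElevation : ∀ {n} → IndPred n → IndPred n → Set₁
IsPartialElevation M₀ M = Star Erects M₀ M

IsMaximalElevation : ∀ {n} → IndPred n → IndPred n → Set₁
IsMaximalElevation M₀ M =
  IsPartialElevation M₀ M ×
  (∀ M' → IsPartialElevation M₀ M' → M ⪯ M' → M' ⪯ M)

IsCopyOf : ∀ {n} (k : ℕ) (Hadj : Fin k → Fin k → Set) → ESet n → Set
IsCopyOf {n} k Hadj F =
  ∃[ φ ] (Injective _≡_ _≡_ φ ×
    (∀ (e : Edge n) → (F e ≡ true → ∃[ u ] ∃[ v ] (Hadj u v × φ u ≡ src e × φ v ≡ tgt e))
                    × ((∃[ u ] ∃[ v ] (Hadj u v × φ u ≡ src e × φ v ≡ tgt e)) → F e ≡ true)))

K4adj : Fin 4 → Fin 4 → Set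
K4adj u v = u ≢ v

K23adj : Fin 5 → Fin 5 → Set
K23adj u v = (toℕ u < 2 × 2 ≤ toℕ v) ⊎ (2 ≤ toℕ u × toℕ v < 2)

InX : ∀ {n} → ESet n → Set
InX F = IsCopyOf 4 K4adj F ⊎ IsCopyOf 5 K23adj F

U : (n : ℕ) → IndPred n
U n F = size F ≤ 6 × ¬ InX F

{-# OPTIONS --safe #-}

-- Over 𝔽₃ represent the edge ij by the vector δ_i + δ_j (the even cycle matroid).  Let 𝓔 be the
-- matroid of edge sets of nullity at most one; it has rank n + 1 and its truncation to rank 6 is U.
-- In any matroid M in which each K₄ and K₂₃ is a circuit, K₂₃ shows that attaching a vertex to a complete
-- or complete bipartite graph raises the rank by at most one.  So a complete graph on m vertices has
-- rank at most m + 1, and a hyperplane {ij : x i + x j = 0} (x ≠ 0) of the even cycle matroid, being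
-- the disjoint union of a complete and a complete bipartite graph, has rank at most n provided that
-- C₄ ∪ C₄ (vertex-disjoint) is dependent.  If instead C₄ ∪ C₄ is independent, it spans both complete
-- bipartite graphs containing it, hence K₈, and then M has rank at most n.  Therefore M ⪰ 𝓔 forces M = 𝓔.
-- The second maximal elevation is the truncation of 𝓔 to rank 8 with all circuit-hyperplanes C₄ ∪ C₄
-- relaxed.  Above it every K₈ has rank 8, which is already the rank of K₇, so the rank cannot grow,
-- and the other dependent sets of size at most 8 are forced by the rank bounds above.

module Submission where

open import Defs
open import Data.Nat using (ℕ; zero; suc; _+_; _∸_; _≤_; _<_; _≤?_; _<?_; z≤n; s≤s)
open import Data.Nat.Properties using (≤-refl; ≤-reflexive; ≤-trans; ≤-antisym; ≤-pred; <-irrefl; <⇒≤; ≰⇒>; ≮⇒≥; <-≤-trans; ≤-irrelevant; n≤1+n; m≤n+m; +-mono-≤; +-monoˡ-≤; +-monoʳ-≤; +-suc; +-comm; +-assoc; +-identityʳ)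
open import Data.Nat.ListAction using (sum)
open import Data.Fin as Fin using (Fin; zero; suc)
open import Data.Fin.Properties as Finₚ using (_≟_; injective⇒≤) renaming (_<?_ to _<ᶠ?_)
open import Data.Bool using (Bool; true; false; if_then_else_; _∧_; not)
import Data.Bool.Properties as Boolₚ
open import Data.List using (List; []; _∷_; [_]; _++_; map; concatMap; filter; length; lookup; allFin)
open import Data.List.Properties using (length-map; length-++)
open import Data.List.Membership.Propositional using (_∈_; _∉_; find; lose)
open import Data.List.Membership.Propositional.Properties using (∈-concatMap⁺; ∈-concatMap⁻; ∈-allFin; ∈-lookup; ∈-filter⁺; ∈-filter⁻; ∈-map⁺; ∈-map⁻; ∈-++⁺ˡ; ∈-++⁺ʳ; ∈-++⁻)
open import Data.List.Relation.Unary.Any as Any using (Any; here; there; any?)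
open import Data.List.Relation.Unary.Any.Properties using (lookup-index)
open import Data.List.Relation.Unary.All as All using (All; []; _∷_; all?)
import Data.List.Relation.Unary.All.Properties as Allₚ
open import Data.List.Relation.Unary.AllPairs as AllPairs using (AllPairs; []; _∷_)
import Data.List.Relation.Unary.AllPairs.Properties as AllPairsₚ
open import Data.List.Relation.Unary.Unique.Propositional using (Unique)
import Data.List.Relation.Unary.Unique.Propositional.Properties as Uniqueₚ
open import Data.Product using (∃-syntax; _×_; _,_; proj₁; proj₂)
open import Data.Sum using (_⊎_; inj₁; inj₂; [_,_]′)
open import Data.Empty using (⊥; ⊥-elim)
open import Function using (_∘_; id)
open import Relation.Nullary using (¬_; Dec; yes; no; contradiction)
open import Relation.Nullary.Decidable using (True; toWitness; _×-dec_; _⊎-dec_; _→-dec_; ¬?; map′; decidable-stable)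
open import Relation.Unary using (Decidable)
open import Relation.Binary.PropositionalEquality using (_≡_; _≢_; refl; sym; trans; cong; cong₂; subst)
open import Data.Fin using (toℕ; punchIn; inject≤)
open import Data.Fin.Patterns
open import Data.Fin.Properties using (punchInᵢ≢i; punchIn-injective; inject≤-injective) renaming (any? to anyFin?)
open import Data.List using (tabulate)
open import Data.List.Properties using (length-tabulate)
open import Data.List.Membership.Propositional.Properties using (∈-tabulate⁺; ∈-tabulate⁻)
open import Data.Nat.Properties using (+-cancelˡ-≤; +-mono-<; m+[n∸m]≡n)
import Data.Nat.Properties as ℕₚ
open import Data.Unit using (⊤; tt)
open import Relation.Binary.Definitions using (tri<; tri≈; tri>)
open import Relation.Binary.Construct.Closure.ReflexiveTransitive using (Star; ε; _◅_; _◅◅_)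

-- The number 8 comes from a count. Take a set of nullity at least two with at most eight edges and
-- delete pendant edges until a set D of minimum degree two on m vertices is left. If |D| ≥ m + 2,
-- the bound m + 1 for complete graphs makes D dependent. If |D| = m + 1, then D has rank below m,
-- some nonzero vector x is killed by D, and the bound m for the hyperplane of x makes D dependent;
-- here m ≤ 7 leaves no room for a C₄ ∪ C₄. Only |D| ≤ m gives freedom: the vectors killed by D then
-- form a space of dimension at least two, and with at most eight edges this happens for C₄ ∪ C₄
-- alone. With at most six edges the first two cases yield exactly K₄ and K₂₃, which is why the
-- truncation to rank 6 is `U`. The field 𝔽₃ is chosen because its characteristic is not two, so
-- that odd cycles are independent, and because it is finite, so that the existence of a vector with
-- a decidable property is decidable. Spans never appear as linear combinations of edges: that L
-- spans F is expressed by saying that every vector killed by L is killed by F.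

private variable n k : ℕ

-- Counting in lists without repetitions

opaque
  lookup-injective : {A : Set} {xs : List A} → Unique xs → ∀ {i j} → lookup xs i ≡ lookup xs j → i ≡ j
  lookup-injective (px ∷ u) {zero}  {zero}  eq = refl
  lookup-injective {xs = x ∷ xs} (px ∷ u) {zero}  {suc j} eq = contradiction eq (All.lookup px (∈-lookup j))
  lookup-injective {xs = x ∷ xs} (px ∷ u) {suc i} {zero}  eq = contradiction (sym eq) (All.lookup px (∈-lookup i))
  lookup-injective (px ∷ u) {suc i} {suc j} eq = cong suc (lookup-injective u eq)

unique-length-≤ : {A : Set} {xs ys : List A} → Unique xs → (∀ {x} → x ∈ xs → x ∈ ys) → length xs ≤ length ys
unique-length-≤ {xs = xs} {ys} u sub = injective⇒≤ {f = f} inj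
  where
  f : Fin (length xs) → Fin (length ys)
  f i = Any.index (sub (∈-lookup i))
  inj : ∀ {i j} → f i ≡ f j → i ≡ j
  inj {i} {j} eq = lookup-injective u
    (trans (lookup-index (sub (∈-lookup i))) (trans (cong (lookup ys) eq) (sym (lookup-index (sub (∈-lookup j))))))

-- Edge sets

edge-≡ : {e f : Edge n} → src e ≡ src f → tgt e ≡ tgt f → e ≡ f
edge-≡ {e = i , j , p} {f = .i , .j , q} refl refl = cong (λ r → i , j , r) (≤-irrelevant p q)

_≟ᵉ_ : (e f : Edge n) → Dec (e ≡ f)
e ≟ᵉ f = map′ (λ (p , q) → edge-≡ p q) (λ { refl → refl , refl }) ((src e ≟ src f) ×-dec (tgt e ≟ tgt f))

pick : (i j : Fin n) → List (Edge n)
pick i j with i <ᶠ? j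
... | yes p = [ (i , j , p) ]
... | no _  = []

concatMap-cong₂ : {A : Set} {f g : Fin n → Fin n → List A} (xs ys : List (Fin n)) → (∀ i j → f i j ≡ g i j) →
  concatMap (λ i → concatMap (λ j → f i j) ys) xs ≡ concatMap (λ i → concatMap (λ j → g i j) ys) xs
concatMap-cong₂ {f = f} {g} [] ys eq = refl
concatMap-cong₂ {f = f} {g} (x ∷ xs) ys eq = cong₂ _++_ (inner ys) (concatMap-cong₂ xs ys eq)
  where
  inner : ∀ zs → concatMap (f x) zs ≡ concatMap (g x) zs
  inner [] = refl
  inner (z ∷ zs) = cong₂ _++_ (eq x z) (inner zs)

-- The underscore is solved by the local function of Defs.allEdges, which has no name here.
mutual
  allEdges-pick : ∀ n → allEdges n ≡ concatMap (λ i → concatMap (λ j → pick i j) (allFin n)) (allFin n)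
  allEdges-pick n = concatMap-cong₂ (allFin n) (allFin n) (local-pick n)

  local-pick : ∀ n i j → _ ≡ pick {n} i j
  local-pick n i j with i <ᶠ? j
  ... | yes p = refl
  ... | no _  = refl

pick-∈ : (e : Edge n) → e ∈ pick (src e) (tgt e)
pick-∈ (i , j , p) with i <ᶠ? j
... | yes q = here (edge-≡ refl refl)
... | no ¬q = contradiction p ¬q

∈-pick : ∀ (i j : Fin n) {e} → e ∈ pick i j → src e ≡ i × tgt e ≡ j
∈-pick i j e∈ with i <ᶠ? j
∈-pick i j (here refl) | yes p = refl , refl

pick-unique : ∀ (i j : Fin n) → Unique (pick i j)
pick-unique i j with i <ᶠ? j
... | yes p = [] ∷ []
... | no _  = []

∈-allEdges : (e : Edge n) → e ∈ allEdges n
∈-allEdges {n} e = subst (e ∈_) (sym (allEdges-pick n))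
  (∈-concatMap⁺ _ (lose (∈-allFin (src e)) (∈-concatMap⁺ _ (lose (∈-allFin (tgt e)) (pick-∈ e)))))

concatMap-unique : {A B : Set} {f : A → List B} {xs : List A} → Unique xs → (∀ x → Unique (f x)) →
  (∀ {x y z} → z ∈ f x → z ∈ f y → x ≡ y) → Unique (concatMap f xs)
concatMap-unique {f = f} {xs} u uf inj = Uniqueₚ.concat⁺ (Allₚ.map⁺ (All.universal uf xs))
  (AllPairsₚ.map⁺ (AllPairs.map (λ x≢y {_} (p , q) → x≢y (inj p q)) u))

allEdges-unique : ∀ n → Unique (allEdges n)
allEdges-unique n = subst Unique (sym (allEdges-pick n))
  (concatMap-unique (Uniqueₚ.allFin⁺ n) row (λ p q → trans (sym (src-row _ p)) (src-row _ q)))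
  where
  row : ∀ i → Unique (concatMap (λ j → pick i j) (allFin n))
  row i = concatMap-unique (Uniqueₚ.allFin⁺ n) (pick-unique i)
    (λ {j} {j′} p q → trans (sym (proj₂ (∈-pick i j p))) (proj₂ (∈-pick i j′ q)))
  src-row : ∀ i {e} → e ∈ concatMap (λ j → pick i j) (allFin n) → src e ≡ i
  src-row i e∈ with find (∈-concatMap⁻ (λ j → pick i j) {xs = allFin n} e∈)
  ... | j , _ , q = proj₁ (∈-pick i j q)

checkEdges : {P : Edge n → Set} (P? : Decidable P) → True (all? P? (allEdges n)) → ∀ e → P e
checkEdges P? t e = All.lookup (toWitness t) (∈-allEdges e)

elems : ESet n → List (Edge n)
elems {n} S = filter (λ e → S e Boolₚ.≟ true) (allEdges n)

∈-elems : {S : ESet n} → ∀ {e} → S e ≡ true → e ∈ elems S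
∈-elems {S = S} p = ∈-filter⁺ (λ e → S e Boolₚ.≟ true) (∈-allEdges _) p

elems-∈ : {S : ESet n} → ∀ {e} → e ∈ elems S → S e ≡ true
elems-∈ {n} {S = S} p = proj₂ (∈-filter⁻ (λ e → S e Boolₚ.≟ true) {xs = allEdges n} p)

elems-unique : (S : ESet n) → Unique (elems S)
elems-unique {n} S = Uniqueₚ.filter⁺ (λ e → S e Boolₚ.≟ true) (allEdges-unique n)

size-elems : (S : ESet n) → size S ≡ length (elems S)
size-elems {n} S = go (allEdges n)
  where
  go : ∀ xs → sum (map (λ e → if S e then 1 else 0) xs) ≡ length (filter (λ e → S e Boolₚ.≟ true) xs)
  go [] = refl
  go (e ∷ xs) with S e
  ... | true  = cong suc (go xs)
  ... | false = go xs

size-≤ : {S : ESet n} (L : List (Edge n)) → (∀ e → S e ≡ true → e ∈ L) → size S ≤ length L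
size-≤ {S = S} L sub = subst (_≤ length L) (sym (size-elems S))
  (unique-length-≤ (elems-unique S) (λ p → sub _ (elems-∈ {S = S} p)))

size-≥ : {S : ESet n} {L : List (Edge n)} → Unique L → (∀ {e} → e ∈ L → S e ≡ true) → length L ≤ size S
size-≥ {S = S} {L} u sub = subst (length L ≤_) (sym (size-elems S))
  (unique-length-≤ u (λ p → ∈-elems {S = S} (sub p)))

⊆-trans : {S T W : ESet n} → S ⊆ T → T ⊆ W → S ⊆ W
⊆-trans p q e = q e ∘ p e

size-mono : {S T : ESet n} → S ⊆ T → size S ≤ size T
size-mono {S = S} {T} sub = subst (size S ≤_) (sym (size-elems T)) (size-≤ (elems T) (λ e p → ∈-elems {S = T} (sub e p)))

sameEdge-refl : (e : Edge n) → sameEdge e e ≡ true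
sameEdge-refl e with src e ≟ src e | tgt e ≟ tgt e
... | yes _ | yes _ = refl
... | yes _ | no ¬p = contradiction refl ¬p
... | no ¬p | _     = contradiction refl ¬p

sameEdge⇒≡ : {e f : Edge n} → sameEdge e f ≡ true → e ≡ f
sameEdge⇒≡ {e = e} {f} eq with src e ≟ src f | tgt e ≟ tgt f
... | yes p | yes q = edge-≡ p q

insert-here : ∀ (e : Edge n) S → insert e S e ≡ true
insert-here e S rewrite sameEdge-refl e = Boolₚ.∨-zeroʳ (S e)

insert-there : ∀ (e : Edge n) S → S ⊆ insert e S
insert-there e S f p rewrite p = refl

insert-inv : ∀ (e : Edge n) S {f} → insert e S f ≡ true → S f ≡ true ⊎ f ≡ e
insert-inv e S {f} p with S f
... | true  = inj₁ refl
... | false = inj₂ (sameEdge⇒≡ p)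

insert-⊆ : ∀ {e : Edge n} {S T} → S ⊆ T → T e ≡ true → insert e S ⊆ T
insert-⊆ {e = e} {S} sub p f q with insert-inv e S q
... | inj₁ r    = sub f r
... | inj₂ refl = p

remove : Edge n → ESet n → ESet n
remove e S x = S x ∧ not (sameEdge x e)

remove-⊆ : ∀ (e : Edge n) S → remove e S ⊆ S
remove-⊆ e S f p with S f
... | true = refl

remove-≢ : ∀ (e : Edge n) S {f} → remove e S f ≡ true → f ≢ e
remove-≢ e S {f} p refl rewrite sameEdge-refl e with S f
remove-≢ e S () refl | true
remove-≢ e S () refl | false

remove-intro : ∀ (e : Edge n) S {f} → S f ≡ true → f ≢ e → remove e S f ≡ true
remove-intro e S {f} p f≢e with sameEdge f e in eq
... | true  = contradiction (sameEdge⇒≡ eq) f≢e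
... | false rewrite p = refl

⊆-insert-remove : ∀ (e : Edge n) S → S ⊆ insert e (remove e S)
⊆-insert-remove e S f p with f ≟ᵉ e
... | yes refl = insert-here e (remove e S)
... | no f≢e   = insert-there e (remove e S) f (remove-intro e S p f≢e)

remove-insert-⊆ : ∀ (e : Edge n) S → remove e (insert e S) ⊆ S
remove-insert-⊆ e S f p with insert-inv e S (remove-⊆ e (insert e S) f p)
... | inj₁ q = q
... | inj₂ q = contradiction q (remove-≢ e (insert e S) p)

false≢true : {b : Bool} → b ≡ false → b ≢ true
false≢true refl ()

size-insert : ∀ {e : Edge n} {S} → S e ≡ false → size (insert e S) ≡ suc (size S)
size-insert {e = e} {S} e∉S = ≤-antisym
  (subst (λ m → size (insert e S) ≤ suc m) (sym (size-elems S)) (size-≤ (e ∷ elems S) upper))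
  (subst (λ m → suc m ≤ size (insert e S)) (sym (size-elems S)) (size-≥ (fresh ∷ elems-unique S) lower))
  where
  upper : ∀ f → insert e S f ≡ true → f ∈ e ∷ elems S
  upper f p with insert-inv e S p
  ... | inj₁ q    = there (∈-elems {S = S} q)
  ... | inj₂ refl = here refl
  fresh : All (e ≢_) (elems S)
  fresh = All.tabulate λ { p refl → false≢true e∉S (elems-∈ {S = S} p) }
  lower : ∀ {f} → f ∈ e ∷ elems S → insert e S f ≡ true
  lower (here refl) = insert-here e S
  lower (there p)   = insert-there e S _ (elems-∈ {S = S} p)

size-insert-≤ : ∀ (e : Edge n) S → size (insert e S) ≤ suc (size S)
size-insert-≤ e S with S e in eq
... | false = ≤-reflexive (size-insert {e = e} {S} eq)
... | true  = ≤-trans (size-mono {S = insert e S} {S} (insert-⊆ {e = e} {S} {S} (λ _ p → p) eq)) (n≤1+n _)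

size-≤-remove : ∀ (e : Edge n) S → size S ≤ suc (size (remove e S))
size-≤-remove e S = ≤-trans (size-mono {S = S} (⊆-insert-remove e S)) (size-insert-≤ e (remove e S))

size-remove : ∀ {e : Edge n} {S} → S e ≡ true → suc (size (remove e S)) ≡ size S
size-remove {e = e} {S} p = ≤-antisym
  (subst (_≤ size S) (size-insert {e = e} {remove e S} e∉) (size-mono {S = insert e (remove e S)} {S} (insert-⊆ {e = e} {remove e S} (remove-⊆ e S) p)))
  (size-≤-remove e S)
  where
  e∉ : remove e S e ≡ false
  e∉ rewrite sameEdge-refl e = Boolₚ.∧-zeroʳ (S e)

⊆-or-witness : (S T : ESet n) → T ⊆ S ⊎ ∃[ e ] (T e ≡ true × S e ≡ false)
⊆-or-witness {n} S T with any? (λ e → (T e Boolₚ.≟ true) ×-dec (S e Boolₚ.≟ false)) (allEdges n)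
... | yes a = inj₂ (let e , _ , p = find a in e , p)
... | no ¬a = inj₁ λ e p → decidable-stable (S e Boolₚ.≟ true) (λ q → ¬a (lose (∈-allEdges e) (p , Boolₚ.¬-not q)))

larger : {S T : ESet n} → size S < size T → ∃[ e ] (T e ≡ true × S e ≡ false)
larger {S = S} {T} lt with ⊆-or-witness S T
... | inj₁ sub = contradiction (≤-trans lt (size-mono {S = T} {S} sub)) (<-irrefl refl)
... | inj₂ w   = w

⊆-full : {S T : ESet n} → S ⊆ T → size T ≤ size S → T ⊆ S
⊆-full {S = S} {T} sub le with ⊆-or-witness S T
... | inj₁ r = r
... | inj₂ (e , p , q) = contradiction
  (≤-trans (≤-reflexive (sym (size-insert {e = e} {S} q))) (≤-trans (size-mono {S = insert e S} {T} (insert-⊆ {e = e} {S} sub p)) le)) (<-irrefl refl)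

size-∅ : size (∅ {n}) ≡ 0
size-∅ {n} = ≤-antisym (size-≤ {S = ∅ {n}} [] (λ _ ())) z≤n

shrink : ∀ k (S : ESet n) → k ≤ size S → ∃[ S′ ] (S′ ⊆ S × size S′ ≡ k)
shrink {n} k S le = go (size S ∸ k) S (sym (m+[n∸m]≡n le))
  where
  go : ∀ d (S : ESet n) → size S ≡ k + d → ∃[ S′ ] (S′ ⊆ S × size S′ ≡ k)
  go zero    S eq = S , (λ _ p → p) , trans eq (+-identityʳ k)
  go (suc d) S eq with larger {S = ∅} {S} (≤-trans (s≤s (≤-reflexive (size-∅ {n}))) (≤-trans (s≤s z≤n) (≤-reflexive (sym (trans eq (+-suc k d))))))
  ... | e , p , _ with go d (remove e S) (ℕₚ.suc-injective (trans (size-remove {e = e} {S} p) (trans eq (+-suc k d))))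
  ... | S′ , sub , eq′ = S′ , ⊆-trans {S = S′} {remove e S} {S} sub (remove-⊆ e S) , eq′

fromList : List (Edge n) → ESet n
fromList []      = ∅
fromList (e ∷ L) = insert e (fromList L)

fromList-∈ : ∀ (L : List (Edge n)) {e} → e ∈ L → fromList L e ≡ true
fromList-∈ (f ∷ L) (here refl) = insert-here f (fromList L)
fromList-∈ (f ∷ L) (there p)   = insert-there f (fromList L) _ (fromList-∈ L p)

∈-fromList : ∀ (L : List (Edge n)) {e} → fromList L e ≡ true → e ∈ L
∈-fromList (f ∷ L) p with insert-inv f (fromList L) p
... | inj₁ q    = there (∈-fromList L q)
... | inj₂ refl = here refl

size-fromList-≤ : (L : List (Edge n)) → size (fromList L) ≤ length L
size-fromList-≤ L = size-≤ L (λ e → ∈-fromList L)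

-- Linear algebra over 𝔽₃

data 𝔽₃ : Set where
  𝟎 𝟏 𝟐 : 𝔽₃

infix 4 _≟₃_
infixl 6 _⊕_
infixl 7 _⊗_

_⊕_ : 𝔽₃ → 𝔽₃ → 𝔽₃
𝟎 ⊕ b = b
𝟏 ⊕ 𝟎 = 𝟏
𝟏 ⊕ 𝟏 = 𝟐
𝟏 ⊕ 𝟐 = 𝟎
𝟐 ⊕ 𝟎 = 𝟐
𝟐 ⊕ 𝟏 = 𝟎
𝟐 ⊕ 𝟐 = 𝟏

_⊗_ : 𝔽₃ → 𝔽₃ → 𝔽₃
𝟎 ⊗ b = 𝟎
𝟏 ⊗ b = b
𝟐 ⊗ 𝟎 = 𝟎
𝟐 ⊗ 𝟏 = 𝟐
𝟐 ⊗ 𝟐 = 𝟏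

_≟₃_ : (a b : 𝔽₃) → Dec (a ≡ b)
𝟎 ≟₃ 𝟎 = yes refl
𝟎 ≟₃ 𝟏 = no λ ()
𝟎 ≟₃ 𝟐 = no λ ()
𝟏 ≟₃ 𝟎 = no λ ()
𝟏 ≟₃ 𝟏 = yes refl
𝟏 ≟₃ 𝟐 = no λ ()
𝟐 ≟₃ 𝟎 = no λ ()
𝟐 ≟₃ 𝟏 = no λ ()
𝟐 ≟₃ 𝟐 = yes refl

-- Settles the field identities and small linear systems by trying all values.
all₃? : {P : 𝔽₃ → Set} → Decidable P → Dec (∀ a → P a)
all₃? P? = map′ (λ { (p , q , r) → λ { 𝟎 → p ; 𝟏 → q ; 𝟐 → r } }) (λ f → f 𝟎 , f 𝟏 , f 𝟐) (P? 𝟎 ×-dec P? 𝟏 ×-dec P? 𝟐)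

opaque
  ⊕-comm : ∀ a b → a ⊕ b ≡ b ⊕ a
  ⊕-comm = toWitness {a? = all₃? λ a → all₃? λ b → a ⊕ b ≟₃ b ⊕ a} _

opaque
  ⊕-interchange : ∀ c a b a′ b′ → (a ⊕ c ⊗ b) ⊕ (a′ ⊕ c ⊗ b′) ≡ (a ⊕ a′) ⊕ c ⊗ (b ⊕ b′)
  ⊕-interchange = toWitness {a? = all₃? λ c → all₃? λ a → all₃? λ b → all₃? λ a′ → all₃? λ b′ →
    (a ⊕ c ⊗ b) ⊕ (a′ ⊕ c ⊗ b′) ≟₃ (a ⊕ a′) ⊕ c ⊗ (b ⊕ b′)} _

opaque
  -- A nonzero b has b² = 1 and is its own inverse, so 2ab is the coefficient -a/b of an elimination
  -- step.
  pivot : ∀ a b → b ≢ 𝟎 → a ⊕ 𝟐 ⊗ (a ⊗ b) ⊗ b ≡ 𝟎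
  pivot = toWitness {a? = all₃? λ a → all₃? λ b → ¬? (b ≟₃ 𝟎) →-dec (a ⊕ 𝟐 ⊗ (a ⊗ b) ⊗ b ≟₃ 𝟎)} _

opaque
  ⊗-zeroʳ : ∀ c → c ⊗ 𝟎 ≡ 𝟎
  ⊗-zeroʳ = toWitness {a? = all₃? λ c → c ⊗ 𝟎 ≟₃ 𝟎} _

opaque
  ⊕-⊗𝟎 : ∀ c a → a ⊕ c ⊗ 𝟎 ≡ a
  ⊕-⊗𝟎 = toWitness {a? = all₃? λ c → all₃? λ a → a ⊕ c ⊗ 𝟎 ≟₃ a} _

𝟏≢𝟎 : 𝟏 ≢ 𝟎
𝟏≢𝟎 ()

V : ℕ → Set
V n = Fin n → 𝔽₃

comb : V n → 𝔽₃ → V n → V n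
comb x c y i = x i ⊕ c ⊗ y i

record Functional (n : ℕ) : Set where
  constructor functional
  infix 9 _⟨_⟩
  field
    _⟨_⟩ : V n → 𝔽₃
    linear : ∀ x c y → _⟨_⟩ (comb x c y) ≡ _⟨_⟩ x ⊕ c ⊗ _⟨_⟩ y
open Functional

coordinate : Fin n → Functional n
coordinate i = functional (λ x → x i) (λ x c y → refl)

infix 8 _∙_

_∙_ : V n → Edge n → 𝔽₃
x ∙ e = x (src e) ⊕ x (tgt e)

edge-functional : Edge n → Functional n
edge-functional e = functional (_∙ e) (λ x c y → ⊕-interchange c (x (src e)) (y (src e)) (x (tgt e)) (y (tgt e)))

∙-linear : ∀ x c y (e : Edge n) → comb x c y ∙ e ≡ x ∙ e ⊕ c ⊗ (y ∙ e)
∙-linear x c y e = linear (edge-functional e) x c y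

comb-kernel : (f : Functional n) {x y : V n} (c : 𝔽₃) → f ⟨ x ⟩ ≡ 𝟎 → f ⟨ y ⟩ ≡ 𝟎 → f ⟨ comb x c y ⟩ ≡ 𝟎
comb-kernel f {x} {y} c fx fy = trans (linear f x c y) (trans (cong₂ (λ a b → a ⊕ c ⊗ b) fx fy) (⊗-zeroʳ c))

-- If more than |L| functionals t j have dual vectors x j, then some combination y of the x j
-- is killed by all of L but not by all of the t j.  Each f ∈ L costs one dual pair.
steinitz : (P : V n → Set) → (∀ {x y} c → P x → P y → P (comb x c y)) →
  (L : List (Functional n)) → length L < k →
  (t : Fin k → Functional n) (x : Fin k → V n) → (∀ j → P (x j)) →
  (∀ j → t j ⟨ x j ⟩ ≡ 𝟏) → (∀ {j l} → j ≢ l → t l ⟨ x j ⟩ ≡ 𝟎) →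
  ∃[ j ] ∃[ y ] (P y × All (λ f → f ⟨ y ⟩ ≡ 𝟎) L × t j ⟨ y ⟩ ≡ 𝟏)
steinitz {k = suc k} P cl [] lt t x px diag off = zero , x zero , px zero , [] , diag zero
steinitz {n} {k = suc k} P cl (f ∷ L) (s≤s lt) t x px diag off with anyFin? (λ j → ¬? (f ⟨ x j ⟩ ≟₃ 𝟎))
... | no none =
  -- If `f` already kills every x j, dropping any one pair will do. The predicate grows by the
  -- condition f = 0, so the vector returned by the recursion is killed by `f` as well.
  let j , y , (py , fy) , ay , ty = steinitz (λ y → P y × f ⟨ y ⟩ ≡ 𝟎) (λ c (p , fx) (q , fy) → cl c p q , comb-kernel f c fx fy) L lt (t ∘ suc) (x ∘ suc)
        (λ j → px (suc j) , decidable-stable (f ⟨ x (suc j) ⟩ ≟₃ 𝟎) (λ ne → none (suc j , ne)))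
        (diag ∘ suc) (λ j≢l → off (j≢l ∘ Finₚ.suc-injective))
  in suc j , y , py , fy ∷ ay , ty
... | yes (j₀ , ne) =
  let j , y , (py , fy) , ay , ty = steinitz (λ y → P y × f ⟨ y ⟩ ≡ 𝟎) (λ c (p , fx) (q , fy) → cl c p q , comb-kernel f c fx fy) L lt (t ∘ punchIn j₀) x′ px′
        (λ j → trans (t-x′ j j) (diag (punchIn j₀ j)))
        (λ {j} {l} j≢l → trans (t-x′ j l) (off (j≢l ∘ punchIn-injective j₀ j l)))
  in punchIn j₀ j , y , py , fy ∷ ay , ty
  where
  coeff : Fin k → 𝔽₃
  coeff l = 𝟐 ⊗ (f ⟨ x (punchIn j₀ l) ⟩ ⊗ f ⟨ x j₀ ⟩)
  x′ : Fin k → V n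
  x′ l = comb (x (punchIn j₀ l)) (coeff l) (x j₀)
  px′ : ∀ l → P (x′ l) × f ⟨ x′ l ⟩ ≡ 𝟎
  px′ l = cl (coeff l) (px _) (px j₀) , trans (linear f (x (punchIn j₀ l)) (coeff l) (x j₀)) (pivot (f ⟨ x (punchIn j₀ l) ⟩) (f ⟨ x j₀ ⟩) ne)
  -- The pairs stay dual after subtracting a multiple of x j₀, because the remaining functionals
  -- vanish on x j₀.
  t-x′ : ∀ j l → t (punchIn j₀ l) ⟨ x′ j ⟩ ≡ t (punchIn j₀ l) ⟨ x (punchIn j₀ j) ⟩
  t-x′ j l = trans (linear (t (punchIn j₀ l)) (x (punchIn j₀ j)) (coeff j) (x j₀))
    (trans (cong (λ b → t (punchIn j₀ l) ⟨ x (punchIn j₀ j) ⟩ ⊕ coeff j ⊗ b) (off (punchInᵢ≢i j₀ l ∘ sym))) (⊕-⊗𝟎 (coeff j) _))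

-- Linear independence of edge sets and the elongation

Ker : V n → ESet n → Set
Ker x S = ∀ e → S e ≡ true → x ∙ e ≡ 𝟎

Ker-⊆ : {x : V n} {S T : ESet n} → S ⊆ T → Ker x T → Ker x S
Ker-⊆ sub kx e p = kx e (sub e p)

-- Linear independence over 𝔽₃ of the vectors δ_i + δ_j (ij ∈ S), witnessed by a dual family.
Indep : ESet n → Set
Indep {n} S = ∀ e → S e ≡ true → ∃[ x ] (x ∙ e ≡ 𝟏 × (∀ f → S f ≡ true → f ≢ e → x ∙ f ≡ 𝟎))

Indep-⊆ : {S T : ESet n} → S ⊆ T → Indep T → Indep S
Indep-⊆ sub ind e p = let x , xe , xf = ind e (sub e p) in x , xe , λ f q → xf f (sub f q)

-- Steinitz exchange in dual form: `x` certifies that `e` lies outside the span of `L`. The dual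
-- family is the one that witnesses the independence of `T`.
Indep-augment : {T : ESet n} → Indep T → (L : List (Edge n)) → length L < size T →
  ∃[ e ] ∃[ x ] (T e ≡ true × (∀ {f} → f ∈ L → x ∙ f ≡ 𝟎) × x ∙ e ≡ 𝟏)
Indep-augment {n} {T} ind L lt =
  let j , y , _ , ay , ty = steinitz (λ _ → ⊤) (λ _ _ _ → tt) (map edge-functional L)
        (subst (_< length (elems T)) (sym (length-map edge-functional L)) (subst (length L <_) (size-elems T) lt))
        (λ j → edge-functional (lookup (elems T) j)) (λ j → proj₁ (dual j)) (λ _ → tt)
        (λ j → proj₁ (proj₂ (dual j)))
        (λ {j} {l} j≢l → proj₂ (proj₂ (dual j)) _ (in-T l) (λ eq → j≢l (sym (lookup-injective (elems-unique T) eq))))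
  in lookup (elems T) j , y , in-T j , (λ p → All.lookup (Allₚ.map⁻ ay) p) , ty
  where
  in-T : ∀ j → T (lookup (elems T) j) ≡ true
  in-T j = elems-∈ {S = T} (∈-lookup j)
  dual : ∀ j → ∃[ x ] (x ∙ lookup (elems T) j ≡ 𝟏 × (∀ f → T f ≡ true → f ≢ lookup (elems T) j → x ∙ f ≡ 𝟎))
  dual j = ind _ (in-T j)

-- The vector `x` plays two roles: a multiple of it is added to each old dual vector to make that
-- vector vanish on `e`, and a rescaled copy is the dual vector of `e`.
Indep-insert : {S : ESet n} {e : Edge n} {x : V n} → Indep S → Ker x S → x ∙ e ≢ 𝟎 → Indep (insert e S)
Indep-insert {n} {S} {e} {x} ind kx xe≢0 g p with insert-inv e S p
... | inj₁ g∈S = y′ , trans (y′∙ g (kx g g∈S)) yg , zeros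
  where
  y = proj₁ (ind g g∈S)
  yg = proj₁ (proj₂ (ind g g∈S))
  c = 𝟐 ⊗ ((y ∙ e) ⊗ (x ∙ e))
  y′ : V n
  y′ = comb y c x
  y′∙ : ∀ f → x ∙ f ≡ 𝟎 → y′ ∙ f ≡ y ∙ f
  y′∙ f xf = trans (∙-linear y c x f) (trans (cong (λ b → y ∙ f ⊕ c ⊗ b) xf) (⊕-⊗𝟎 c _))
  zeros : ∀ f → insert e S f ≡ true → f ≢ g → y′ ∙ f ≡ 𝟎
  zeros f q f≢g with insert-inv e S q
  ... | inj₁ f∈S  = trans (y′∙ f (kx f f∈S)) (proj₂ (proj₂ (ind g g∈S)) f f∈S f≢g)
  ... | inj₂ refl = trans (∙-linear y c x e) (pivot (y ∙ e) (x ∙ e) xe≢0)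
-- The scalar `x ∙ e` is its own inverse, so scaling by it gives the value 1 on `e`.
... | inj₂ refl = comb (λ _ → 𝟎) (x ∙ e) x , trans (∙-linear (λ _ → 𝟎) (x ∙ e) x e) (square (x ∙ e) xe≢0) , zeros
  where
  square : ∀ a → a ≢ 𝟎 → a ⊗ a ≡ 𝟏
  square 𝟎 a≢0 = contradiction refl a≢0
  square 𝟏 _ = refl
  square 𝟐 _ = refl
  zeros : ∀ f → insert e S f ≡ true → f ≢ e → comb (λ _ → 𝟎) (x ∙ e) x ∙ f ≡ 𝟎
  zeros f q f≢e with insert-inv e S q
  ... | inj₁ f∈S = trans (∙-linear (λ _ → 𝟎) (x ∙ e) x f) (trans (cong ((x ∙ e) ⊗_) (kx f f∈S)) (⊗-zeroʳ (x ∙ e)))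
  ... | inj₂ f≡e = contradiction f≡e f≢e

-- The elongation of the even cycle matroid.
𝓔 : IndPred n
𝓔 S = Indep S ⊎ ∃[ e ] Indep (remove e S)

𝓔-⊆ : (S T : ESet n) → S ⊆ T → 𝓔 T → 𝓔 S
𝓔-⊆ S T sub (inj₁ ind) = inj₁ (Indep-⊆ {S = S} {T} sub ind)
𝓔-⊆ S T sub (inj₂ (e , ind)) = inj₂ (e , Indep-⊆ {S = remove e S} {remove e T}
  (λ f p → remove-intro e T (sub f (remove-⊆ e S f p)) (remove-≢ e S p)) ind)

𝓔-core : {S : ESet n} → 𝓔 S → ∃[ J ] (J ⊆ S × Indep J × size S ≤ suc (size J))
𝓔-core {S = S} (inj₁ ind)       = S , (λ _ p → p) , ind , n≤1+n _
𝓔-core {S = S} (inj₂ (e , ind)) = remove e S , remove-⊆ e S , ind , size-≤-remove e S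

remove-insert-comm : ∀ (e g : Edge n) S → remove e (insert g S) ⊆ insert g (remove e S)
remove-insert-comm e g S f p with insert-inv g S (remove-⊆ e (insert g S) f p)
... | inj₁ q    = insert-there g (remove e S) f (remove-intro e S q (remove-≢ e (insert g S) p))
... | inj₂ refl = insert-here g (remove e S)

𝓔-insert : {S : ESet n} {e : Edge n} {x : V n} → 𝓔 S → Ker x S → x ∙ e ≢ 𝟎 → 𝓔 (insert e S)
𝓔-insert {S = S} {e} {x} (inj₁ ind) kx ne = inj₁ (Indep-insert {S = S} {e} {x} ind kx ne)
𝓔-insert {S = S} {e} {x} (inj₂ (f , ind)) kx ne = inj₂ (f , Indep-⊆ {S = remove f (insert e S)} {insert e (remove f S)}
  (remove-insert-comm f e S) (Indep-insert {S = remove f S} {e} {x} ind (Ker-⊆ {x = x} {remove f S} {S} (remove-⊆ f S) kx) ne))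

-- If S is linearly independent, any edge of T outside S may serve as the one surplus edge. If S is
-- e plus an independent set, the independent core J of T is larger than S without e, so some g in J
-- lies outside its span. Such a g is either new, or it lies in S and must be e; then S was
-- independent after all.
𝓔-matroid : IsMatroid (𝓔 {n})
𝓔-matroid {n} = record { ind-∅ = inj₁ (λ _ ()) ; ind-down = 𝓔-⊆ ; ind-exch = exch }
  where
  Exchange : ESet n → ESet n → Set
  Exchange S T = ∃[ e ] (T e ≡ true × S e ≡ false × 𝓔 (insert e S))
  free : ∀ S T → Indep S → size S < size T → Exchange S T
  free S T ind lt = let e , p , q = larger {S = S} {T} lt in
    e , p , q , inj₂ (e , Indep-⊆ {S = remove e (insert e S)} {S} (remove-insert-⊆ e S) ind)
  augment : ∀ S T e → S e ≡ true → size S < size T → Indep (remove e S) →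
    ∀ g → T g ≡ true → Indep (insert g (remove e S)) → (S g ≡ true → g ≡ e) → ∀ b → S g ≡ b → Exchange S T
  augment S T e e∈S lt ind g g∈T indI g≡e false g∉S =
    g , g∈T , g∉S , inj₂ (e , Indep-⊆ {S = remove e (insert g S)} {insert g (remove e S)} (remove-insert-comm e g S) indI)
  augment S T e e∈S lt ind g g∈T indI g≡e true g∈S = free S T (Indep-⊆ {S = S} {insert g (remove e S)} S⊆ indI) lt
    where
    S⊆ : S ⊆ insert g (remove e S)
    S⊆ = subst (λ h → S ⊆ insert h (remove e S)) (sym (g≡e g∈S)) (⊆-insert-remove e S)
  circuit : ∀ S T e → Indep (remove e S) → 𝓔 T → size S < size T → ∀ b → S e ≡ b → Exchange S T
  circuit S T e ind mT lt false e∉S =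
    free S T (Indep-⊆ {S = S} {remove e S} (λ f p → remove-intro e S p (λ { refl → false≢true e∉S p })) ind) lt
  circuit S T e ind mT lt true e∈S =
    let J , J⊆T , indJ , szT = 𝓔-core {S = T} mT
        g , x , g∈J , kx , xg = Indep-augment {T = J} indJ (elems (remove e S))
          (subst (_< size J) (size-elems (remove e S)) (≤-pred (≤-trans (s≤s (≤-reflexive (size-remove {e = e} {S} e∈S))) (≤-trans lt szT))))
    in augment S T e e∈S lt ind g (J⊆T g g∈J)
         (Indep-insert {S = remove e S} {g} {x} ind (λ f p → kx (∈-elems {S = remove e S} p)) (λ xg≡0 → 𝟏≢𝟎 (trans (sym xg) xg≡0)))
         (λ g∈S → decidable-stable (g ≟ᵉ e) (λ g≢e → 𝟏≢𝟎 (trans (sym xg) (kx (∈-elems {S = remove e S} (remove-intro e S g∈S g≢e))))))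
         (S g) refl
  exch : ∀ S T → 𝓔 S → 𝓔 T → size S < size T → Exchange S T
  exch S T (inj₁ ind) mT lt = free S T ind lt
  exch S T (inj₂ (e , ind)) mT lt = circuit S T e ind mT lt (S e) refl

-- Bases and kernel vectors

anyVector? : {P : V n → Set} → (∀ {x y} → (∀ i → x i ≡ y i) → P x → P y) → Decidable P → Dec (∃[ x ] P x)
anyVector? {zero} {P} resp P? = map′ (λ p → empty , p) (λ (x , p) → resp (λ ()) p) (P? empty)
  where
  empty : V 0
  empty ()
anyVector? {suc n} {P} resp P? = map′ from to (sub? 𝟎 ⊎-dec sub? 𝟏 ⊎-dec sub? 𝟐)
  where
  _◂_ : ∀ {n} → 𝔽₃ → V n → V (suc n)
  (a ◂ x) zero    = a
  (a ◂ x) (suc i) = x i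
  sub? : ∀ a → Dec (∃[ x ] P (a ◂ x))
  sub? a = anyVector? {n} {λ x → P (a ◂ x)} (λ eq → resp (λ { zero → refl ; (suc i) → eq i })) (λ x → P? (a ◂ x))
  from : (∃[ x ] P (𝟎 ◂ x)) ⊎ ((∃[ x ] P (𝟏 ◂ x)) ⊎ (∃[ x ] P (𝟐 ◂ x))) → ∃[ x ] P x
  from (inj₁ (x , p))        = _ , p
  from (inj₂ (inj₁ (x , p))) = _ , p
  from (inj₂ (inj₂ (x , p))) = _ , p
  split : ∀ a x → P (a ◂ x) → (∃[ x ] P (𝟎 ◂ x)) ⊎ ((∃[ x ] P (𝟏 ◂ x)) ⊎ (∃[ x ] P (𝟐 ◂ x)))
  split 𝟎 x p = inj₁ (x , p)
  split 𝟏 x p = inj₂ (inj₁ (x , p))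
  split 𝟐 x p = inj₂ (inj₂ (x , p))
  to : ∃[ x ] P x → (∃[ x ] P (𝟎 ◂ x)) ⊎ ((∃[ x ] P (𝟏 ◂ x)) ⊎ (∃[ x ] P (𝟐 ◂ x)))
  -- A vector agrees only pointwise with the one rebuilt from its head and tail, hence the
  -- hypothesis `resp`.
  to (x , p) = split (x zero) (λ i → x (suc i)) (resp (λ { zero → refl ; (suc i) → refl }) p)

Ker? : (x : V n) (S : ESet n) → Dec (Ker x S)
Ker? {n} x S = map′ (λ a e → All.lookup a (∈-allEdges e)) (λ k → All.tabulate (λ {e} _ → k e))
  (all? (λ e → (S e Boolₚ.≟ true) →-dec (x ∙ e ≟₃ 𝟎)) (allEdges n))

-- Greedy: an edge joins B exactly when some vector killed by B is nonzero on it. The last component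
-- says in dual form that B spans D.
basis : (D : ESet n) → ∃[ B ] (B ⊆ D × Indep B × (∀ x → Ker x B → Ker x D))
basis {n} D = let B , sub , ind , kr = go (elems D) in B , (λ e p → elems-∈ {S = D} (sub e p)) , ind , (λ x kx e p → kr x kx (∈-elems {S = D} p))
  where
  go : ∀ L → ∃[ B ] ((∀ e → B e ≡ true → e ∈ L) × Indep B × (∀ x → Ker x B → ∀ {e} → e ∈ L → x ∙ e ≡ 𝟎))
  go [] = ∅ , (λ _ ()) , (λ _ ()) , (λ _ _ ())
  go (e ∷ L) with go L
  ... | B , sub , ind , kr with anyVector? {n} {λ x → Ker x B × x ∙ e ≢ 𝟎} resp (λ x → Ker? x B ×-dec ¬? (x ∙ e ≟₃ 𝟎))
    where
    resp : ∀ {x y : V n} → (∀ i → x i ≡ y i) → Ker x B × x ∙ e ≢ 𝟎 → Ker y B × y ∙ e ≢ 𝟎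
    resp eq (kx , xe) = (λ f p → trans (sym (cong₂ _⊕_ (eq _) (eq _))) (kx f p)) , (λ ye → xe (trans (cong₂ _⊕_ (eq _) (eq _)) ye))
  ... | yes (x , kx , xe) = insert e B , sub′ , Indep-insert {S = B} {e} {x} ind kx xe , kr′
    where
    sub′ : ∀ f → insert e B f ≡ true → f ∈ e ∷ L
    sub′ f p with insert-inv e B p
    ... | inj₁ q    = there (sub f q)
    ... | inj₂ refl = here refl
    kr′ : ∀ y → Ker y (insert e B) → ∀ {f} → f ∈ e ∷ L → y ∙ f ≡ 𝟎
    kr′ y ky (here refl) = ky e (insert-here e B)
    kr′ y ky (there p)   = kr y (Ker-⊆ {x = y} {B} {insert e B} (insert-there e B) ky) p
  ... | no none = B , (λ f p → there (sub f p)) , ind , kr′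
    where
    kr′ : ∀ y → Ker y B → ∀ {f} → f ∈ e ∷ L → y ∙ f ≡ 𝟎
    kr′ y ky (here refl) = decidable-stable (y ∙ e ≟₃ 𝟎) (λ ne → none (y , ky , ne))
    kr′ y ky (there p)   = kr y ky p

δ : Fin n → V n
δ i j with i ≟ j
... | yes _ = 𝟏
... | no _  = 𝟎

δ-diag : (i : Fin n) → δ i i ≡ 𝟏
δ-diag i with i ≟ i
... | yes _ = refl
... | no ¬p = contradiction refl ¬p

δ-off : {i j : Fin n} → i ≢ j → δ i j ≡ 𝟎
δ-off {i = i} {j} i≢j with i ≟ j
... | yes p = contradiction p i≢j
... | no _  = refl

-- Z and B together impose fewer conditions than there are coordinates in `vs`; `steinitz` is
-- applied to these coordinates, with the unit vectors as dual family.
kernel-vector : (vs : List (Fin n)) → Unique vs → (Z : List (Fin n)) (B : ESet n) → length Z + size B < length vs →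
  ∃[ x ] (Ker x B × (∀ {z} → z ∈ Z → x z ≡ 𝟎) × ∃[ v ] (v ∈ vs × x v ≡ 𝟏))
kernel-vector {n} vs uvs Z B lt =
  let j , y , _ , ay , ty = steinitz (λ _ → ⊤) (λ _ _ _ → tt) L (subst (_< length vs) (sym lenL) lt)
        (λ j → coordinate (lookup vs j)) (λ j → δ (lookup vs j)) (λ _ → tt)
        (λ j → δ-diag (lookup vs j)) (λ j≢l → δ-off (λ eq → j≢l (lookup-injective uvs eq)))
  in y , (λ e p → All.lookup (Allₚ.map⁻ (Allₚ.++⁻ʳ (map coordinate Z) ay)) (∈-elems {S = B} p)) ,
     (λ p → All.lookup (Allₚ.map⁻ (Allₚ.++⁻ˡ (map coordinate Z) ay)) p) , lookup vs j , ∈-lookup j , ty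
  where
  L = map coordinate Z ++ map edge-functional (elems B)
  lenL : length L ≡ length Z + size B
  lenL = trans (length-++ (map coordinate Z)) (cong₂ _+_ (length-map coordinate Z) (trans (length-map edge-functional (elems B)) (sym (size-elems B))))

-- What nullity at least two provides. The rank of D is then at most |D| - 2, so the conditions from
-- Z and D number fewer than |vs| as soon as |Z| + |D| ≤ |vs| + 1.
KernelVectors : ESet n → Set
KernelVectors {n} D = ∀ (vs Z : List (Fin n)) → Unique vs → length Z + size D ≤ suc (length vs) →
  ∃[ x ] (Ker x D × (∀ {z} → z ∈ Z → x z ≡ 𝟎) × ∃[ v ] (v ∈ vs × x v ≡ 𝟏))

-- Compare D with a basis B. Two edges beyond B mean nullity at least two, and vectors killed by B
-- are killed by D. Otherwise at most one edge of D lies outside B, and this is `𝓔`.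
𝓔-or-kernel : (D : ESet n) → 𝓔 D ⊎ KernelVectors D
𝓔-or-kernel {n} D with basis D
... | B , B⊆D , ind , kr with 2 + size B ≤? size D
... | yes le = inj₂ λ vs Z uvs len →
  let x , kx , zx , v = kernel-vector vs uvs Z B (≤-pred (≤-trans (≤-reflexive (eq (length Z) (size B))) (≤-trans (+-monoʳ-≤ (length Z) le) len)))
  in x , kr x kx , zx , v
  where
  eq : ∀ a b → suc (suc (a + b)) ≡ a + suc (suc b)
  eq a b = sym (trans (+-suc a (suc b)) (cong suc (+-suc a b)))
... | no nle with ⊆-or-witness B D
...   | inj₁ D⊆B = inj₁ (inj₁ (Indep-⊆ {S = D} {B} D⊆B ind))
...   | inj₂ (e , e∈D , e∉B) = inj₁ (inj₂ (e , Indep-⊆ {S = remove e D} {B} sub ind))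
  where
  full : D ⊆ insert e B
  full = ⊆-full {S = insert e B} {D} (insert-⊆ {e = e} {B} B⊆D e∈D) (≤-trans (≤-pred (≰⇒> nle)) (≤-reflexive (sym (size-insert {e = e} {B} e∉B))))
  sub : remove e D ⊆ B
  sub f p with insert-inv e B (full f (remove-⊆ e D f p))
  ... | inj₁ q = q
  ... | inj₂ q = contradiction q (remove-≢ e D p)

-- Copies of small graphs

data Joins {n} (e : Edge n) (u v : Fin n) : Set where
  fwd : src e ≡ u × tgt e ≡ v → Joins e u v
  bwd : src e ≡ v × tgt e ≡ u → Joins e u v

joins-self : (e : Edge n) → Joins e (src e) (tgt e)
joins-self e = fwd (refl , refl)

joins-sym : {e : Edge n} {u v : Fin n} → Joins e u v → Joins e v u
joins-sym (fwd p) = bwd p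
joins-sym (bwd p) = fwd p

src≢tgt : (e : Edge n) → src e ≢ tgt e
src≢tgt (i , .i , p) refl = Finₚ.<-irrefl {x = i} refl p

joins-≢ : {e : Edge n} {u v : Fin n} → Joins e u v → u ≢ v
joins-≢ {e = e} (fwd (refl , refl)) eq = src≢tgt e eq
joins-≢ {e = e} (bwd (refl , refl)) eq = src≢tgt e (sym eq)

joins-unique : {e f : Edge n} {u v : Fin n} → Joins e u v → Joins f u v → e ≡ f
joins-unique (fwd (p , q)) (fwd (r , s)) = edge-≡ (trans p (sym r)) (trans q (sym s))
joins-unique (bwd (p , q)) (bwd (r , s)) = edge-≡ (trans p (sym r)) (trans q (sym s))
joins-unique {e = _ , _ , l} {_ , _ , m} (fwd (refl , refl)) (bwd (refl , refl)) = contradiction m (Finₚ.<-asym l)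
joins-unique {e = _ , _ , l} {_ , _ , m} (bwd (refl , refl)) (fwd (refl , refl)) = contradiction m (Finₚ.<-asym l)

joins-ends : {e : Edge n} {u v u′ v′ : Fin n} → Joins e u v → Joins e u′ v′ → (u ≡ u′ × v ≡ v′) ⊎ (u ≡ v′ × v ≡ u′)
joins-ends (fwd (refl , refl)) (fwd (refl , refl)) = inj₁ (refl , refl)
joins-ends (fwd (refl , refl)) (bwd (refl , refl)) = inj₂ (refl , refl)
joins-ends (bwd (refl , refl)) (fwd (refl , refl)) = inj₂ (refl , refl)
joins-ends (bwd (refl , refl)) (bwd (refl , refl)) = inj₁ (refl , refl)

opaque
  edge-between : {u v : Fin n} → u ≢ v → ∃[ e ] Joins e u v
  edge-between {u = u} {v} u≢v with Finₚ.<-cmp u v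
  ... | tri< p _ _ = (u , v , p) , fwd (refl , refl)
  ... | tri≈ _ p _ = contradiction p u≢v
  ... | tri> _ _ p = (v , u , p) , bwd (refl , refl)

∙-joins : (x : V n) {e : Edge n} {u v : Fin n} → Joins e u v → x ∙ e ≡ x u ⊕ x v
∙-joins x (fwd (refl , refl)) = refl
∙-joins x {e} (bwd (refl , refl)) = ⊕-comm (x (src e)) (x (tgt e))

record Embedding (k n : ℕ) : Set where
  constructor embedding
  field
    at        : Fin k → Fin n
    injective : ∀ {i j} → at i ≡ at j → i ≡ j
open Embedding

embed-edge : (φ : Embedding k n) (e : Edge k) → ∃[ f ] Joins f (at φ (src e)) (at φ (tgt e))
embed-edge φ e = edge-between (λ eq → src≢tgt e (injective φ eq))

opaque
  embed : Embedding k n → Edge k → Edge n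
  embed φ e = proj₁ (embed-edge φ e)

  embed-joins : (φ : Embedding k n) {e : Edge k} {u v : Fin k} → Joins e u v → Joins (embed φ e) (at φ u) (at φ v)
  embed-joins φ {e} (fwd (refl , refl)) = proj₂ (embed-edge φ e)
  embed-joins φ {e} (bwd (refl , refl)) = joins-sym (proj₂ (embed-edge φ e))

embed-injective : (φ : Embedding k n) {e f : Edge k} → embed φ e ≡ embed φ f → e ≡ f
embed-injective φ {e} {f} eq with joins-ends (embed-joins φ (joins-self e)) (subst (λ g → Joins g _ _) (sym eq) (embed-joins φ (joins-self f)))
... | inj₁ (p , q) = joins-unique (fwd (injective φ p , injective φ q)) (joins-self f)
... | inj₂ (p , q) = joins-unique (bwd (injective φ p , injective φ q)) (joins-self f)

embed-onto : (φ : Embedding k n) {e : Edge n} {i j : Fin k} → Joins e (at φ i) (at φ j) → ∃[ e′ ] (Joins e′ i j × e ≡ embed φ e′)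
embed-onto φ {e} {i} {j} jn =
  let e′ , jn′ = edge-between (λ i≡j → joins-≢ jn (cong (at φ) i≡j))
  in e′ , jn′ , joins-unique jn (embed-joins φ jn′)

∙-embed : (x : V n) (φ : Embedding k n) (e : Edge k) → x ∙ embed φ e ≡ (λ i → x (at φ i)) ∙ e
∙-embed x φ e = ∙-joins x (embed-joins φ (joins-self e))

image : Embedding k n → List (Edge k) → ESet n
image φ L = fromList (map (embed φ) L)

∈-image : (φ : Embedding k n) {L : List (Edge k)} {e : Edge k} → e ∈ L → image φ L (embed φ e) ≡ true
∈-image φ {L} p = fromList-∈ (map (embed φ) L) (∈-map⁺ (embed φ) p)

image-∈ : (φ : Embedding k n) {L : List (Edge k)} {f : Edge n} → image φ L f ≡ true → ∃[ e ] (e ∈ L × f ≡ embed φ e)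
image-∈ φ {L} p = ∈-map⁻ (embed φ) (∈-fromList (map (embed φ) L) p)

image-⊆ : (φ : Embedding k n) {L : List (Edge k)} {S : ESet n} → (∀ {e} → e ∈ L → S (embed φ e) ≡ true) → image φ L ⊆ S
image-⊆ φ {L} sub f p with image-∈ φ {L} p
... | e , e∈L , refl = sub e∈L

size-image-≤ : (φ : Embedding k n) (L : List (Edge k)) → size (image φ L) ≤ length L
size-image-≤ φ L = ≤-trans (size-fromList-≤ (map (embed φ) L)) (≤-reflexive (length-map (embed φ) L))

size-image : (φ : Embedding k n) {L : List (Edge k)} → Unique L → size (image φ L) ≡ length L
size-image φ {L} u = ≤-antisym (size-image-≤ φ L) (≤-trans (≤-reflexive (sym (length-map (embed φ) L)))
  (size-≥ (Uniqueₚ.map⁺ (embed-injective φ) u) (fromList-∈ (map (embed φ) L))))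

_≐_ : ESet n → ESet n → Set
S ≐ T = S ⊆ T × T ⊆ S

size-≐ : {S T : ESet n} → S ≐ T → size S ≡ size T
size-≐ {S = S} {T} (p , q) = ≤-antisym (size-mono {S = S} {T} p) (size-mono {S = T} {S} q)

module Copies {k} (Adj : Fin k → Fin k → Set) (L : List (Edge k))
  (adj-sym : ∀ {u v} → Adj u v → Adj v u)
  (L⇒adj : ∀ e → e ∈ L → Adj (src e) (tgt e)) (adj⇒L : ∀ e → Adj (src e) (tgt e) → e ∈ L) where

  adj⇒joins : ∀ {e u v} → Adj u v → Joins e u v → e ∈ L
  adj⇒joins a (fwd (refl , refl)) = adj⇒L _ a
  adj⇒joins a (bwd (refl , refl)) = adj⇒L _ (adj-sym a)

  image⇒copy : (φ : Embedding k n) {F : ESet n} → F ≐ image φ L → IsCopyOf k Adj F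
  image⇒copy φ {F} (F⊆ , ⊆F) = at φ , injective φ , λ e → to e , from e
    where
    to : ∀ e → F e ≡ true → ∃[ u ] ∃[ v ] (Adj u v × at φ u ≡ src e × at φ v ≡ tgt e)
    to e p with image-∈ φ {L} (F⊆ e p)
    ... | e′ , e′∈L , refl with embed-joins φ (joins-self e′)
    ...   | fwd (q , r) = src e′ , tgt e′ , L⇒adj e′ e′∈L , sym q , sym r
    ...   | bwd (q , r) = tgt e′ , src e′ , adj-sym (L⇒adj e′ e′∈L) , sym q , sym r
    from : ∀ e → ∃[ u ] ∃[ v ] (Adj u v × at φ u ≡ src e × at φ v ≡ tgt e) → F e ≡ true
    from e (u , v , a , p , q) with embed-onto φ {e} {u} {v} (fwd (sym p , sym q))
    ... | e′ , jn , refl = ⊆F _ (∈-image φ (adj⇒joins a jn))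

  copy⇒image : {F : ESet n} → IsCopyOf k Adj F → ∃[ φ ] (F ≐ image φ L)
  copy⇒image {n} {F} (f , inj , h) = φ , to , image-⊆ φ {L} {F} from
    where
    φ : Embedding k n
    φ = embedding f inj
    to : F ⊆ image φ L
    to e p with proj₁ (h e) p
    ... | u , v , a , q , r with embed-onto φ {e} {u} {v} (fwd (sym q , sym r))
    ...   | e′ , jn , refl = ∈-image φ (adj⇒joins a jn)
    from : ∀ {e} → e ∈ L → F (embed φ e) ≡ true
    from {e} e∈L with embed-joins φ (joins-self e)
    ... | fwd (q , r) = proj₂ (h (embed φ e)) (src e , tgt e , L⇒adj e e∈L , sym q , sym r)
    ... | bwd (q , r) = proj₂ (h (embed φ e)) (tgt e , src e , adj-sym (L⇒adj e e∈L) , sym q , sym r)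

_∈ᵉ?_ : (e : Edge k) (L : List (Edge k)) → Dec (e ∈ L)
e ∈ᵉ? L = any? (e ≟ᵉ_) L

_—_ : (i j : Fin k) {i<j : True (i <ᶠ? j)} → Edge k
(i — j) {i<j} = i , j , toWitness i<j

unique? : (L : List (Edge k)) → Dec (Unique L)
unique? = AllPairs.allPairs? (λ e f → ¬? (e ≟ᵉ f))

-- The head, here and in `K₂₃`, is the edge that completes the circuit: the image of the list
-- unfolds to an insertion of this edge into the image of the tail, the shape that `rank-closure`
-- asks for.
K₄ : List (Edge 4)
K₄ = (0F — 1F) ∷ (0F — 2F) ∷ (0F — 3F) ∷ (1F — 2F) ∷ (1F — 3F) ∷ (2F — 3F) ∷ []

opaque
  ∈-K₄ : ∀ e → e ∈ K₄
  ∈-K₄ = checkEdges (_∈ᵉ? K₄) _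

K₂₃ : List (Edge 5)
K₂₃ = (1F — 4F) ∷ (0F — 2F) ∷ (0F — 3F) ∷ (0F — 4F) ∷ (1F — 2F) ∷ (1F — 3F) ∷ []

K23adj? : ∀ u v → Dec (K23adj u v)
K23adj? u v = ((toℕ u <? 2) ×-dec (2 ≤? toℕ v)) ⊎-dec ((2 ≤? toℕ u) ×-dec (toℕ v <? 2))

K23adj-sym : ∀ {u v} → K23adj u v → K23adj v u
K23adj-sym (inj₁ (p , q)) = inj₂ (q , p)
K23adj-sym (inj₂ (p , q)) = inj₁ (q , p)

module K4Copies = Copies K4adj K₄ (λ p q → p (sym q)) (λ e _ → src≢tgt e) (λ e _ → ∈-K₄ e)
module K23Copies = Copies K23adj K₂₃ K23adj-sym
  (checkEdges (λ e → (e ∈ᵉ? K₂₃) →-dec K23adj? (src e) (tgt e)) _)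
  (checkEdges (λ e → K23adj? (src e) (tgt e) →-dec (e ∈ᵉ? K₂₃)) _)

opaque
  K₄-unique : Unique K₄
  K₄-unique = toWitness {a? = unique? K₄} _

opaque
  K₂₃-unique : Unique K₂₃
  K₂₃-unique = toWitness {a? = unique? K₂₃} _

InX-size : {F : ESet n} → InX F → size F ≡ 6
InX-size {F = F} (inj₁ c) = let φ , eq = K4Copies.copy⇒image {F = F} c in trans (size-≐ {S = F} {image φ K₄} eq) (size-image φ K₄-unique)
InX-size {F = F} (inj₂ c) = let φ , eq = K23Copies.copy⇒image {F = F} c in trans (size-≐ {S = F} {image φ K₂₃} eq) (size-image φ K₂₃-unique)

-- The hypothesis says in dual form that L spans F, so an independent core of F has at most |L|
-- edges, and `𝓔` allows one more.
𝓔-size : {F : ESet n} (L : List (Edge n)) → (∀ x → (∀ {f} → f ∈ L → x ∙ f ≡ 𝟎) → Ker x F) → 𝓔 F → size F ≤ suc (length L)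
𝓔-size {F = F} L spans m with 𝓔-core {S = F} m
... | J , J⊆F , ind , le with size J ≤? length L
...   | yes le′ = ≤-trans le (s≤s le′)
...   | no nle  = let e , x , e∈J , kx , xe = Indep-augment {T = J} ind L (≰⇒> nle) in
  contradiction (trans (sym xe) (spans x kx e (J⊆F e e∈J))) 𝟏≢𝟎

image-Ker : (φ : Embedding k n) {L : List (Edge k)} {F : ESet n} → F ⊆ image φ L → (x : V n) →
  (∀ {e} → e ∈ L → (λ i → x (at φ i)) ∙ e ≡ 𝟎) → Ker x F
image-Ker φ {L} F⊆ x kx f p with image-∈ φ {L} (F⊆ f p)
... | e , e∈L , refl = trans (∙-embed x φ e) (kx e∈L)

-- Both graphs have six edges but rank four, hence nullity two. The four spanning edges are a
-- triangle with a pendant edge in K₄, where the odd cycle forces zero everywhere, and a spanning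
-- tree in the bipartite K₂₃.
InX⇒¬𝓔 : {F : ESet n} → InX F → ¬ 𝓔 F
InX⇒¬𝓔 {n} {F} inX m = contradiction (subst (_≤ 5) (InX-size {F = F} inX) (bound inX)) λ { (s≤s (s≤s (s≤s (s≤s (s≤s ()))))) }
  where
  bound : InX F → size F ≤ 5
  bound (inj₁ c) = let φ , F⊆ , _ = K4Copies.copy⇒image {F = F} c in
    𝓔-size {F = F} (map (embed φ) tree) (λ x kx → image-Ker φ {K₄} {F} F⊆ x (λ {e} _ → spans (λ i → x (at φ i))
      (λ {f} f∈ → trans (sym (∙-embed x φ f)) (kx (∈-map⁺ (embed φ) f∈))) e)) m
    where
    tree : List (Edge 4)
    tree = (0F — 1F) ∷ (0F — 2F) ∷ (1F — 2F) ∷ (0F — 3F) ∷ []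
    arith : ∀ a b c d → a ⊕ b ≡ 𝟎 → a ⊕ c ≡ 𝟎 → b ⊕ c ≡ 𝟎 → a ⊕ d ≡ 𝟎 → a ≡ 𝟎 × b ≡ 𝟎 × c ≡ 𝟎 × d ≡ 𝟎
    arith = toWitness {a? = all₃? λ a → all₃? λ b → all₃? λ c → all₃? λ d → (a ⊕ b ≟₃ 𝟎) →-dec ((a ⊕ c ≟₃ 𝟎) →-dec ((b ⊕ c ≟₃ 𝟎) →-dec
      ((a ⊕ d ≟₃ 𝟎) →-dec ((a ≟₃ 𝟎) ×-dec (b ≟₃ 𝟎) ×-dec (c ≟₃ 𝟎) ×-dec (d ≟₃ 𝟎)))))} _
    spans : (y : V 4) → (∀ {f} → f ∈ tree → y ∙ f ≡ 𝟎) → ∀ e → y ∙ e ≡ 𝟎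
    spans y ky e = cong₂ _⊕_ (zeros (src e)) (zeros (tgt e))
      where
      all = arith (y 0F) (y 1F) (y 2F) (y 3F) (ky (here refl)) (ky (there (here refl))) (ky (there (there (here refl)))) (ky (there (there (there (here refl)))))
      zeros : ∀ i → y i ≡ 𝟎
      zeros 0F = proj₁ all
      zeros 1F = proj₁ (proj₂ all)
      zeros 2F = proj₁ (proj₂ (proj₂ all))
      zeros 3F = proj₂ (proj₂ (proj₂ all))
  bound (inj₂ c) = let φ , F⊆ , _ = K23Copies.copy⇒image {F = F} c in
    𝓔-size {F = F} (map (embed φ) tree) (λ x kx → image-Ker φ {K₂₃} {F} F⊆ x (λ e∈ → spans (λ i → x (at φ i))
      (λ {f} f∈ → trans (sym (∙-embed x φ f)) (kx (∈-map⁺ (embed φ) f∈))) e∈)) m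
    where
    tree : List (Edge 5)
    tree = (0F — 2F) ∷ (0F — 3F) ∷ (0F — 4F) ∷ (1F — 2F) ∷ []
    arith : ∀ a b c d → a ⊕ b ≡ 𝟎 → a ⊕ c ≡ 𝟎 → d ⊕ b ≡ 𝟎 → d ⊕ c ≡ 𝟎
    arith = toWitness {a? = all₃? λ a → all₃? λ b → all₃? λ c → all₃? λ d → (a ⊕ b ≟₃ 𝟎) →-dec ((a ⊕ c ≟₃ 𝟎) →-dec ((d ⊕ b ≟₃ 𝟎) →-dec (d ⊕ c ≟₃ 𝟎)))} _
    spans : (y : V 5) → (∀ {f} → f ∈ tree → y ∙ f ≡ 𝟎) → ∀ {e} → e ∈ K₂₃ → y ∙ e ≡ 𝟎
    spans y ky (here refl) = arith (y 0F) (y 2F) (y 4F) (y 1F) (ky (here refl)) (ky (there (there (here refl)))) (ky (there (there (there (here refl)))))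
    spans y ky (there (here refl)) = ky (here refl)
    spans y ky (there (there (here refl))) = ky (there (here refl))
    spans y ky (there (there (there (here refl)))) = ky (there (there (here refl)))
    spans y ky (there (there (there (there (here refl))))) = ky (there (there (there (here refl))))
    spans y ky (there (there (there (there (there (here refl)))))) = arith (y 0F) (y 2F) (y 3F) (y 1F) (ky (here refl)) (ky (there (here refl))) (ky (there (there (there (here refl)))))

-- Vertex lists and flats of the even cycle matroid

fromUnique : (xs : List (Fin n)) → Unique xs → Embedding (length xs) n
fromUnique xs u = embedding (lookup xs) (lookup-injective u)

Within : List (Fin n) → Edge n → Set
Within vs e = src e ∈ vs × tgt e ∈ vs

within-embed : {vs : List (Fin n)} (u : Unique vs) {e : Edge n} → Within vs e → ∃[ e′ ] (e ≡ embed (fromUnique vs u) e′)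
within-embed u (p , q) = let e′ , _ , eq = embed-onto (fromUnique _ u) (fwd (lookup-index p , lookup-index q)) in e′ , eq

-- The part of the flat {ij : x i + x j = 0} on the vertices vs: the disjoint union of the complete
-- bipartite graph between x⁻¹(1) and x⁻¹(2) and the complete graph on x⁻¹(0).
Flat : V n → List (Fin n) → Edge n → Set
Flat x vs e = Within vs e × x ∙ e ≡ 𝟎

flat-joins : (x : V n) {vs : List (Fin n)} {e : Edge n} {a b : Fin n} → Joins e a b → a ∈ vs → b ∈ vs → x a ⊕ x b ≡ 𝟎 → Flat x vs e
flat-joins x (fwd (refl , refl)) p q eq = (p , q) , eq
flat-joins x {e = e} (bwd (refl , refl)) p q eq = (q , p) , trans (⊕-comm (x (src e)) (x (tgt e))) eq

C₄ : List (Edge 4)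
C₄ = (0F — 1F) ∷ (1F — 2F) ∷ (2F — 3F) ∷ (0F — 3F) ∷ []

2C₄ : List (Edge 8)
2C₄ = (0F — 1F) ∷ (1F — 2F) ∷ (2F — 3F) ∷ (0F — 3F) ∷ (4F — 5F) ∷ (5F — 6F) ∷ (6F — 7F) ∷ (4F — 7F) ∷ []

opaque
  2C₄-unique : Unique 2C₄
  2C₄-unique = toWitness {a? = unique? 2C₄} _

_∈ᶠ?_ : (v : Fin n) (vs : List (Fin n)) → Dec (v ∈ vs)
v ∈ᶠ? vs = any? (v ≟_) vs

-- From m = 4 on, m(m - 1)/2 exceeds m; there K₄ has to be used as a circuit.
allEdges-length-≤ : ∀ m → m ≤ 3 → length (allEdges m) ≤ m
allEdges-length-≤ 0 _ = ≤-reflexive {length (allEdges 0)} {0} refl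
allEdges-length-≤ 1 _ = n≤1+n 0
allEdges-length-≤ 2 _ = n≤1+n 1
allEdges-length-≤ 3 _ = ≤-reflexive {length (allEdges 3)} {3} refl
allEdges-length-≤ (suc (suc (suc (suc m)))) (s≤s (s≤s (s≤s ())))

-- Rank bounds for matroids in which every K₄ and K₂₃ is a circuit

-- Supplies the two auxiliary vertices of a K₂₃ inside a complete graph, where vector values do not
-- keep them apart from `q₀` and `q`.
avoid-two : (base : List (Fin n)) → Unique base → 4 ≤ length base → ∀ q₀ q →
  ∃[ p₁ ] ∃[ p₂ ] (p₁ ∈ base × p₂ ∈ base × p₁ ≢ p₂ × (p₁ ≢ q₀ × p₁ ≢ q) × (p₂ ≢ q₀ × p₂ ≢ q))
avoid-two base u le q₀ q = pick-two (filter P? base) refl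
  where
  P? = λ w → ¬? (w ≟ q₀) ×-dec ¬? (w ≟ q)
  cover : ∀ {w} → w ∈ base → w ∈ q₀ ∷ q ∷ filter P? base
  cover {w} w∈ with w ≟ q₀ | w ≟ q
  ... | yes eq | _      = here eq
  ... | no _   | yes eq = there (here eq)
  ... | no ne  | no ne′ = there (there (∈-filter⁺ P? w∈ (ne , ne′)))
  len : 2 ≤ length (filter P? base)
  len = +-cancelˡ-≤ 2 2 (length (filter P? base)) (≤-trans le (unique-length-≤ u cover))
  pick-two : ∀ ps → ps ≡ filter P? base →
    ∃[ p₁ ] ∃[ p₂ ] (p₁ ∈ base × p₂ ∈ base × p₁ ≢ p₂ × (p₁ ≢ q₀ × p₁ ≢ q) × (p₂ ≢ q₀ × p₂ ≢ q))
  pick-two [] eq = contradiction (subst (λ ps → 2 ≤ length ps) (sym eq) len) λ ()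
  pick-two (p ∷ []) eq = contradiction (subst (λ ps → 2 ≤ length ps) (sym eq) len) λ { (s≤s ()) }
  pick-two (p₁ ∷ p₂ ∷ ps) eq =
    let b₁ , r₁ = ∈-filter⁻ P? {xs = base} (subst (p₁ ∈_) eq (here refl))
        b₂ , r₂ = ∈-filter⁻ P? {xs = base} (subst (p₂ ∈_) eq (there (here refl)))
    in p₁ , p₂ , b₁ , b₂ , All.head (AllPairs.head (subst Unique (sym eq) (Uniqueₚ.filter⁺ P? u))) , r₁ , r₂

-- A K₂₃ on the flat: `q₀`, `q` on one side and `p₁`, `p₂`, `v` on the other. All its edges except
-- those at `v` join vertices already present.
Spread : V n → List (Fin n) → Fin n → Fin n → Fin n → Set
Spread x base v q₀ q = ∃[ p₁ ] ∃[ p₂ ] (p₁ ∈ base × p₂ ∈ base × p₁ ≢ p₂ ×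
  (x p₁ ≡ x v × x p₂ ≡ x v) × (p₁ ≢ q₀ × p₁ ≢ q) × (p₂ ≢ q₀ × p₂ ≢ q))

Spread-⊆ : {x : V n} {b b′ : List (Fin n)} {v q₀ q : Fin n} → (∀ {w} → w ∈ b → w ∈ b′) → Spread x b v q₀ q → Spread x b′ v q₀ q
Spread-⊆ sub (p₁ , p₂ , m₁ , m₂ , r) = p₁ , p₂ , sub m₁ , sub m₂ , r

-- The condition under which `v` can be attached at the cost of one: after the edge from `v` to a
-- first neighbour `q₀`, every further edge from `v` to some `q` completes a K₂₃.
Rich : V n → List (Fin n) → List (Fin n) → Fin n → Set
Rich x base vs v = ∀ {q₀ q} → q₀ ∈ vs → q ∈ vs → x q₀ ⊕ x v ≡ 𝟎 → x q ⊕ x v ≡ 𝟎 → q₀ ≢ q → Spread x base v q₀ q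

opaque
  negate : ∀ a b → a ⊕ b ≡ 𝟎 → a ≡ 𝟐 ⊗ b
  negate = toWitness {a? = all₃? λ a → all₃? λ b → (a ⊕ b ≟₃ 𝟎) →-dec (a ≟₃ 𝟐 ⊗ b)} _

opposite : ∀ {a b c} → a ⊕ b ≡ 𝟎 → b ≡ c → a ≡ 𝟐 ⊗ c
opposite {a} {b} p refl = negate a b p

level : V n → List (Fin n) → 𝔽₃ → List (Fin n)
level x vs a = filter (λ v → x v ≟₃ a) vs

∈-level : (x : V n) {vs : List (Fin n)} {a : 𝔽₃} {v : Fin n} → v ∈ vs → x v ≡ a → v ∈ level x vs a
∈-level x {a = a} = ∈-filter⁺ (λ v → x v ≟₃ a)

level-∈ : (x : V n) (vs : List (Fin n)) {a : 𝔽₃} {v : Fin n} → v ∈ level x vs a → v ∈ vs × x v ≡ a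
level-∈ x vs {a} = ∈-filter⁻ (λ v → x v ≟₃ a) {xs = vs}

level-unique : (x : V n) {vs : List (Fin n)} (a : 𝔽₃) → Unique vs → Unique (level x vs a)
level-unique x a = Uniqueₚ.filter⁺ (λ v → x v ≟₃ a)

apart : {x : V n} {p q : Fin n} {a b : 𝔽₃} → x p ≡ a → x q ≡ b → a ≢ b → p ≢ q
apart refl refl a≢b refl = a≢b refl

-- Starting configurations for the bipartite part: a single vertex when one side has at most one
-- vertex, otherwise a 4-cycle listed in cyclic order.
data NonzeroBase (x : V n) : List (Fin n) → Set where
  single : ∀ {a} → x a ≢ 𝟎 → NonzeroBase x (a ∷ [])
  square : ∀ {a₁ b₁ a₂ b₂} → x a₁ ≡ 𝟏 → x b₁ ≡ 𝟐 → x a₂ ≡ 𝟏 → x b₂ ≡ 𝟐 → NonzeroBase x (a₁ ∷ b₁ ∷ a₂ ∷ b₂ ∷ [])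

data ZeroBase : List (Fin n) → Set where
  few  : {ws : List (Fin n)} → length ws ≤ 3 → ZeroBase ws
  four : {w₁ w₂ w₃ w₄ : Fin n} → ZeroBase (w₁ ∷ w₂ ∷ w₃ ∷ w₄ ∷ [])

-- If one side has at most one vertex, the base vertex is chosen so that every other nonzero vertex
-- has at most one neighbour among the nonzero vertices; there are then no two neighbours `q₀` ≠
-- `q`, and `Rich` is vacuous. Otherwise two base vertices lie on the side of `v`, and their values
-- keep them apart from `q₀` and `q`.
nonzero-base : (x : V n) (vs : List (Fin n)) → Unique vs → ∃[ v ] (v ∈ vs × x v ≢ 𝟎) →
  ∃[ bs ] (NonzeroBase x bs × Unique bs × (∀ {v} → v ∈ bs → v ∈ vs) × (∀ {v} → v ∈ vs → v ∉ bs → x v ≢ 𝟎 → Rich x bs vs v))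
nonzero-base {n} x vs u (v₀ , v₀∈ , v₀≢0) = go (level x vs 𝟏) (level x vs 𝟐) (level-unique x 𝟏 u) (level-unique x 𝟐 u)
    (level-∈ x vs) (∈-level x) (level-∈ x vs) (∈-level x)
  where
  Result : Set
  Result = ∃[ bs ] (NonzeroBase x bs × Unique bs × (∀ {v} → v ∈ bs → v ∈ vs) × (∀ {v} → v ∈ vs → v ∉ bs → x v ≢ 𝟎 → Rich x bs vs v))
  one : ∀ a → a ∈ vs → x a ≢ 𝟎 → (∀ {v} → v ∈ vs → v ∉ a ∷ [] → x v ≢ 𝟎 → ∀ {q₀ q} → q₀ ∈ vs → q ∈ vs → x q₀ ⊕ x v ≡ 𝟎 → x q ⊕ x v ≡ 𝟎 → q₀ ≡ q) → Result
  one a a∈ a≢0 same = a ∷ [] , single a≢0 , [] ∷ [] , (λ { (here refl) → a∈ }) ,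
    (λ p q r s t eq eq′ ne → contradiction (same p q r s t eq eq′) ne)
  value : ∀ {c v} → x v ≡ c → c ≢ 𝟎 → x v ≢ 𝟎
  value refl p = p
  go : ∀ As Bs → Unique As → Unique Bs → (∀ {v} → v ∈ As → v ∈ vs × x v ≡ 𝟏) → (∀ {v} → v ∈ vs → x v ≡ 𝟏 → v ∈ As) →
    (∀ {v} → v ∈ Bs → v ∈ vs × x v ≡ 𝟐) → (∀ {v} → v ∈ vs → x v ≡ 𝟐 → v ∈ Bs) → Result
  go [] [] _ _ _ A⁺ _ B⁺ with x v₀ in eq
  ... | 𝟎 = contradiction refl v₀≢0
  ... | 𝟏 = contradiction (A⁺ v₀∈ eq) λ ()
  ... | 𝟐 = contradiction (B⁺ v₀∈ eq) λ ()
  go [] (b ∷ Bs) _ _ _ A⁺ B⁻ B⁺ = one b (proj₁ (B⁻ (here refl))) (value (proj₂ (B⁻ (here refl))) λ ()) same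
    where
    same : ∀ {v} → v ∈ vs → v ∉ b ∷ [] → x v ≢ 𝟎 → ∀ {q₀ q} → q₀ ∈ vs → q ∈ vs → x q₀ ⊕ x v ≡ 𝟎 → x q ⊕ x v ≡ 𝟎 → q₀ ≡ q
    same {v} v∈ _ v≢0 q₀∈ _ op _ with x v in eq
    ... | 𝟎 = contradiction refl v≢0
    ... | 𝟏 = contradiction (A⁺ v∈ eq) λ ()
    ... | 𝟐 = contradiction (A⁺ q₀∈ (negate _ 𝟐 op)) λ ()
  go (a ∷ []) Bs _ _ A⁻ A⁺ B⁻ B⁺ = one a (proj₁ (A⁻ (here refl))) (value (proj₂ (A⁻ (here refl))) λ ()) same
    where
    same : ∀ {v} → v ∈ vs → v ∉ a ∷ [] → x v ≢ 𝟎 → ∀ {q₀ q} → q₀ ∈ vs → q ∈ vs → x q₀ ⊕ x v ≡ 𝟎 → x q ⊕ x v ≡ 𝟎 → q₀ ≡ q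
    same {v} v∈ v∉ v≢0 q₀∈ q∈ op op′ with x v in eq
    ... | 𝟎 = contradiction refl v≢0
    ... | 𝟏 = contradiction (A⁺ v∈ eq) v∉
    ... | 𝟐 with A⁺ q₀∈ (negate _ 𝟐 op) | A⁺ q∈ (negate _ 𝟐 op′)
    ...   | here refl | here refl = refl
  go (a ∷ _ ∷ _) [] _ _ A⁻ A⁺ _ B⁺ = one a (proj₁ (A⁻ (here refl))) (value (proj₂ (A⁻ (here refl))) λ ()) same
    where
    same : ∀ {v} → v ∈ vs → v ∉ a ∷ [] → x v ≢ 𝟎 → ∀ {q₀ q} → q₀ ∈ vs → q ∈ vs → x q₀ ⊕ x v ≡ 𝟎 → x q ⊕ x v ≡ 𝟎 → q₀ ≡ q
    same {v} v∈ _ v≢0 q₀∈ _ op _ with x v in eq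
    ... | 𝟎 = contradiction refl v≢0
    ... | 𝟏 = contradiction (B⁺ q₀∈ (negate _ 𝟏 op)) λ ()
    ... | 𝟐 = contradiction (B⁺ v∈ eq) λ ()
  go (_ ∷ _ ∷ _) (b ∷ []) _ _ _ _ B⁻ B⁺ = one b (proj₁ (B⁻ (here refl))) (value (proj₂ (B⁻ (here refl))) λ ()) same
    where
    same : ∀ {v} → v ∈ vs → v ∉ b ∷ [] → x v ≢ 𝟎 → ∀ {q₀ q} → q₀ ∈ vs → q ∈ vs → x q₀ ⊕ x v ≡ 𝟎 → x q ⊕ x v ≡ 𝟎 → q₀ ≡ q
    same {v} v∈ v∉ v≢0 q₀∈ q∈ op op′ with x v in eq
    ... | 𝟎 = contradiction refl v≢0
    ... | 𝟐 = contradiction (B⁺ v∈ eq) v∉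
    ... | 𝟏 with B⁺ q₀∈ (negate _ 𝟏 op) | B⁺ q∈ (negate _ 𝟏 op′)
    ...   | here refl | here refl = refl
  go (a₁ ∷ a₂ ∷ _) (b₁ ∷ b₂ ∷ _) ((a₁≢a₂ ∷ _) ∷ _) ((b₁≢b₂ ∷ _) ∷ _) A⁻ _ B⁻ _ =
      a₁ ∷ b₁ ∷ a₂ ∷ b₂ ∷ [] , square xa₁ xb₁ xa₂ xb₂ ,
      (apart {x = x} xa₁ xb₁ (λ ()) ∷ a₁≢a₂ ∷ apart {x = x} xa₁ xb₂ (λ ()) ∷ []) ∷ (apart {x = x} xb₁ xa₂ (λ ()) ∷ b₁≢b₂ ∷ []) ∷ (apart {x = x} xa₂ xb₂ (λ ()) ∷ []) ∷ [] ∷ [] ,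
      in-vs , rich
    where
    xa₁ = proj₂ (A⁻ (here refl))
    xa₂ = proj₂ (A⁻ (there (here refl)))
    xb₁ = proj₂ (B⁻ (here refl))
    xb₂ = proj₂ (B⁻ (there (here refl)))
    in-vs : ∀ {v} → v ∈ a₁ ∷ b₁ ∷ a₂ ∷ b₂ ∷ [] → v ∈ vs
    in-vs (here refl) = proj₁ (A⁻ (here refl))
    in-vs (there (here refl)) = proj₁ (B⁻ (here refl))
    in-vs (there (there (here refl))) = proj₁ (A⁻ (there (here refl)))
    in-vs (there (there (there (here refl)))) = proj₁ (B⁻ (there (here refl)))
    rich : ∀ {v} → v ∈ vs → v ∉ a₁ ∷ b₁ ∷ a₂ ∷ b₂ ∷ [] → x v ≢ 𝟎 → Rich x (a₁ ∷ b₁ ∷ a₂ ∷ b₂ ∷ []) vs v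
    rich {v} _ _ v≢0 _ _ op op′ _ with x v in eq
    ... | 𝟎 = contradiction refl v≢0
    ... | 𝟏 = a₁ , a₂ , here refl , there (there (here refl)) , a₁≢a₂ , (xa₁ , xa₂) ,
      (apart {x = x} xa₁ (negate _ 𝟏 op) (λ ()) , apart {x = x} xa₁ (negate _ 𝟏 op′) (λ ())) , (apart {x = x} xa₂ (negate _ 𝟏 op) (λ ()) , apart {x = x} xa₂ (negate _ 𝟏 op′) (λ ()))
    ... | 𝟐 = b₁ , b₂ , there (here refl) , there (there (there (here refl))) , b₁≢b₂ , (xb₁ , xb₂) ,
      (apart {x = x} xb₁ (negate _ 𝟐 op) (λ ()) , apart {x = x} xb₁ (negate _ 𝟐 op′) (λ ())) , (apart {x = x} xb₂ (negate _ 𝟐 op) (λ ()) , apart {x = x} xb₂ (negate _ 𝟐 op′) (λ ()))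

zero-base : (x : V n) (vs : List (Fin n)) → Unique vs →
  ∃[ bs ] (ZeroBase bs × Unique bs × (∀ {v} → v ∈ bs → v ∈ vs × x v ≡ 𝟎) × (∀ {v} → v ∈ vs → v ∉ bs → x v ≡ 𝟎 → Rich x bs vs v))
zero-base {n} x vs u = go (level x vs 𝟎) (level-unique x 𝟎 u) (level-∈ x vs) (∈-level x)
  where
  Result : Set
  Result = ∃[ bs ] (ZeroBase bs × Unique bs × (∀ {v} → v ∈ bs → v ∈ vs × x v ≡ 𝟎) × (∀ {v} → v ∈ vs → v ∉ bs → x v ≡ 𝟎 → Rich x bs vs v))
  all-of : ∀ Ws → length Ws ≤ 3 → Unique Ws → (∀ {v} → v ∈ Ws → v ∈ vs × x v ≡ 𝟎) → (∀ {v} → v ∈ vs → x v ≡ 𝟎 → v ∈ Ws) → Result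
  all-of Ws le uW W⁻ W⁺ = Ws , few le , uW , W⁻ , λ v∈ v∉ xv → contradiction (W⁺ v∈ xv) v∉
  go : ∀ Ws → Unique Ws → (∀ {v} → v ∈ Ws → v ∈ vs × x v ≡ 𝟎) → (∀ {v} → v ∈ vs → x v ≡ 𝟎 → v ∈ Ws) → Result
  go [] uW = all-of [] z≤n uW
  go (a ∷ []) uW = all-of (a ∷ []) (s≤s z≤n) uW
  go (a ∷ b ∷ []) uW = all-of (a ∷ b ∷ []) (s≤s (s≤s z≤n)) uW
  go (a ∷ b ∷ c ∷ []) uW = all-of (a ∷ b ∷ c ∷ []) (s≤s (s≤s (s≤s z≤n))) uW
  go (a ∷ b ∷ c ∷ d ∷ Ws) ((ab ∷ ac ∷ ad ∷ _) ∷ (bc ∷ bd ∷ _) ∷ (cd ∷ _) ∷ _) W⁻ W⁺ = bs , four , ubs , W⁻ ∘ ∈-++⁺ˡ , rich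
    where
    bs : List (Fin n)
    bs = a ∷ b ∷ c ∷ d ∷ []
    ubs : Unique bs
    ubs = (ab ∷ ac ∷ ad ∷ []) ∷ (bc ∷ bd ∷ []) ∷ (cd ∷ []) ∷ [] ∷ []
    rich : ∀ {v} → v ∈ vs → v ∉ bs → x v ≡ 𝟎 → Rich x bs vs v
    rich _ _ xv {q₀} {q} _ _ _ _ _ = let p₁ , p₂ , m₁ , m₂ , ne , r = avoid-two bs ubs ≤-refl q₀ q in
      p₁ , p₂ , m₁ , m₂ , ne , (trans (proj₂ (W⁻ (∈-++⁺ˡ m₁))) (sym xv) , trans (proj₂ (W⁻ (∈-++⁺ˡ m₂))) (sym xv)) , r

-- Explicit vectors on four and eight vertices

square-pattern : V 4
square-pattern 0F = 𝟏
square-pattern 1F = 𝟐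
square-pattern 2F = 𝟏
square-pattern 3F = 𝟐

opaque
  square-flat : ∀ e → square-pattern ∙ e ≡ 𝟎 → e ∈ C₄
  square-flat = checkEdges (λ e → (square-pattern ∙ e ≟₃ 𝟎) →-dec (e ∈ᵉ? C₄)) _

-- Its flat is a C₄ next to a K₄, that is, `2C₄` with both chords of the second cycle.
split-pattern : V 8
split-pattern 0F = 𝟏
split-pattern 1F = 𝟐
split-pattern 2F = 𝟏
split-pattern 3F = 𝟐
split-pattern _  = 𝟎

opaque
  split-flat : ∀ e → split-pattern ∙ e ≡ 𝟎 → e ∈ (5F — 7F) ∷ (4F — 6F) ∷ 2C₄
  split-flat = checkEdges (λ e → (split-pattern ∙ e ≟₃ 𝟎) →-dec (e ∈ᵉ? ((5F — 7F) ∷ (4F — 6F) ∷ 2C₄))) _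

∙-cong : {x y : V n} → (∀ i → x i ≡ y i) → ∀ e → x ∙ e ≡ y ∙ e
∙-cong eq e = cong₂ _⊕_ (eq (src e)) (eq (tgt e))

_∘ᵉ_ : ∀ {m} → Embedding k n → Embedding m k → Embedding m n
φ ∘ᵉ ψ = embedding (λ i → at φ (at ψ i)) (λ eq → injective ψ (injective φ eq))

embed-∘ : ∀ {m} (φ : Embedding k n) (ψ : Embedding m k) e {f} → Joins f (at ψ (src e)) (at ψ (tgt e)) → embed (φ ∘ᵉ ψ) e ≡ embed φ f
embed-∘ φ ψ e jn = joins-unique (embed-joins (φ ∘ᵉ ψ) (joins-self e)) (embed-joins φ jn)

opaque
  lookup-injective? : (xs : List (Fin n)) → True (AllPairs.allPairs? (λ a b → ¬? (a ≟ b)) xs) → ∀ {i j} → lookup xs i ≡ lookup xs j → i ≡ j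
  lookup-injective? xs t = lookup-injective (toWitness t)

fromUnique? : (xs : List (Fin n)) → True (AllPairs.allPairs? (λ a b → ¬? (a ≟ b)) xs) → Embedding (length xs) n
fromUnique? xs t = embedding (lookup xs) (lookup-injective? xs t)

vertices : Embedding k n → List (Fin n)
vertices φ = tabulate (at φ)

vertices-unique : (φ : Embedding k n) → Unique (vertices φ)
vertices-unique φ = Uniqueₚ.tabulate⁺ (injective φ)

∈-vertices : (φ : Embedding k n) (i : Fin k) → at φ i ∈ vertices φ
∈-vertices φ i = ∈-tabulate⁺ i

vertices-∈ : (φ : Embedding k n) {v : Fin n} → v ∈ vertices φ → ∃[ i ] (v ≡ at φ i)
vertices-∈ φ = ∈-tabulate⁻ {f = at φ}

within-vertices : (φ : Embedding k n) {e : Edge n} → Within (vertices φ) e → ∃[ e′ ] (e ≡ embed φ e′)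
within-vertices φ (p , q) =
  let i , eq = vertices-∈ φ p
      j , eq′ = vertices-∈ φ q
      e′ , _ , eq″ = embed-onto φ (fwd (eq , eq′))
  in e′ , eq″

embed-within : (φ : Embedding k n) (e : Edge k) → Within (vertices φ) (embed φ e)
embed-within φ e with embed-joins φ (joins-self e)
... | fwd (p , q) = subst (_∈ vertices φ) (sym p) (∈-vertices φ (src e)) , subst (_∈ vertices φ) (sym q) (∈-vertices φ (tgt e))
... | bwd (p , q) = subst (_∈ vertices φ) (sym p) (∈-vertices φ (tgt e)) , subst (_∈ vertices φ) (sym q) (∈-vertices φ (src e))

extend-by-𝟎 : Embedding k n → V k → V n
extend-by-𝟎 φ y v with anyFin? (λ i → at φ i ≟ v)
... | yes (i , _) = y i
... | no _        = 𝟎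

extend-at : (φ : Embedding k n) (y : V k) (i : Fin k) → extend-by-𝟎 φ y (at φ i) ≡ y i
extend-at φ y i with anyFin? (λ j → at φ j ≟ at φ i)
... | yes (j , eq) = cong y (injective φ eq)
... | no none      = contradiction (i , refl) none

-- The two proper 2-colourings of C₄ ∪ C₄ up to exchanging colours; their flats are the two copies
-- of K₄,₄ that contain it.
pattern₁ pattern₂ : V 8
pattern₁ 0F = 𝟏
pattern₁ 1F = 𝟐
pattern₁ 2F = 𝟏
pattern₁ 3F = 𝟐
pattern₁ 4F = 𝟏
pattern₁ 5F = 𝟐
pattern₁ 6F = 𝟏
pattern₁ 7F = 𝟐
pattern₂ 0F = 𝟏
pattern₂ 1F = 𝟐
pattern₂ 2F = 𝟏
pattern₂ 3F = 𝟐
pattern₂ 4F = 𝟐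
pattern₂ 5F = 𝟏
pattern₂ 6F = 𝟐
pattern₂ 7F = 𝟏

Killed : V k → V k → Edge k → Set
Killed y z e = y ∙ e ≡ 𝟎 ⊎ z ∙ e ≡ 𝟎

killed? : (y z : V k) (e : Edge k) → Dec (Killed y z e)
killed? y z e = (y ∙ e ≟₃ 𝟎) ⊎-dec (z ∙ e ≟₃ 𝟎)

opaque
  2C₄-pattern₁ : All (λ e → pattern₁ ∙ e ≡ 𝟎) 2C₄
  2C₄-pattern₁ = toWitness {a? = all? (λ e → pattern₁ ∙ e ≟₃ 𝟎) 2C₄} _

opaque
  2C₄-pattern₂ : All (λ e → pattern₂ ∙ e ≡ 𝟎) 2C₄
  2C₄-pattern₂ = toWitness {a? = all? (λ e → pattern₂ ∙ e ≟₃ 𝟎) 2C₄} _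

opaque
  -- An edge between the cycles lies in one of the two K₄,₄ and a cycle edge in both; only the four
  -- chords remain.
  K₈-cover : ∀ e → Killed pattern₁ pattern₂ e ⊎ e ∈ (0F — 2F) ∷ (1F — 3F) ∷ (4F — 6F) ∷ (5F — 7F) ∷ []
  K₈-cover = checkEdges (λ e → killed? pattern₁ pattern₂ e ⊎-dec (e ∈ᵉ? ((0F — 2F) ∷ (1F — 3F) ∷ (4F — 6F) ∷ (5F — 7F) ∷ []))) _

module XMatroid {n : ℕ} (M : IndPred n) (isMatroid : IsMatroid M)
  (small : ∀ S → size S ≤ 5 → M S) (X-dependent : ∀ S → InX S → ¬ M S) where

  open IsMatroid isMatroid

  -- A bound on independent subsets instead of a rank function: no basis of `A` has to be chosen,
  -- and `A` may be any predicate.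
  Rank≤ : (Edge n → Set) → ℕ → Set
  Rank≤ A r = ∀ S → (∀ e → S e ≡ true → A e) → M S → size S ≤ r

  infixl 5 _∪ᵉ_
  _∪ᵉ_ : (Edge n → Set) → Edge n → Edge n → Set
  (A ∪ᵉ f) e = A e ⊎ e ≡ f

  rank-mono : ∀ {A B r s} → (∀ e → A e → B e) → r ≤ s → Rank≤ B r → Rank≤ A s
  rank-mono sub le rk S S⊆A mS = ≤-trans (rk S (λ e p → sub e (S⊆A e p)) mS) le

  rank-list : (L : List (Edge n)) → Rank≤ (_∈ L) (length L)
  rank-list L S S⊆L _ = size-≤ L S⊆L

  rank-insert : ∀ {A r} f → Rank≤ A r → Rank≤ (A ∪ᵉ f) (suc r)
  rank-insert {A} f rk S S⊆ mS = ≤-trans (size-≤-remove f S) (s≤s (rk (remove f S) sub (ind-down (remove f S) S (remove-⊆ f S) mS)))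
    where
    sub : ∀ e → remove f S e ≡ true → A e
    sub e p with S⊆ e (remove-⊆ f S e p)
    ... | inj₁ a = a
    ... | inj₂ q = contradiction q (remove-≢ f S p)

  extend : ∀ I S → M I → M S → ∃[ I′ ] (M I′ × I ⊆ I′ × (∀ e → I′ e ≡ true → I e ≡ true ⊎ S e ≡ true) × size S ≤ size I′)
  extend I S mI mS = go (size S) I mI (m≤n+m (size S) (size I))
    where
    go : ∀ d I → M I → size S ≤ size I + d → ∃[ I′ ] (M I′ × I ⊆ I′ × (∀ e → I′ e ≡ true → I e ≡ true ⊎ S e ≡ true) × size S ≤ size I′)
    go zero I mI le = I , mI , (λ _ p → p) , (λ _ → inj₁) , ≤-trans le (≤-reflexive (+-identityʳ (size I)))
    go (suc d) I mI le with size S ≤? size I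
    ... | yes le′ = I , mI , (λ _ p → p) , (λ _ → inj₁) , le′
    ... | no nle  =
      let e , e∈S , e∉I , mIe = ind-exch I S mI mS (≰⇒> nle)
          I′ , mI′ , sub , sup , le″ = go d (insert e I) mIe
            (≤-trans le (≤-reflexive (trans (+-suc (size I) d) (cong (_+ d) (sym (size-insert {e = e} {I} e∉I))))))
      in I′ , mI′ , ⊆-trans {S = I} {insert e I} {I′} (insert-there e I) sub , sup′ e e∈S I I′ sup , le″
      where
      sup′ : ∀ e → S e ≡ true → ∀ I I′ → (∀ f → I′ f ≡ true → insert e I f ≡ true ⊎ S f ≡ true) → ∀ f → I′ f ≡ true → I f ≡ true ⊎ S f ≡ true
      sup′ e e∈S I I′ sup f p with sup f p
      ... | inj₂ q = inj₂ q
      ... | inj₁ q with insert-inv e I q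
      ...   | inj₁ r    = inj₁ r
      ...   | inj₂ refl = inj₂ e∈S

  -- Here f is in the closure of Q. Extending Q inside Q ∪ S to an independent set at least as large
  -- as S gives a set that cannot contain f, so it lies in A.
  rank-closure : ∀ {A r} Q f → M Q → ¬ M (insert f Q) → (∀ e → Q e ≡ true → A e) → Rank≤ A r → Rank≤ (A ∪ᵉ f) r
  rank-closure {A} Q f mQ ¬m Q⊆A rk S S⊆ mS =
    let I , mI , Q⊆I , I⊆ , le = extend Q S mQ mS in ≤-trans le (rk I (sub I mI Q⊆I I⊆) mI)
    where
    sub : ∀ I → M I → Q ⊆ I → (∀ e → I e ≡ true → Q e ≡ true ⊎ S e ≡ true) → ∀ e → I e ≡ true → A e
    sub I mI Q⊆I I⊆ e p with I⊆ e p
    ... | inj₁ q = Q⊆A e q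
    ... | inj₂ q with S⊆ e q
    ...   | inj₁ a    = a
    ...   | inj₂ refl = contradiction (ind-down (insert f Q) I (insert-⊆ {e = f} {Q} {I} Q⊆I p) mI) ¬m

  -- T is a basis of A and of B. A larger independent set would augment T by an edge of one of them,
  -- exceeding the bound there.
  rank-join : ∀ {A B r} T → M T → size T ≡ r → (∀ e → T e ≡ true → A e) → (∀ e → T e ≡ true → B e) →
    Rank≤ A r → Rank≤ B r → Rank≤ (λ e → A e ⊎ B e) r
  rank-join {A} {B} {r} T mT size-T T⊆A T⊆B rkA rkB S S⊆ mS = ≮⇒≥ λ lt →
    let e , e∈S , e∉T , mTe = ind-exch T S mT mS (≤-trans (s≤s (≤-reflexive size-T)) lt)
    in <-irrefl refl (≤-trans (≤-reflexive (sym (trans (size-insert {e = e} {T} e∉T) (cong suc size-T)))) (bound e mTe (S⊆ e e∈S)))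
    where
    sub : ∀ {A : Edge n → Set} e → (∀ e → T e ≡ true → A e) → A e → ∀ f → insert e T f ≡ true → A f
    sub e T⊆ a f p with insert-inv e T p
    ... | inj₁ q    = T⊆ f q
    ... | inj₂ refl = a
    bound : ∀ e → M (insert e T) → A e ⊎ B e → size (insert e T) ≤ r
    bound e mTe (inj₁ a) = rkA (insert e T) (sub {A} e T⊆A a) mTe
    bound e mTe (inj₂ b) = rkB (insert e T) (sub {B} e T⊆B b) mTe

  image-in : ∀ {A : Edge n → Set} (φ : Embedding k n) {L} → (∀ {e} → e ∈ L → A (embed φ e)) → ∀ f → image φ L f ≡ true → A f
  image-in φ {L} h f p with image-∈ φ {L} p
  ... | e , e∈L , refl = h e∈L

  K₄-closure : ∀ {A r} (φ : Embedding 4 n) → (∀ {e} → e ∈ (0F — 2F) ∷ (0F — 3F) ∷ (1F — 2F) ∷ (1F — 3F) ∷ (2F — 3F) ∷ [] → A (embed φ e)) →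
    Rank≤ A r → Rank≤ (A ∪ᵉ embed φ (0F — 1F)) r
  K₄-closure {A} {r} φ h = rank-closure {A} {r} (image φ L) (embed φ (0F — 1F)) (small (image φ L) (size-image-≤ φ L))
      (X-dependent (image φ K₄) (inj₁ (K4Copies.image⇒copy φ {image φ K₄} ((λ _ p → p) , (λ _ p → p)))))
      (image-in {A = A} φ {L} h)
    where
    L : List (Edge 4)
    L = (0F — 2F) ∷ (0F — 3F) ∷ (1F — 2F) ∷ (1F — 3F) ∷ (2F — 3F) ∷ []

  K₂₃-closure : ∀ {A r} (φ : Embedding 5 n) → (∀ {e} → e ∈ (0F — 2F) ∷ (0F — 3F) ∷ (0F — 4F) ∷ (1F — 2F) ∷ (1F — 3F) ∷ [] → A (embed φ e)) →
    Rank≤ A r → Rank≤ (A ∪ᵉ embed φ (1F — 4F)) r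
  K₂₃-closure {A} {r} φ h = rank-closure {A} {r} (image φ L) (embed φ (1F — 4F)) (small (image φ L) (size-image-≤ φ L))
      (X-dependent (image φ K₂₃) (inj₂ (K23Copies.image⇒copy φ {image φ K₂₃} ((λ _ p → p) , (λ _ p → p)))))
      (image-in {A = A} φ {L} h)
    where
    L : List (Edge 5)
    L = (0F — 2F) ∷ (0F — 3F) ∷ (0F — 4F) ∷ (1F — 2F) ∷ (1F — 3F) ∷ []

  -- If `v` has no neighbour on the flat, no edge is added. Otherwise the edge to one neighbour `q₀`
  -- costs one, and the remaining edges at `v` enter one at a time, each as the last edge of a K₂₃.
  rank-vertex : (x : V n) (cur : List (Fin n)) (v : Fin n) {r : ℕ} → v ∉ cur → Rich x cur cur v →
    Rank≤ (Flat x cur) r → Rank≤ (Flat x (v ∷ cur)) (suc r)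
  rank-vertex x cur v {r} v∉ rich rk with any? (λ q → x q ⊕ x v ≟₃ 𝟎) cur
  ... | no none = rank-mono {Flat x (v ∷ cur)} {Flat x cur} sub (n≤1+n r) rk
    where
    sub : ∀ e → Flat x (v ∷ cur) e → Flat x cur e
    sub e ((here p , here q) , _)    = contradiction (trans p (sym q)) (src≢tgt e)
    sub e ((here refl , there q) , eq) = contradiction (lose q (trans (⊕-comm (x (tgt e)) (x v)) eq)) none
    sub e ((there p , here refl) , eq) = contradiction (lose p eq) none
    sub e ((there p , there q) , eq) = (p , q) , eq
  ... | yes a = rank-mono {Flat x (v ∷ cur)} {Stage cur} final ≤-refl (stage cur id)
    where
    q₀ : Fin n
    q₀ = proj₁ (find a)
    q₀∈ : q₀ ∈ cur
    q₀∈ = proj₁ (proj₂ (find a))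
    q₀-opp : x q₀ ⊕ x v ≡ 𝟎
    q₀-opp = proj₂ (proj₂ (find a))
    ∈cur⇒≢v : ∀ {q} → q ∈ cur → q ≢ v
    ∈cur⇒≢v p refl = v∉ p
    e₀ : ∃[ e ] Joins e q₀ v
    e₀ = edge-between (∈cur⇒≢v q₀∈)
    Stage : List (Fin n) → Edge n → Set
    Stage Q e = (Flat x cur e ⊎ e ≡ proj₁ e₀) ⊎ ∃[ q ] (q ∈ Q × Joins e q v × x q ⊕ x v ≡ 𝟎)
    stage : ∀ Q → (∀ {q} → q ∈ Q → q ∈ cur) → Rank≤ (Stage Q) (suc r)
    stage [] sub = rank-mono {Stage []} {Flat x cur ∪ᵉ proj₁ e₀} (λ { _ (inj₁ s) → s ; _ (inj₂ (_ , () , _)) }) ≤-refl (rank-insert {Flat x cur} (proj₁ e₀) rk)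
    stage (q ∷ Q) sub with x q ⊕ x v ≟₃ 𝟎
    ... | no ne = rank-mono {Stage (q ∷ Q)} {Stage Q} drop ≤-refl (stage Q (sub ∘ there))
      where
      drop : ∀ e → Stage (q ∷ Q) e → Stage Q e
      drop e (inj₁ s) = inj₁ s
      drop e (inj₂ (_ , here refl , _ , eq)) = contradiction eq ne
      drop e (inj₂ (p , there m , r)) = inj₂ (p , m , r)
    ... | yes opp with q₀ ≟ q
    ...   | yes refl = rank-mono {Stage (q ∷ Q)} {Stage Q} drop ≤-refl (stage Q (sub ∘ there))
      where
      drop : ∀ e → Stage (q ∷ Q) e → Stage Q e
      drop e (inj₁ s) = inj₁ s
      drop e (inj₂ (_ , here refl , jn , _)) = inj₁ (inj₂ (joins-unique jn (proj₂ e₀)))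
      drop e (inj₂ (p , there m , r)) = inj₂ (p , m , r)
    ...   | no q₀≢q with rich q₀∈ (sub (here refl)) q₀-opp opp q₀≢q
    ...     | p₁ , p₂ , p₁∈ , p₂∈ , p₁≢p₂ , (xp₁ , xp₂) , (p₁≢q₀ , p₁≢q) , (p₂≢q₀ , p₂≢q) =
      rank-mono {Stage (q ∷ Q)} {Stage Q ∪ᵉ embed φ (1F — 4F)} drop ≤-refl (K₂₃-closure {Stage Q} φ edges (stage Q (sub ∘ there)))
      where
      q∈ : q ∈ cur
      q∈ = sub (here refl)
      φ : Embedding 5 n
      φ = fromUnique (q₀ ∷ q ∷ p₁ ∷ p₂ ∷ v ∷ [])
        ((q₀≢q ∷ (p₁≢q₀ ∘ sym) ∷ (p₂≢q₀ ∘ sym) ∷ ∈cur⇒≢v q₀∈ ∷ []) ∷ ((p₁≢q ∘ sym) ∷ (p₂≢q ∘ sym) ∷ ∈cur⇒≢v q∈ ∷ []) ∷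
         (p₁≢p₂ ∷ ∈cur⇒≢v p₁∈ ∷ []) ∷ (∈cur⇒≢v p₂∈ ∷ []) ∷ [] ∷ [])
      old : ∀ (i j : Fin 5) {i<j} → at φ i ∈ cur → at φ j ∈ cur → x (at φ i) ⊕ x v ≡ 𝟎 → x (at φ j) ≡ x v → Stage Q (embed φ ((i — j) {i<j}))
      old i j {i<j} p s eq eq′ = inj₁ (inj₁ (flat-joins x (embed-joins φ (joins-self ((i — j) {i<j}))) p s (trans (cong (x (at φ i) ⊕_) eq′) eq)))
      edges : ∀ {e} → e ∈ (0F — 2F) ∷ (0F — 3F) ∷ (0F — 4F) ∷ (1F — 2F) ∷ (1F — 3F) ∷ [] → Stage Q (embed φ e)
      edges (here refl) = old 0F 2F q₀∈ p₁∈ q₀-opp xp₁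
      edges (there (here refl)) = old 0F 3F q₀∈ p₂∈ q₀-opp xp₂
      edges (there (there (here refl))) = inj₁ (inj₂ (joins-unique (embed-joins φ (joins-self (0F — 4F))) (proj₂ e₀)))
      edges (there (there (there (here refl)))) = old 1F 2F q∈ p₁∈ opp xp₁
      edges (there (there (there (there (here refl))))) = old 1F 3F q∈ p₂∈ opp xp₂
      drop : ∀ e → Stage (q ∷ Q) e → (Stage Q ∪ᵉ embed φ (1F — 4F)) e
      drop e (inj₁ s) = inj₁ (inj₁ s)
      drop e (inj₂ (_ , here refl , jn , _)) = inj₂ (joins-unique jn (embed-joins φ (joins-self (1F — 4F))))
      drop e (inj₂ (p , there m , r)) = inj₁ (inj₂ (p , m , r))
    final : ∀ e → Flat x (v ∷ cur) e → Stage cur e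
    final e ((here p , here q) , _)    = contradiction (trans p (sym q)) (src≢tgt e)
    final e ((here refl , there q) , eq) = inj₂ (tgt e , q , bwd (refl , refl) , trans (⊕-comm (x (tgt e)) (x v)) eq)
    final e ((there p , here refl) , eq) = inj₂ (src e , p , fwd (refl , refl) , eq)
    final e ((there p , there q) , eq) = inj₁ (inj₁ ((p , q) , eq))

  -- The number `c` is the excess of rank over vertices, and attaching a vertex does not increase
  -- it. It is 1 for complete graphs started from K₄, and 0 for hyperplanes and for a K₈ of rank 8.
  rank-grow : (x : V n) (base vs : List (Fin n)) (c : ℕ) → Unique base → (∀ {v} → v ∈ base → v ∈ vs) →
    (∀ {v} → v ∈ vs → v ∉ base → Rich x base vs v) →
    Rank≤ (Flat x base) (c + length base) → Rank≤ (Flat x vs) (c + length vs)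
  rank-grow x base vs c ubase base⊆vs rich rk = go vs base ubase id base⊆vs id inj₂ rk
    where
    go : ∀ todo cur → Unique cur → (∀ {v} → v ∈ base → v ∈ cur) → (∀ {v} → v ∈ cur → v ∈ vs) → (∀ {v} → v ∈ todo → v ∈ vs) →
      (∀ {v} → v ∈ vs → v ∈ cur ⊎ v ∈ todo) → Rank≤ (Flat x cur) (c + length cur) → Rank≤ (Flat x vs) (c + length vs)
    go [] cur ucur base⊆ cur⊆ _ cover rk = rank-mono {Flat x vs} {Flat x cur} (λ _ ((p , q) , eq) → (in-cur p , in-cur q) , eq)
        (+-monoʳ-≤ c (unique-length-≤ ucur cur⊆)) rk
      where
      in-cur : ∀ {v} → v ∈ vs → v ∈ cur
      in-cur p with cover p
      ... | inj₁ q = q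
      ... | inj₂ ()
    go (v ∷ todo) cur ucur base⊆ cur⊆ todo⊆ cover rk with v ∈ᶠ? cur
    ... | yes v∈ = go todo cur ucur base⊆ cur⊆ (todo⊆ ∘ there) cover′ rk
      where
      cover′ : ∀ {w} → w ∈ vs → w ∈ cur ⊎ w ∈ todo
      cover′ p with cover p
      ... | inj₁ q           = inj₁ q
      ... | inj₂ (here refl) = inj₁ v∈
      ... | inj₂ (there q)   = inj₂ q
    ... | no v∉ = go todo (v ∷ cur) (All.tabulate (λ { p refl → v∉ p }) ∷ ucur) (there ∘ base⊆) cur⊆′ (todo⊆ ∘ there) cover′
        (subst (Rank≤ (Flat x (v ∷ cur))) (sym (+-suc c (length cur)))
          (rank-vertex x cur v v∉ (λ p q a b ne → Spread-⊆ {x = x} {base} {cur} base⊆ (rich (todo⊆ (here refl)) (v∉ ∘ base⊆) (cur⊆ p) (cur⊆ q) a b ne)) rk))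
      where
      cur⊆′ : ∀ {w} → w ∈ v ∷ cur → w ∈ vs
      cur⊆′ (here refl) = todo⊆ (here refl)
      cur⊆′ (there p)   = cur⊆ p
      cover′ : ∀ {w} → w ∈ vs → w ∈ v ∷ cur ⊎ w ∈ todo
      cover′ p with cover p
      ... | inj₁ q           = inj₁ (there q)
      ... | inj₂ (here refl) = inj₁ (here refl)
      ... | inj₂ (there q)   = inj₂ q

  rank-within : (vs : List (Fin n)) → Unique vs → Rank≤ (Within vs) (length (allEdges (length vs)))
  rank-within vs u = rank-mono {Within vs} {_∈ map (embed φ) (allEdges (length vs))} sub (≤-reflexive (length-map (embed φ) (allEdges (length vs))))
      (rank-list (map (embed φ) (allEdges (length vs))))
    where
    φ = fromUnique vs u
    sub : ∀ e → Within vs e → e ∈ map (embed φ) (allEdges (length vs))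
    sub e w with within-embed u {e} w
    ... | e′ , refl = ∈-map⁺ (embed φ) (∈-allEdges e′)

  rank-K₄ : (w₁ w₂ w₃ w₄ : Fin n) → Unique (w₁ ∷ w₂ ∷ w₃ ∷ w₄ ∷ []) → Rank≤ (Within (w₁ ∷ w₂ ∷ w₃ ∷ w₄ ∷ [])) 5
  rank-K₄ w₁ w₂ w₃ w₄ u = rank-mono {_} {(_∈ map (embed φ) L) ∪ᵉ embed φ (0F — 1F)} sub ≤-refl
      (K₄-closure {_∈ map (embed φ) L} φ (∈-map⁺ (embed φ)) (rank-list (map (embed φ) L)))
    where
    φ : Embedding 4 n
    φ = fromUnique (w₁ ∷ w₂ ∷ w₃ ∷ w₄ ∷ []) u
    L : List (Edge 4)
    L = (0F — 2F) ∷ (0F — 3F) ∷ (1F — 2F) ∷ (1F — 3F) ∷ (2F — 3F) ∷ []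
    sub : ∀ e → Within (w₁ ∷ w₂ ∷ w₃ ∷ w₄ ∷ []) e → ((_∈ map (embed φ) L) ∪ᵉ embed φ (0F — 1F)) e
    sub e w with within-embed u {e} w
    ... | e′ , refl with ∈-K₄ e′
    ...   | here refl = inj₂ refl
    ...   | there p   = inj₁ (∈-map⁺ (embed φ) p)

  -- For x = 0 the flat is the complete graph. Growth starts from K₄, of rank at most 5 because it
  -- is dependent; up to three vertices the number of edges is small enough.
  rank-complete : (vs : List (Fin n)) → Unique vs → Rank≤ (Within vs) (suc (length vs))
  rank-complete vs u = go vs u (length vs ≤? 3)
    where
    grow : ∀ a b c d rest → Unique (a ∷ b ∷ c ∷ d ∷ rest) → Rank≤ (Within (a ∷ b ∷ c ∷ d ∷ rest)) (5 + length rest)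
    grow a b c d rest ((ab ∷ ac ∷ ad ∷ _) ∷ (bc ∷ bd ∷ _) ∷ (cd ∷ _) ∷ _) =
        rank-mono {Within us} {Flat (λ _ → 𝟎) us} (λ _ w → w , refl) ≤-refl
          (rank-grow (λ _ → 𝟎) base us 1 ubase ∈-++⁺ˡ rich (rank-mono {Flat (λ _ → 𝟎) base} {Within base} (λ _ → proj₁) ≤-refl (rank-K₄ a b c d ubase)))
      where
      us base : List (Fin n)
      us = a ∷ b ∷ c ∷ d ∷ rest
      base = a ∷ b ∷ c ∷ d ∷ []
      ubase : Unique base
      ubase = (ab ∷ ac ∷ ad ∷ []) ∷ (bc ∷ bd ∷ []) ∷ (cd ∷ []) ∷ [] ∷ []
      rich : ∀ {v} → v ∈ us → v ∉ base → Rich (λ _ → 𝟎) base us v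
      rich _ _ {q₀} {q} _ _ _ _ _ = let p₁ , p₂ , m₁ , m₂ , ne , r = avoid-two base ubase ≤-refl q₀ q in p₁ , p₂ , m₁ , m₂ , ne , (refl , refl) , r
    go : ∀ vs → Unique vs → Dec (length vs ≤ 3) → Rank≤ (Within vs) (suc (length vs))
    go vs u (yes le) = rank-mono {Within vs} {Within vs} (λ _ → id) (≤-trans (allEdges-length-≤ (length vs) le) (n≤1+n _)) (rank-within vs u)
    go (a ∷ b ∷ c ∷ d ∷ rest) u (no _) = grow a b c d rest u
    go [] u (no nle) = contradiction z≤n nle
    go (_ ∷ []) u (no nle) = contradiction (s≤s z≤n) nle
    go (_ ∷ _ ∷ []) u (no nle) = contradiction (s≤s (s≤s z≤n)) nle
    go (_ ∷ _ ∷ _ ∷ []) u (no nle) = contradiction ≤-refl nle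

  rank-2C₄ : (φ : Embedding 8 n) → ¬ M (image φ 2C₄) → Rank≤ (_∈ map (embed φ) 2C₄) 7
  rank-2C₄ φ ¬m S S⊆ mS = ≮⇒≥ λ lt → ¬m (ind-down (image φ 2C₄) S
    (⊆-full {S = S} {image φ 2C₄} (λ e p → fromList-∈ (map (embed φ) 2C₄) (S⊆ e p)) (≤-trans (size-image-≤ φ 2C₄) lt)) mS)

  -- On the eight vertices, (4F — 6F) costs one and then (5F — 7F) closes the K₄.
  rank-split : (φ : Embedding 8 n) → ¬ M (image φ 2C₄) → Rank≤ (_∈ map (embed φ) ((5F — 7F) ∷ (4F — 6F) ∷ 2C₄)) 8
  rank-split φ ¬m = rank-mono {_∈ map (embed φ) ((5F — 7F) ∷ (4F — 6F) ∷ 2C₄)} {A ∪ᵉ embed (φ ∘ᵉ ψ) (0F — 1F)} sub ≤-refl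
      (K₄-closure {A} (φ ∘ᵉ ψ) edges (rank-insert {_∈ map (embed φ) 2C₄} (embed φ (4F — 6F)) (rank-2C₄ φ ¬m)))
    where
    A : Edge n → Set
    A = (_∈ map (embed φ) 2C₄) ∪ᵉ embed φ (4F — 6F)
    ψ : Embedding 4 8
    ψ = fromUnique? (5F ∷ 7F ∷ 4F ∷ 6F ∷ []) _
    via : ∀ e f → Joins f (at ψ (src e)) (at ψ (tgt e)) → f ∈ 2C₄ → A (embed (φ ∘ᵉ ψ) e)
    via e f jn f∈ = inj₁ (subst (_∈ map (embed φ) 2C₄) (sym (embed-∘ φ ψ e jn)) (∈-map⁺ (embed φ) f∈))
    edges : ∀ {e} → e ∈ (0F — 2F) ∷ (0F — 3F) ∷ (1F — 2F) ∷ (1F — 3F) ∷ (2F — 3F) ∷ [] → A (embed (φ ∘ᵉ ψ) e)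
    edges (here refl) = via (0F — 2F) (4F — 5F) (bwd (refl , refl)) (toWitness {a? = (4F — 5F) ∈ᵉ? 2C₄} _)
    edges (there (here refl)) = via (0F — 3F) (5F — 6F) (fwd (refl , refl)) (toWitness {a? = (5F — 6F) ∈ᵉ? 2C₄} _)
    edges (there (there (here refl))) = via (1F — 2F) (4F — 7F) (bwd (refl , refl)) (toWitness {a? = (4F — 7F) ∈ᵉ? 2C₄} _)
    edges (there (there (there (here refl)))) = via (1F — 3F) (6F — 7F) (bwd (refl , refl)) (toWitness {a? = (6F — 7F) ∈ᵉ? 2C₄} _)
    edges (there (there (there (there (here refl))))) = inj₂ (embed-∘ φ ψ (2F — 3F) (fwd (refl , refl)))
    sub : ∀ e → e ∈ map (embed φ) ((5F — 7F) ∷ (4F — 6F) ∷ 2C₄) → (A ∪ᵉ embed (φ ∘ᵉ ψ) (0F — 1F)) e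
    sub e (here eq) = inj₂ (trans eq (sym (embed-∘ φ ψ (0F — 1F) (fwd (refl , refl)))))
    sub e (there (here eq)) = inj₁ (inj₂ eq)
    sub e (there (there p)) = inj₁ (inj₁ p)

  -- A single nonzero vertex is isolated on this flat and pays for the excess 1 of the complete
  -- graph on the zeros. A 4-cycle with at most three zeros has few enough edges. For a 4-cycle with
  -- four zeros the separate bounds 4 + 5 are one too many for eight vertices, and the dependence of
  -- C₄ ∪ C₄ saves that one.
  rank-bases : (x : V n) {bs ws : List (Fin n)} → NonzeroBase x bs → ZeroBase ws → Unique bs → Unique ws → Unique (bs ++ ws) →
    (∀ {w} → w ∈ ws → x w ≡ 𝟎) →
    ((φ : Embedding 8 n) → (∀ i → at φ i ∈ bs ++ ws) → (∀ i → x (at φ i) ≡ split-pattern i) → ¬ M (image φ 2C₄)) →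
    Rank≤ (Flat x (bs ++ ws)) (length (bs ++ ws))
  rank-bases x {ws = ws} (single {a} xa) zb ubs uws u zero-ws dep =
      rank-mono {Flat x (a ∷ ws)} {Within ws} sub ≤-refl (rank-complete ws uws)
    where
    sub : ∀ e → Flat x (a ∷ ws) e → Within ws e
    sub e ((here p , here q) , _) = contradiction (trans p (sym q)) (src≢tgt e)
    sub e ((here refl , there q) , eq) = contradiction (opposite eq (zero-ws q)) xa
    sub e ((there p , here refl) , eq) = contradiction (opposite (trans (⊕-comm (x a) (x (src e))) eq) (zero-ws p)) xa
    sub e ((there p , there q) , _) = p , q
  rank-bases x {bs} {ws} (square {a₁} {b₁} {a₂} {b₂} xa₁ xb₁ xa₂ xb₂) (few le) ubs uws u zero-ws dep =
      rank-mono {Flat x (bs ++ ws)} {_∈ L₁ ++ L₂} sub len (rank-list (L₁ ++ L₂))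
    where
    φ = fromUnique bs ubs
    ψ = fromUnique ws uws
    L₁ = map (embed φ) C₄
    L₂ = map (embed ψ) (allEdges (length ws))
    len : length (L₁ ++ L₂) ≤ length (bs ++ ws)
    len = s≤s (s≤s (s≤s (s≤s (≤-trans (≤-reflexive (length-map (embed ψ) (allEdges (length ws)))) (allEdges-length-≤ (length ws) le)))))
    values : ∀ i → x (at φ i) ≡ square-pattern i
    values 0F = xa₁
    values 1F = xb₁
    values 2F = xa₂
    values 3F = xb₂
    square-≢ : ∀ i → square-pattern i ≢ 𝟎
    square-≢ 0F ()
    square-≢ 1F ()
    square-≢ 2F ()
    square-≢ 3F ()
    nonzero : ∀ {v} → v ∈ bs → x v ≢ 𝟎
    nonzero p xv = square-≢ (Any.index p) (trans (sym (values (Any.index p))) (trans (cong x (sym (lookup-index p))) xv))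
    inside : ∀ e → Within bs e → x ∙ e ≡ 𝟎 → e ∈ L₁
    inside e w eq =
      let e′ , eq′ = within-embed ubs {e} w in
      subst (_∈ L₁) (sym eq′) (∈-map⁺ (embed φ) (square-flat e′ (trans (sym (∙-cong values e′)) (trans (sym (∙-embed x φ e′)) (trans (cong (x ∙_) (sym eq′)) eq)))))
    sub : ∀ e → Flat x (bs ++ ws) e → e ∈ L₁ ++ L₂
    sub e ((p , q) , eq) with ∈-++⁻ bs p | ∈-++⁻ bs q
    ... | inj₁ p′ | inj₁ q′ = ∈-++⁺ˡ (inside e (p′ , q′) eq)
    ... | inj₁ p′ | inj₂ q′ = contradiction (opposite eq (zero-ws q′)) (nonzero p′)
    ... | inj₂ p′ | inj₁ q′ = contradiction (opposite (trans (⊕-comm (x (tgt e)) (x (src e))) eq) (zero-ws p′)) (nonzero q′)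
    ... | inj₂ p′ | inj₂ q′ = let e′ , eq′ = within-embed uws {e} (p′ , q′) in
      ∈-++⁺ʳ L₁ (subst (_∈ L₂) (sym eq′) (∈-map⁺ (embed ψ) (∈-allEdges e′)))
  rank-bases x {bs} {ws} (square {a₁} {b₁} {a₂} {b₂} xa₁ xb₁ xa₂ xb₂) (four {w₁ = w₁} {w₂} {w₃} {w₄}) ubs uws u zero-ws dep =
      rank-mono {Flat x (bs ++ ws)} {_∈ L} sub ≤-refl (rank-split φ (dep φ (λ i → ∈-lookup i) values))
    where
    φ = fromUnique (bs ++ ws) u
    L = map (embed φ) ((5F — 7F) ∷ (4F — 6F) ∷ 2C₄)
    values : ∀ i → x (at φ i) ≡ split-pattern i
    values 0F = xa₁
    values 1F = xb₁
    values 2F = xa₂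
    values 3F = xb₂
    values 4F = zero-ws (here refl)
    values 5F = zero-ws (there (here refl))
    values 6F = zero-ws (there (there (here refl)))
    values 7F = zero-ws (there (there (there (here refl))))
    sub : ∀ e → Flat x (bs ++ ws) e → e ∈ L
    sub e (w , eq) =
      let e′ , eq′ = within-embed u {e} w in
      subst (_∈ L) (sym eq′) (∈-map⁺ (embed φ) (split-flat e′ (trans (sym (∙-cong values e′)) (trans (sym (∙-embed x φ e′)) (trans (cong (x ∙_) (sym eq′)) eq)))))

  -- Dependence is demanded only of copies of C₄ ∪ C₄ inside `vs` with the values of
  -- `split-pattern`. The demand is therefore vacuous when x has no zeros or `vs` has fewer than
  -- eight vertices, and both cases occur below.
  rank-flat : (x : V n) (vs : List (Fin n)) → Unique vs → ∃[ v ] (v ∈ vs × x v ≢ 𝟎) →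
    ((φ : Embedding 8 n) → (∀ i → at φ i ∈ vs) → (∀ i → x (at φ i) ≡ split-pattern i) → ¬ M (image φ 2C₄)) →
    Rank≤ (Flat x vs) (length vs)
  rank-flat x vs u nz dep =
    let bs , nb , ubs , bs⊆ , rich = nonzero-base x vs u nz
        ws , zb , uws , ws⊆ , rich′ = zero-base x vs u
        nonzero = nonzero-∈ nb
        ++⊆ : ∀ {v} → v ∈ bs ++ ws → v ∈ vs
        ++⊆ p = [ bs⊆ , (λ q → proj₁ (ws⊆ q)) ]′ (∈-++⁻ bs p)
        u++ = Uniqueₚ.++⁺ ubs uws (λ (p , q) → nonzero p (proj₂ (ws⊆ q)))
    in rank-grow x (bs ++ ws) vs 0 u++ ++⊆ (combine bs ws rich rich′)
         (rank-bases x nb zb ubs uws u++ (λ p → proj₂ (ws⊆ p)) (λ φ in-base → dep φ (λ i → ++⊆ (in-base i))))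
    where
    nonzero-∈ : ∀ {bs} → NonzeroBase x bs → ∀ {v} → v ∈ bs → x v ≢ 𝟎
    nonzero-∈ (single ne) (here refl) = ne
    nonzero-∈ (square p q r s) (here refl) eq = contradiction (trans (sym p) eq) λ ()
    nonzero-∈ (square p q r s) (there (here refl)) eq = contradiction (trans (sym q) eq) λ ()
    nonzero-∈ (square p q r s) (there (there (here refl))) eq = contradiction (trans (sym r) eq) λ ()
    nonzero-∈ (square p q r s) (there (there (there (here refl)))) eq = contradiction (trans (sym s) eq) λ ()
    combine : ∀ bs ws → (∀ {v} → v ∈ vs → v ∉ bs → x v ≢ 𝟎 → Rich x bs vs v) → (∀ {v} → v ∈ vs → v ∉ ws → x v ≡ 𝟎 → Rich x ws vs v) →
      ∀ {v} → v ∈ vs → v ∉ bs ++ ws → Rich x (bs ++ ws) vs v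
    combine bs ws rich rich′ {v} v∈ v∉ q₀∈ q∈ op op′ ne with x v ≟₃ 𝟎
    ... | yes xv = Spread-⊆ {x = x} {ws} {bs ++ ws} (∈-++⁺ʳ bs) (rich′ v∈ (v∉ ∘ ∈-++⁺ʳ bs) xv q₀∈ q∈ op op′ ne)
    ... | no xv  = Spread-⊆ {x = x} {bs} {bs ++ ws} ∈-++⁺ˡ (rich v∈ (v∉ ∘ ∈-++⁺ˡ) xv q₀∈ q∈ op op′ ne)

  rank-bipartite : (φ : Embedding 8 n) (y : V 8) → (∀ i → y i ≢ 𝟎) → Rank≤ (Flat (extend-by-𝟎 φ y) (vertices φ)) 8
  rank-bipartite φ y y≢0 = rank-flat (extend-by-𝟎 φ y) (vertices φ) (vertices-unique φ)
      (at φ 0F , ∈-vertices φ 0F , (λ eq → y≢0 0F (trans (sym (extend-at φ y 0F)) eq)))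
      (λ ψ in-φ values → contradiction (values 4F) (nonzero (in-φ 4F)))
    where
    nonzero : ∀ {v} → v ∈ vertices φ → extend-by-𝟎 φ y v ≢ 𝟎
    nonzero p eq with vertices-∈ φ p
    ... | i , refl = y≢0 i (trans (sym (extend-at φ y i)) eq)

  -- An independent C₄ ∪ C₄ is a basis of both complete bipartite graphs containing it,
  -- and the two together span K₈.
  rank-K₈ : (φ : Embedding 8 n) → M (image φ 2C₄) → Rank≤ (Within (vertices φ)) 8
  rank-K₈ φ m = rank-mono {Within (vertices φ)} {A ∪ᵉ new ψ₁ ∪ᵉ new ψ₂ ∪ᵉ new ψ₃ ∪ᵉ new ψ₄} cover ≤-refl
      (K₄-closure {A ∪ᵉ new ψ₁ ∪ᵉ new ψ₂ ∪ᵉ new ψ₃} (φ ∘ᵉ ψ₄) (λ p → inj₁ (inj₁ (inj₁ (old ψ₄ _ p))))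
      (K₄-closure {A ∪ᵉ new ψ₁ ∪ᵉ new ψ₂} (φ ∘ᵉ ψ₃) (λ p → inj₁ (inj₁ (old ψ₃ _ p)))
      (K₄-closure {A ∪ᵉ new ψ₁} (φ ∘ᵉ ψ₂) (λ p → inj₁ (old ψ₂ _ p))
      (K₄-closure {A} (φ ∘ᵉ ψ₁) (old ψ₁ _)
      (rank-join {Flat x₁ (vertices φ)} {Flat x₂ (vertices φ)} (image φ 2C₄) m (size-image φ 2C₄-unique)
        (image-in {A = Flat x₁ (vertices φ)} φ {2C₄} (λ {e} p → embed-within φ e , trans (∙-φ pattern₁ e) (All.lookup 2C₄-pattern₁ p)))
        (image-in {A = Flat x₂ (vertices φ)} φ {2C₄} (λ {e} p → embed-within φ e , trans (∙-φ pattern₂ e) (All.lookup 2C₄-pattern₂ p)))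
        (rank-bipartite φ pattern₁ λ { 0F () ; 1F () ; 2F () ; 3F () ; 4F () ; 5F () ; 6F () ; 7F () })
        (rank-bipartite φ pattern₂ λ { 0F () ; 1F () ; 2F () ; 3F () ; 4F () ; 5F () ; 6F () ; 7F () }))))))
    where
    x₁ = extend-by-𝟎 φ pattern₁
    x₂ = extend-by-𝟎 φ pattern₂
    A : Edge n → Set
    A e = Flat x₁ (vertices φ) e ⊎ Flat x₂ (vertices φ) e
    ∙-φ : ∀ y e → extend-by-𝟎 φ y ∙ embed φ e ≡ y ∙ e
    ∙-φ y e = trans (∙-embed (extend-by-𝟎 φ y) φ e) (∙-cong (extend-at φ y) e)
    ψ₁ ψ₂ ψ₃ ψ₄ : Embedding 4 8
    -- Each chord of one cycle spans a K₄ with an edge of the other cycle, and the other five edges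
    -- of that K₄ lie in the two K₄,₄.
    ψ₁ = fromUnique? (0F ∷ 2F ∷ 4F ∷ 5F ∷ []) _
    ψ₂ = fromUnique? (1F ∷ 3F ∷ 4F ∷ 5F ∷ []) _
    ψ₃ = fromUnique? (4F ∷ 6F ∷ 0F ∷ 1F ∷ []) _
    ψ₄ = fromUnique? (5F ∷ 7F ∷ 0F ∷ 1F ∷ []) _
    new : Embedding 4 8 → Edge n
    new ψ = embed (φ ∘ᵉ ψ) (0F — 1F)
    killed : ∀ (ψ : Embedding 4 8) e → Killed (λ i → pattern₁ (at ψ i)) (λ i → pattern₂ (at ψ i)) e → A (embed (φ ∘ᵉ ψ) e)
    killed ψ e h = go h
      where
      in-φ : Within (vertices φ) (embed (φ ∘ᵉ ψ) e)
      in-φ with embed-joins (φ ∘ᵉ ψ) (joins-self e)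
      ... | fwd (p , q) = subst (_∈ vertices φ) (sym p) (∈-vertices φ _) , subst (_∈ vertices φ) (sym q) (∈-vertices φ _)
      ... | bwd (p , q) = subst (_∈ vertices φ) (sym p) (∈-vertices φ _) , subst (_∈ vertices φ) (sym q) (∈-vertices φ _)
      value : ∀ y → extend-by-𝟎 φ y ∙ embed (φ ∘ᵉ ψ) e ≡ (λ i → y (at ψ i)) ∙ e
      value y = trans (∙-embed (extend-by-𝟎 φ y) (φ ∘ᵉ ψ) e) (∙-cong (λ i → extend-at φ y (at ψ i)) e)
      go : Killed (λ i → pattern₁ (at ψ i)) (λ i → pattern₂ (at ψ i)) e → A (embed (φ ∘ᵉ ψ) e)
      go (inj₁ p) = inj₁ (in-φ , trans (value pattern₁) p)
      go (inj₂ p) = inj₂ (in-φ , trans (value pattern₂) p)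
    L : List (Edge 4)
    L = (0F — 2F) ∷ (0F — 3F) ∷ (1F — 2F) ∷ (1F — 3F) ∷ (2F — 3F) ∷ []
    old : ∀ (ψ : Embedding 4 8) → True (all? (killed? (λ i → pattern₁ (at ψ i)) (λ i → pattern₂ (at ψ i))) L) →
      ∀ {e} → e ∈ L → A (embed (φ ∘ᵉ ψ) e)
    old ψ t {e} p = killed ψ e (All.lookup (toWitness t) p)
    cover : ∀ e → Within (vertices φ) e → (A ∪ᵉ new ψ₁ ∪ᵉ new ψ₂ ∪ᵉ new ψ₃ ∪ᵉ new ψ₄) e
    cover e w with within-vertices φ {e} w
    ... | e′ , eq with K₈-cover e′
    ...   | inj₁ (inj₁ p) = inj₁ (inj₁ (inj₁ (inj₁ (inj₁ (w , trans (cong (x₁ ∙_) eq) (trans (∙-φ pattern₁ e′) p))))))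
    ...   | inj₁ (inj₂ p) = inj₁ (inj₁ (inj₁ (inj₁ (inj₂ (w , trans (cong (x₂ ∙_) eq) (trans (∙-φ pattern₂ e′) p))))))
    ...   | inj₂ (here refl) = inj₁ (inj₁ (inj₁ (inj₂ (trans eq (sym (embed-∘ φ ψ₁ (0F — 1F) (fwd (refl , refl))))))))
    ...   | inj₂ (there (here refl)) = inj₁ (inj₁ (inj₂ (trans eq (sym (embed-∘ φ ψ₂ (0F — 1F) (fwd (refl , refl)))))))
    ...   | inj₂ (there (there (here refl))) = inj₁ (inj₂ (trans eq (sym (embed-∘ φ ψ₃ (0F — 1F) (fwd (refl , refl))))))
    ...   | inj₂ (there (there (there (here refl)))) = inj₂ (trans eq (sym (embed-∘ φ ψ₄ (0F — 1F) (fwd (refl , refl)))))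

  -- This K₈ has rank at most 8, its number of vertices: growing the complete graph from it instead
  -- of from K₄ lowers the excess from 1 to 0.
  2C₄-independent⇒rank≤n : (φ : Embedding 8 n) → M (image φ 2C₄) → Rank≤ (λ _ → ⊤) n
  2C₄-independent⇒rank≤n φ m = rank-mono {λ _ → ⊤} {Flat (λ _ → 𝟎) (allFin n)} (λ e _ → (∈-allFin (src e) , ∈-allFin (tgt e)) , refl)
      (≤-reflexive (length-tabulate id))
      (rank-grow (λ _ → 𝟎) (vertices φ) (allFin n) 0 (vertices-unique φ) (λ _ → ∈-allFin _) rich
        (rank-mono {Flat (λ _ → 𝟎) (vertices φ)} {Within (vertices φ)} (λ _ → proj₁) ≤-refl (rank-K₈ φ m)))
    where
    rich : ∀ {v} → v ∈ allFin n → v ∉ vertices φ → Rich (λ _ → 𝟎) (vertices φ) (allFin n) v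
    rich _ _ {q₀} {q} _ _ _ _ _ =
      let p₁ , p₂ , m₁ , m₂ , ne , r = avoid-two (vertices φ) (vertices-unique φ) (s≤s (s≤s (s≤s (s≤s z≤n)))) q₀ q
      in p₁ , p₂ , m₁ , m₂ , ne , (refl , refl) , r

  -- R is an independent set of size 8 in a K₇. A K₈ through this K₇ has rank at most 8 and is thus
  -- spanned by R, so R spans all edges that meet the K₇, and by K₄ circuits also the others.
  2C₄-independent⇒rank≤8 : (∀ (φ : Embedding 8 n) → M (image φ 2C₄)) → (ψ : Embedding 7 n) (z : Fin n) → z ∉ vertices ψ →
    (R : List (Edge 7)) → Unique R → length R ≡ 8 → M (image ψ R) → Rank≤ (λ _ → ⊤) 8
  2C₄-independent⇒rank≤8 all-m ψ z z∉ R uR lenR mR S _ mS = ≮⇒≥ λ lt →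
      let e , e∈S , e∉R , mRe = ind-exch (image ψ R) S mR mS (≤-trans (s≤s (≤-reflexive sizeR)) lt) in
      <-irrefl refl (≤-trans (≤-reflexive (sym (trans (size-insert {e = e} {image ψ R} e∉R) (cong suc sizeR)))) (rank-e e (insert e (image ψ R)) (in-A e) mRe))
    where
    sizeR : size (image ψ R) ≡ 8
    sizeR = trans (size-image ψ uR) lenR
    plus : Fin n → List (Fin n)
    plus u = u ∷ vertices ψ
    rank-new : ∀ u → u ∉ vertices ψ → Rank≤ (Within (plus u)) 8
    rank-new u u∉ = rank-K₈ φ (all-m φ)
      where
      φ : Embedding 8 n
      φ = fromUnique (plus u) (All.tabulate (λ { p refl → u∉ p }) ∷ vertices-unique ψ)
    rank-plus : ∀ u → Rank≤ (Within (plus u)) 8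
    rank-plus u with u ∈ᶠ? vertices ψ
    ... | no u∉  = rank-new u u∉
    -- For `u` inside the K₇ there are only seven distinct vertices; the outside vertex `z`
    -- completes them to a K₈.
    ... | yes u∈ = rank-mono {Within (plus u)} {Within (plus z)} (λ _ (p , q) → move p , move q) ≤-refl (rank-new z z∉)
      where
      move : ∀ {v} → v ∈ plus u → v ∈ plus z
      move (here refl) = there u∈
      move (there p)   = there p
    A : Edge n → Edge n → Set
    A e f = Within (plus (src e)) f ⊎ Within (plus (tgt e)) f
    R-in : ∀ u f → image ψ R f ≡ true → Within (plus u) f
    R-in u = image-in {A = Within (plus u)} ψ {R} (λ {f} _ → there (proj₁ (embed-within ψ f)) , there (proj₂ (embed-within ψ f)))
    rank-A : ∀ e → Rank≤ (A e) 8
    rank-A e = rank-join {Within (plus (src e))} {Within (plus (tgt e))} (image ψ R) mR sizeR (R-in (src e)) (R-in (tgt e)) (rank-plus (src e)) (rank-plus (tgt e))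
    in-A : ∀ e f → insert e (image ψ R) f ≡ true → (A e ∪ᵉ e) f
    in-A e f p with insert-inv e (image ψ R) p
    ... | inj₁ q = inj₁ (inj₁ (R-in (src e) f q))
    ... | inj₂ q = inj₂ q
    rank-e : ∀ e → Rank≤ (A e ∪ᵉ e) 8
    rank-e e with src e ∈ᶠ? vertices ψ | tgt e ∈ᶠ? vertices ψ
    ... | yes p | _     = rank-mono {A e ∪ᵉ e} {A e} (λ { f (inj₁ a) → a ; f (inj₂ refl) → inj₂ (there p , here refl) }) ≤-refl (rank-A e)
    ... | no _  | yes q = rank-mono {A e ∪ᵉ e} {A e} (λ { f (inj₁ a) → a ; f (inj₂ refl) → inj₁ (here refl , there q) }) ≤-refl (rank-A e)
    -- An edge disjoint from the K₇ closes a K₄ with two vertices of the K₇.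
    ... | no p  | no q  = rank-mono {A e ∪ᵉ e} {A e ∪ᵉ embed φ (0F — 1F)}
        (λ { f (inj₁ a) → inj₁ a ; f (inj₂ refl) → inj₂ (joins-unique (joins-self e) (embed-joins φ (joins-self (0F — 1F)))) }) ≤-refl
        (K₄-closure {A e} φ edges (rank-A e))
      where
      ≢-at : ∀ {v} i → v ∉ vertices ψ → v ≢ at ψ i
      ≢-at i v∉ refl = v∉ (∈-vertices ψ i)
      φ : Embedding 4 n
      φ = fromUnique (src e ∷ tgt e ∷ at ψ 0F ∷ at ψ 1F ∷ [])
        ((src≢tgt e ∷ ≢-at 0F p ∷ ≢-at 1F p ∷ []) ∷ (≢-at 0F q ∷ ≢-at 1F q ∷ []) ∷ ((λ eq → contradiction (injective ψ eq) λ ()) ∷ []) ∷ [] ∷ [])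
      within : ∀ {u f a b} → Joins f a b → a ∈ plus u → b ∈ plus u → Within (plus u) f
      within (fwd (refl , refl)) p q = p , q
      within (bwd (refl , refl)) p q = q , p
      joined : ∀ i j {i<j} → Joins (embed φ ((i — j) {i<j})) (at φ i) (at φ j)
      joined i j {i<j} = embed-joins φ (joins-self ((i — j) {i<j}))
      edges : ∀ {f} → f ∈ (0F — 2F) ∷ (0F — 3F) ∷ (1F — 2F) ∷ (1F — 3F) ∷ (2F — 3F) ∷ [] → A e (embed φ f)
      edges (here refl) = inj₁ (within (joined 0F 2F) (here refl) (there (∈-vertices ψ 0F)))
      edges (there (here refl)) = inj₁ (within (joined 0F 3F) (here refl) (there (∈-vertices ψ 1F)))
      edges (there (there (here refl))) = inj₂ (within (joined 1F 2F) (here refl) (there (∈-vertices ψ 0F)))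
      edges (there (there (there (here refl)))) = inj₂ (within (joined 1F 3F) (here refl) (there (∈-vertices ψ 1F)))
      edges (there (there (there (there (here refl))))) = inj₁ (within (joined 2F 3F) (there (∈-vertices ψ 0F)) (there (∈-vertices ψ 1F)))

-- Edge sets of nullity two with at most eight edges

Incident : Fin n → Edge n → Set
Incident v e = src e ≡ v ⊎ tgt e ≡ v

incident? : (v : Fin n) (e : Edge n) → Dec (Incident v e)
incident? v e = (src e ≟ v) ⊎-dec (tgt e ≟ v)

other-end : {v : Fin n} {e : Edge n} → Incident v e → ∃[ p ] Joins e v p
other-end {e = e} (inj₁ p) = tgt e , fwd (p , refl)
other-end {e = e} (inj₂ p) = src e , bwd (refl , p)

joins⇒incident : {v p : Fin n} {e : Edge n} → Joins e v p → Incident v e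
joins⇒incident (fwd (p , _)) = inj₁ p
joins⇒incident (bwd (_ , p)) = inj₂ p

star : ESet n → Fin n → List (Edge n)
star D v = filter (incident? v) (elems D)

∈-star : (D : ESet n) {v : Fin n} {e : Edge n} → D e ≡ true → Incident v e → e ∈ star D v
∈-star D {v} p = ∈-filter⁺ (incident? v) (∈-elems {S = D} p)

star-∈ : (D : ESet n) {v : Fin n} {e : Edge n} → e ∈ star D v → D e ≡ true × Incident v e
star-∈ D {v} p = let q , r = ∈-filter⁻ (incident? v) {xs = elems D} p in elems-∈ {S = D} q , r

Adj : ESet n → Fin n → Fin n → Set
Adj D u v = ∃[ e ] (D e ≡ true × Joins e u v)

adj-sym : {D : ESet n} {u v : Fin n} → Adj D u v → Adj D v u
adj-sym (e , p , jn) = e , p , joins-sym jn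

adj-≢ : {D : ESet n} {u v : Fin n} → Adj D u v → u ≢ v
adj-≢ (e , p , jn) = joins-≢ jn

TwoNeighbours : ESet n → Fin n → Set
TwoNeighbours D v = ∃[ p ] ∃[ q ] (p ≢ q × Adj D v p × Adj D v q)

branch : (D : ESet n) (v : Fin n) → 2 ≤ length (star D v) → TwoNeighbours D v
branch D v le = go (star D v) le (Uniqueₚ.filter⁺ (incident? v) (elems-unique D)) (star-∈ D)
  where
  go : ∀ es → 2 ≤ length es → Unique es → (∀ {e} → e ∈ es → D e ≡ true × Incident v e) → TwoNeighbours D v
  go (e ∷ f ∷ _) _ ((e≢f ∷ _) ∷ _) h =
    let e∈D , ie = h (here refl)
        f∈D , if = h (there (here refl))
        p , jp = other-end {e = e} ie
        q , jq = other-end {e = f} if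
    in p , q , (λ p≡q → e≢f (joins-unique jp (subst (Joins f v) (sym p≡q) jq))) , (e , e∈D , jp) , (f , f∈D , jq)
  go (e ∷ []) (s≤s ())

leaf : (D : ESet n) (v : Fin n) → length (star D v) ≡ 1 → ∃[ e ] (D e ≡ true × Incident v e × (∀ f → D f ≡ true → Incident v f → f ≡ e))
leaf D v eq = go (star D v) eq (star-∈ D) (∈-star D)
  where
  go : ∀ es → length es ≡ 1 → (∀ {e} → e ∈ es → D e ≡ true × Incident v e) → (∀ {e} → D e ≡ true → Incident v e → e ∈ es) →
    ∃[ e ] (D e ≡ true × Incident v e × (∀ f → D f ≡ true → Incident v f → f ≡ e))
  go (e ∷ []) refl h h′ = e , proj₁ (h (here refl)) , proj₂ (h (here refl)) , (λ f p i → only (h′ p i))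
    where
    only : ∀ {f} → f ∈ e ∷ [] → f ≡ e
    only (here p) = p

-- What remains after pendant edges have been deleted until none is left. Such an edge is a coloop
-- of the set it is deleted from, so nullity is unchanged; `lift` records the direction needed.
record Core (D D′ : ESet n) (vs : List (Fin n)) : Set where
  constructor mkCore
  field
    core-⊆   : D′ ⊆ D
    unique   : Unique vs
    within   : ∀ e → D′ e ≡ true → Within vs e
    min-deg  : ∀ {v} → v ∈ vs → TwoNeighbours D′ v
    lift     : 𝓔 D′ → 𝓔 D

-- The unit vector at the leaf `v` kills every other edge and is nonzero on `e`.
𝓔-leaf : (D : ESet n) (v : Fin n) (e : Edge n) → Incident v e → (∀ f → D f ≡ true → Incident v f → f ≡ e) → 𝓔 (remove e D) → 𝓔 D
𝓔-leaf D v e ie only m = 𝓔-⊆ D (insert e (remove e D)) (⊆-insert-remove e D)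
    (𝓔-insert {S = remove e D} {e} {δ v} m kernel nonzero)
  where
  kernel : Ker (δ v) (remove e D)
  kernel f p = cong₂ _⊕_ (δ-off (λ eq → no-f (inj₁ (sym eq)))) (δ-off (λ eq → no-f (inj₂ (sym eq))))
    where
    no-f : ¬ Incident v f
    no-f i = remove-≢ e D p (only f (remove-⊆ e D f p) i)
  nonzero : δ v ∙ e ≢ 𝟎
  nonzero eq = let p , jp = other-end {e = e} ie in
    𝟏≢𝟎 (trans (sym (cong₂ _⊕_ (δ-diag v) (δ-off (joins-≢ jp)))) (trans (sym (∙-joins (δ v) jp)) eq))

core : (D : ESet n) → ∃[ D′ ] ∃[ vs ] Core D D′ vs
core {n} D = go (size D) D ≤-refl
  where
  Result : ESet n → Set
  Result D = ∃[ D′ ] ∃[ vs ] Core D D′ vs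
  leafless : ∀ D → ¬ (∃[ v ] (length (star D v) ≡ 1)) → Result D
  leafless D none = D , filter P? (allFin n) , mkCore (λ _ p → p) (Uniqueₚ.filter⁺ P? (Uniqueₚ.allFin⁺ n))
      (λ e p → occurs e (inj₁ refl) p , occurs e (inj₂ refl) p)
      (λ {v} v∈ → branch D v (at-least-two (star D v) (λ eq → none (v , eq)) (proj₂ (∈-filter⁻ P? {xs = allFin n} v∈)))) id
    where
    P? : (v : Fin n) → Dec (length (star D v) ≢ 0)
    P? v = ¬? (length (star D v) ℕₚ.≟ 0)
    occurs : ∀ e {v} → Incident v e → D e ≡ true → v ∈ filter P? (allFin n)
    occurs e {v} i p = ∈-filter⁺ P? (∈-allFin v) (nonempty (∈-star D p i))
      where
      nonempty : ∀ {es} → e ∈ es → length es ≢ 0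
      nonempty (here _) ()
      nonempty (there _) ()
    at-least-two : (es : List (Edge n)) → length es ≢ 1 → length es ≢ 0 → 2 ≤ length es
    at-least-two [] _ ne = contradiction refl ne
    at-least-two (_ ∷ []) ne _ = contradiction refl ne
    at-least-two (_ ∷ _ ∷ _) _ _ = s≤s (s≤s z≤n)
  pruned : ∀ D v e → Incident v e → (∀ f → D f ≡ true → Incident v f → f ≡ e) → Result (remove e D) → Result D
  pruned D v e ie only (D′ , vs , mkCore sub u w d l) =
    D′ , vs , mkCore (⊆-trans {S = D′} {remove e D} {D} sub (remove-⊆ e D)) u w d (𝓔-leaf D v e ie only ∘ l)
  go : ∀ m D → size D ≤ m → Result D
  step : ∀ m D → size D ≤ m → Dec (∃[ v ] (length (star D v) ≡ 1)) → Result D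
  go m D le = step m D le (anyFin? (λ v → length (star D v) ℕₚ.≟ 1))
  step m D le (no none) = leafless D none
  step zero D le (yes (v , eq)) =
    let e , e∈D , _ = leaf D v eq in contradiction (≤-trans (≤-reflexive (size-remove {e = e} {D} e∈D)) le) λ ()
  step (suc m) D le (yes (v , eq)) =
    let e , e∈D , ie , only = leaf D v eq in
    pruned D v e ie only (go m (remove e D) (≤-pred (≤-trans (≤-reflexive (size-remove {e = e} {D} e∈D)) le)))

module _ {D D′ : ESet n} {vs : List (Fin n)} (c : Core D D′ vs) where
  open Core c

  -- Double counting of incident pairs: every vertex contributes at least two and every edge only
  -- two.
  handshake : length vs ≤ size D′
  handshake = ≮⇒≥ λ lt → <-irrefl refl (<-≤-trans (+-mono-< lt lt) doubled)
    where
    Good : Fin n × Edge n → Set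
    Good (v , e) = D′ e ≡ true × Incident v e
    darts : ∀ us → Unique us → (∀ {v} → v ∈ us → v ∈ vs) →
      ∃[ ds ] (Unique ds × length ds ≡ length us + length us × (∀ {d} → d ∈ ds → proj₁ d ∈ us × Good d))
    darts [] _ _ = [] , [] , refl , λ ()
    darts (u ∷ us) (u∉ ∷ uus) sub =
      let ds , uds , len , good = darts us uus (sub ∘ there)
          p , q , p≢q , (e , e∈ , je) , (f , f∈ , jf) = min-deg (sub (here refl))
          fresh : ∀ g → All ((u , g) ≢_) ds
          fresh g = All.tabulate (λ { d∈ refl → All.lookup u∉ (proj₁ (good d∈)) refl })
          e≢f : (u , e) ≢ (u , f)
          e≢f eq = p≢q (same-end je jf (cong proj₂ eq))
      in (u , e) ∷ (u , f) ∷ ds , (e≢f ∷ fresh e) ∷ fresh f ∷ uds , cong suc (trans (cong suc len) (sym (+-suc (length us) (length us)))) ,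
         λ { (here refl) → here refl , e∈ , joins⇒incident je
           ; (there (here refl)) → here refl , f∈ , joins⇒incident jf
           ; (there (there d∈)) → there (proj₁ (good d∈)) , proj₂ (good d∈) }
      where
      same-end : ∀ {e f : Edge n} {u p q} → Joins e u p → Joins f u q → e ≡ f → p ≡ q
      same-end je jf refl with joins-ends je jf
      ... | inj₁ (_ , eq) = eq
      ... | inj₂ (eq , eq′) = trans eq′ eq
    both : Edge n → List (Fin n × Edge n)
    both e = (src e , e) ∷ (tgt e , e) ∷ []
    length-both : ∀ es → length (concatMap both es) ≡ length es + length es
    length-both [] = refl
    length-both (e ∷ es) = cong suc (trans (cong suc (length-both es)) (sym (+-suc (length es) (length es))))
    in-both : ∀ {v e} → Incident v e → (v , e) ∈ both e
    in-both (inj₁ refl) = here refl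
    in-both (inj₂ refl) = there (here refl)
    doubled : length vs + length vs ≤ size D′ + size D′
    doubled =
      let ds , uds , len , good = darts vs unique id in
      ≤-trans (≤-reflexive (sym len)) (≤-trans (unique-length-≤ uds (λ {d} d∈ → let e∈ , i = proj₂ (good d∈) in
        ∈-concatMap⁺ both (lose (∈-elems {S = D′} e∈) (in-both {proj₁ d} {proj₂ d} i))))
        (≤-reflexive (trans (length-both (elems D′)) (cong₂ _+_ (sym (size-elems D′)) (sym (size-elems D′))))))

  module _ (x : V n) (kx : Ker x D′) where

    adj-value : ∀ {u v a} → Adj D′ u v → x u ≡ a → x v ≡ 𝟐 ⊗ a
    adj-value {u} {v} (e , e∈ , jn) = opposite (trans (⊕-comm (x v) (x u)) (trans (sym (∙-joins x jn)) (kx e e∈)))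

    adj-in : ∀ {u v} → Adj D′ u v → v ∈ vs
    adj-in (e , e∈ , fwd (_ , refl)) = proj₂ (within e e∈)
    adj-in (e , e∈ , bwd (refl , _)) = proj₁ (within e e∈)

    neighbours : ∀ {v a} → v ∈ vs → x v ≡ a →
      ∃[ p ] ∃[ q ] (p ≢ q × (Adj D′ v p × p ∈ level x vs (𝟐 ⊗ a)) × (Adj D′ v q × q ∈ level x vs (𝟐 ⊗ a)))
    neighbours v∈ xv = let p , q , ne , ap , aq = min-deg v∈ in
      p , q , ne , (ap , ∈-level x (adj-in ap) (adj-value ap xv)) , (aq , ∈-level x (adj-in aq) (adj-value aq xv))

    two-opposite : ∀ {v a} → v ∈ vs → x v ≡ a → 2 ≤ length (level x vs (𝟐 ⊗ a))
    two-opposite v∈ xv = let p , q , ne , (_ , p∈) , (_ , q∈) = neighbours v∈ xv in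
      unique-length-≤ {xs = p ∷ q ∷ []} ((ne ∷ []) ∷ [] ∷ []) (λ { (here refl) → p∈ ; (there (here refl)) → q∈ })

    element : ∀ {xs : List (Fin n)} → 2 ≤ length xs → ∃[ v ] (v ∈ xs)
    element {v ∷ _} _ = v , here refl

    -- Neighbours carry opposite values. A vertex of value a ≠ 0 thus has two neighbours of value
    -- -a, each of which has two neighbours of value a.
    two-and-two : ∃[ v ] (v ∈ vs × x v ≢ 𝟎) → 2 ≤ length (level x vs 𝟏) × 2 ≤ length (level x vs 𝟐)
    two-and-two (v , v∈ , ne) with x v in eq
    ... | 𝟎 = contradiction refl ne
    ... | 𝟏 = let p , p∈ = element (two-opposite v∈ eq) ; p∈′ , xp = level-∈ x vs p∈ in two-opposite p∈′ xp , two-opposite v∈ eq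
    ... | 𝟐 = let p , p∈ = element (two-opposite v∈ eq) ; p∈′ , xp = level-∈ x vs p∈ in two-opposite v∈ eq , two-opposite p∈′ xp

    -- Neighbours of a zero are zeros: `v` and two of its neighbours.
    three-zeros : ∀ {v} → v ∈ vs → x v ≡ 𝟎 → 3 ≤ length (level x vs 𝟎)
    three-zeros {v} v∈ xv = let p , q , ne , (ap , p∈) , (aq , q∈) = neighbours v∈ xv in
      unique-length-≤ {xs = v ∷ p ∷ q ∷ []} ((adj-≢ ap ∷ adj-≢ aq ∷ []) ∷ (ne ∷ []) ∷ [] ∷ [])
        (λ { (here refl) → ∈-level x v∈ xv ; (there (here refl)) → p∈ ; (there (there (here refl))) → q∈ })

level-length : (x : V n) (vs : List (Fin n)) → length (level x vs 𝟏) + length (level x vs 𝟐) + length (level x vs 𝟎) ≡ length vs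
level-length x [] = refl
level-length x (v ∷ vs) with x v | level-length x vs
... | 𝟎 | ih = trans (+-suc _ _) (cong suc ih)
... | 𝟏 | ih = cong suc ih
... | 𝟐 | ih = trans (cong (_+ length (level x vs 𝟎)) (+-suc (length (level x vs 𝟏)) _)) (cong suc ih)

length-two : {A : Set} (xs : List A) → length xs ≡ 2 → ∃[ a ] ∃[ b ] (xs ≡ a ∷ b ∷ [])
length-two (a ∷ b ∷ []) refl = a , b , refl

length-three : {A : Set} (xs : List A) → length xs ≡ 3 → ∃[ a ] ∃[ b ] ∃[ c ] (xs ≡ a ∷ b ∷ c ∷ [])
length-three (a ∷ b ∷ c ∷ []) refl = a , b , c , refl

length-four : {A : Set} (xs : List A) → length xs ≡ 4 → ∃[ a ] ∃[ b ] ∃[ c ] ∃[ d ] (xs ≡ a ∷ b ∷ c ∷ d ∷ [])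
length-four (a ∷ b ∷ c ∷ d ∷ []) refl = a , b , c , d , refl

both-of-two : {A : Set} {P : A → Set} {a b p q : A} → p ∈ a ∷ b ∷ [] → q ∈ a ∷ b ∷ [] → p ≢ q → P p → P q → P a × P b
both-of-two (here refl) (here refl) ne _ _ = contradiction refl ne
both-of-two (here refl) (there (here refl)) _ pp pq = pp , pq
both-of-two (there (here refl)) (here refl) _ pp pq = pq , pp
both-of-two (there (here refl)) (there (here refl)) ne _ _ = contradiction refl ne

TwoOf : Set → Set → Set → Set
TwoOf A B C = (A × B) ⊎ (A × C) ⊎ (B × C)

two-of-three : {A : Set} {P : A → Set} {a b c p q : A} → p ∈ a ∷ b ∷ c ∷ [] → q ∈ a ∷ b ∷ c ∷ [] → p ≢ q → P p → P q → TwoOf (P a) (P b) (P c)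
two-of-three (here refl) (here refl) ne _ _ = contradiction refl ne
two-of-three (here refl) (there (here refl)) _ x y = inj₁ (x , y)
two-of-three (here refl) (there (there (here refl))) _ x y = inj₂ (inj₁ (x , y))
two-of-three (there (here refl)) (here refl) _ x y = inj₁ (y , x)
two-of-three (there (here refl)) (there (here refl)) ne _ _ = contradiction refl ne
two-of-three (there (here refl)) (there (there (here refl))) _ x y = inj₂ (inj₂ (x , y))
two-of-three (there (there (here refl))) (here refl) _ x y = inj₂ (inj₁ (y , x))
two-of-three (there (there (here refl))) (there (here refl)) _ x y = inj₂ (inj₂ (y , x))
two-of-three (there (there (here refl))) (there (there (here refl))) ne _ _ = contradiction refl ne

-- A graph on four vertices with minimum degree two contains a 4-cycle.
four-cycle : {E₁₂ E₁₃ E₁₄ E₂₃ E₂₄ E₃₄ : Set} → TwoOf E₁₂ E₁₃ E₁₄ → TwoOf E₁₂ E₂₃ E₂₄ → TwoOf E₁₃ E₂₃ E₃₄ → TwoOf E₁₄ E₂₄ E₃₄ →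
  (E₁₂ × E₂₃ × E₃₄ × E₁₄) ⊎ (E₁₂ × E₂₄ × E₃₄ × E₁₃) ⊎ (E₁₃ × E₂₃ × E₂₄ × E₁₄)
four-cycle (inj₁ (a , b)) _ _ (inj₂ (inj₂ (c , d))) = inj₂ (inj₁ (a , c , d , b))
four-cycle (inj₁ (a , b)) _ (inj₁ (_ , c)) (inj₁ (d , e)) = inj₂ (inj₂ (b , c , e , d))
four-cycle (inj₁ (a , b)) _ (inj₂ (inj₁ (_ , c))) (inj₁ (d , e)) = inj₂ (inj₁ (a , e , c , b))
four-cycle (inj₁ (a , b)) _ (inj₂ (inj₂ (_ , c))) (inj₁ (d , e)) = inj₂ (inj₁ (a , e , c , b))
four-cycle (inj₁ (a , b)) (inj₁ (_ , c)) _ (inj₂ (inj₁ (d , e))) = inj₁ (a , c , e , d)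
four-cycle (inj₁ (a , b)) (inj₂ (inj₁ (_ , c))) _ (inj₂ (inj₁ (d , e))) = inj₂ (inj₁ (a , c , e , b))
four-cycle (inj₁ (a , b)) (inj₂ (inj₂ (c , _))) _ (inj₂ (inj₁ (d , e))) = inj₁ (a , c , e , d)
four-cycle (inj₂ (inj₁ (a , b))) _ (inj₂ (inj₂ (c , d))) _ = inj₁ (a , c , d , b)
four-cycle (inj₂ (inj₁ (a , b))) _ (inj₁ (c , d)) (inj₁ (_ , e)) = inj₂ (inj₂ (c , d , e , b))
four-cycle (inj₂ (inj₁ (a , b))) _ (inj₁ (c , d)) (inj₂ (inj₁ (_ , e))) = inj₁ (a , d , e , b)
four-cycle (inj₂ (inj₁ (a , b))) _ (inj₁ (c , d)) (inj₂ (inj₂ (e , _))) = inj₂ (inj₂ (c , d , e , b))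
four-cycle (inj₂ (inj₁ (a , b))) (inj₁ (_ , e)) (inj₂ (inj₁ (c , d))) _ = inj₁ (a , e , d , b)
four-cycle (inj₂ (inj₁ (a , b))) (inj₂ (inj₁ (_ , e))) (inj₂ (inj₁ (c , d))) _ = inj₂ (inj₁ (a , e , d , c))
four-cycle (inj₂ (inj₁ (a , b))) (inj₂ (inj₂ (_ , e))) (inj₂ (inj₁ (c , d))) _ = inj₂ (inj₁ (a , e , d , c))
four-cycle (inj₂ (inj₂ (a , b))) (inj₂ (inj₂ (c , d))) _ _ = inj₂ (inj₂ (a , c , d , b))
four-cycle (inj₂ (inj₂ (a , b))) (inj₁ (c , d)) _ (inj₁ (_ , e)) = inj₂ (inj₂ (a , d , e , b))
four-cycle (inj₂ (inj₂ (a , b))) (inj₁ (c , d)) _ (inj₂ (inj₁ (_ , e))) = inj₁ (c , d , e , b)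
four-cycle (inj₂ (inj₂ (a , b))) (inj₁ (c , d)) _ (inj₂ (inj₂ (e , _))) = inj₂ (inj₂ (a , d , e , b))
four-cycle (inj₂ (inj₂ (a , b))) (inj₂ (inj₁ (c , d))) (inj₁ (_ , e)) _ = inj₂ (inj₂ (a , e , d , b))
four-cycle (inj₂ (inj₂ (a , b))) (inj₂ (inj₁ (c , d))) (inj₂ (inj₁ (_ , e))) _ = inj₂ (inj₁ (c , d , e , a))
four-cycle (inj₂ (inj₂ (a , b))) (inj₂ (inj₁ (c , d))) (inj₂ (inj₂ (_ , e))) _ = inj₂ (inj₁ (c , d , e , a))

adj-embed : {D : ESet n} (φ : Embedding k n) (i j : Fin k) {i<j : True (i <ᶠ? j)} → Adj D (at φ i) (at φ j) → D (embed φ ((i — j) {i<j})) ≡ true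
adj-embed {D = D} φ i j {i<j} (e , e∈ , jn) = subst (λ f → D f ≡ true) (joins-unique jn (embed-joins φ (joins-self ((i — j) {i<j})))) e∈

2C₄-⊆ : {D : ESet n} {a b c d p q r s : Fin n} → Unique (a ∷ b ∷ c ∷ d ∷ p ∷ q ∷ r ∷ s ∷ []) →
  Adj D a b → Adj D b c → Adj D c d → Adj D a d → Adj D p q → Adj D q r → Adj D r s → Adj D p s → ∃[ φ ] (image φ 2C₄ ⊆ D)
2C₄-⊆ {n} {D} {a} {b} {c} {d} {p} {q} {r} {s} u ab bc cd ad pq qr rs ps = φ , image-⊆ φ {2C₄} {D} edges
  where
  φ : Embedding 8 n
  φ = fromUnique (a ∷ b ∷ c ∷ d ∷ p ∷ q ∷ r ∷ s ∷ []) u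
  edges : ∀ {e} → e ∈ 2C₄ → D (embed φ e) ≡ true
  edges (here refl) = adj-embed {D = D} φ 0F 1F ab
  edges (there (here refl)) = adj-embed {D = D} φ 1F 2F bc
  edges (there (there (here refl))) = adj-embed {D = D} φ 2F 3F cd
  edges (there (there (there (here refl)))) = adj-embed {D = D} φ 0F 3F ad
  edges (there (there (there (there (here refl))))) = adj-embed {D = D} φ 4F 5F pq
  edges (there (there (there (there (there (here refl)))))) = adj-embed {D = D} φ 5F 6F qr
  edges (there (there (there (there (there (there (here refl))))))) = adj-embed {D = D} φ 6F 7F rs
  edges (there (there (there (there (there (there (there (here refl)))))))) = adj-embed {D = D} φ 4F 7F ps

tight : ∀ {a b c} → 2 ≤ a → 2 ≤ b → 4 ≤ c → a + b + c ≤ 8 → a ≡ 2 × b ≡ 2 × c ≡ 4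
tight {a} {b} {c} 2≤a 2≤b 4≤c le =
    ≤-antisym (+-cancelʳ-≤ 6 a 2 (≤-trans (+-monoʳ-≤ a (+-mono-≤ 2≤b 4≤c)) le′)) 2≤a ,
    ≤-antisym (+-cancelˡ-≤ 6 b 2 (≤-trans (≤-reflexive (swap b)) (≤-trans (+-mono-≤ 2≤a (+-monoʳ-≤ b 4≤c)) le′))) 2≤b ,
    ≤-antisym (+-cancelˡ-≤ 4 c 4 (≤-trans (+-monoˡ-≤ c (+-mono-≤ 2≤a 2≤b)) le)) 4≤c
  where
  open ℕₚ using (+-cancelʳ-≤)
  le′ : a + (b + c) ≤ 8
  le′ = ≤-trans (≤-reflexive (sym (+-assoc a b c))) le
  swap : ∀ b → 6 + b ≡ 2 + (b + 4)
  swap b = cong (2 +_) (+-comm 4 b)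

module _ {D D′ : ESet n} {vs : List (Fin n)} (c : Core D D′ vs) where
  open Core c

  -- At least two vertices of each nonzero value and four zeros already make eight, so the level
  -- sizes are exactly 2, 2 and 4. Minimum degree two gives a C₄ across the nonzero levels and a
  -- 4-cycle among the zeros.
  four-zeros⇒2C₄ : length vs ≤ 8 → (x : V n) → Ker x D′ → ∃[ v ] (v ∈ vs × x v ≢ 𝟎) → 4 ≤ length (level x vs 𝟎) → ∃[ φ ] (image φ 2C₄ ⊆ D′)
  four-zeros⇒2C₄ le x kx nz 4≤W =
    let 2≤A , 2≤B = two-and-two c x kx nz
        lenA , lenB , lenW = tight 2≤A 2≤B 4≤W (≤-trans (≤-reflexive (level-length x vs)) le)
        a₁ , a₂ , eqA = length-two (level x vs 𝟏) lenA
        b₁ , b₂ , eqB = length-two (level x vs 𝟐) lenB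
        w₁ , w₂ , w₃ , w₄ , eqW = length-four (level x vs 𝟎) lenW
    in build a₁ a₂ b₁ b₂ w₁ w₂ w₃ w₄ (subst Unique eqA (level-unique x 𝟏 unique)) (subst Unique eqB (level-unique x 𝟐 unique))
         (subst Unique eqW (level-unique x 𝟎 unique)) eqA eqB eqW
    where
    build : ∀ a₁ a₂ b₁ b₂ w₁ w₂ w₃ w₄ → Unique (a₁ ∷ a₂ ∷ []) → Unique (b₁ ∷ b₂ ∷ []) → Unique (w₁ ∷ w₂ ∷ w₃ ∷ w₄ ∷ []) →
      level x vs 𝟏 ≡ a₁ ∷ a₂ ∷ [] → level x vs 𝟐 ≡ b₁ ∷ b₂ ∷ [] → level x vs 𝟎 ≡ w₁ ∷ w₂ ∷ w₃ ∷ w₄ ∷ [] → ∃[ φ ] (image φ 2C₄ ⊆ D′)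
    build a₁ a₂ b₁ b₂ w₁ w₂ w₃ w₄ ((a₁≢a₂ ∷ []) ∷ _) ((b₁≢b₂ ∷ []) ∷ _) ((w₁₂ ∷ w₁₃ ∷ w₁₄ ∷ []) ∷ (w₂₃ ∷ w₂₄ ∷ []) ∷ (w₃₄ ∷ []) ∷ _) eqA eqB eqW =
        finish (four-cycle (twoW (here refl) (λ ne → λ { (here refl) → contradiction refl ne ; (there p) → p }))
          (swap₂ (twoW (there (here refl)) (λ ne → λ { (here p) → here p ; (there (here refl)) → contradiction refl ne ; (there (there p)) → there p })))
          (swap₃ (twoW (there (there (here refl))) (λ ne → λ { (here p) → here p ; (there (here p)) → there (here p) ; (there (there (here refl))) → contradiction refl ne ; (there (there (there p))) → there (there p) })))
          (swap₄ (twoW (there (there (there (here refl)))) (λ ne → λ { (here p) → here p ; (there (here p)) → there (here p) ; (there (there (here p))) → there (there (here p)) ; (there (there (there (here refl)))) → contradiction refl ne }))))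
      where
      Ws = w₁ ∷ w₂ ∷ w₃ ∷ w₄ ∷ []
      memA : ∀ {v} → v ∈ a₁ ∷ a₂ ∷ [] → v ∈ vs × x v ≡ 𝟏
      memA p = level-∈ x vs (subst (_ ∈_) (sym eqA) p)
      memB : ∀ {v} → v ∈ b₁ ∷ b₂ ∷ [] → v ∈ vs × x v ≡ 𝟐
      memB p = level-∈ x vs (subst (_ ∈_) (sym eqB) p)
      memW : ∀ {v} → v ∈ Ws → v ∈ vs × x v ≡ 𝟎
      memW p = level-∈ x vs (subst (_ ∈_) (sym eqW) p)
      adjA : ∀ {v} → v ∈ a₁ ∷ a₂ ∷ [] → Adj D′ v b₁ × Adj D′ v b₂
      adjA v∈ = let p , q , ne , (ap , p∈) , (aq , q∈) = neighbours c x kx (proj₁ (memA v∈)) (proj₂ (memA v∈)) in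
        both-of-two {P = Adj D′ _} (subst (p ∈_) eqB p∈) (subst (q ∈_) eqB q∈) ne ap aq
      twoW : ∀ {v r s t} → v ∈ Ws → (∀ {p} → v ≢ p → p ∈ Ws → p ∈ r ∷ s ∷ t ∷ []) → TwoOf (Adj D′ v r) (Adj D′ v s) (Adj D′ v t)
      twoW v∈ others = let p , q , ne , (ap , p∈) , (aq , q∈) = neighbours c x kx (proj₁ (memW v∈)) (proj₂ (memW v∈)) in
        two-of-three {P = Adj D′ _} (others (adj-≢ ap) (subst (p ∈_) eqW p∈)) (others (adj-≢ aq) (subst (q ∈_) eqW q∈)) ne ap aq
      map-TwoOf : ∀ {A B C A′ B′ C′ : Set} → (A → A′) → (B → B′) → (C → C′) → TwoOf A B C → TwoOf A′ B′ C′
      map-TwoOf f g h (inj₁ (p , q)) = inj₁ (f p , g q)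
      map-TwoOf f g h (inj₂ (inj₁ (p , q))) = inj₂ (inj₁ (f p , h q))
      map-TwoOf f g h (inj₂ (inj₂ (p , q))) = inj₂ (inj₂ (g p , h q))
      swap₂ : TwoOf (Adj D′ w₂ w₁) (Adj D′ w₂ w₃) (Adj D′ w₂ w₄) → TwoOf (Adj D′ w₁ w₂) (Adj D′ w₂ w₃) (Adj D′ w₂ w₄)
      swap₂ = map-TwoOf (adj-sym {D = D′}) id id
      swap₃ : TwoOf (Adj D′ w₃ w₁) (Adj D′ w₃ w₂) (Adj D′ w₃ w₄) → TwoOf (Adj D′ w₁ w₃) (Adj D′ w₂ w₃) (Adj D′ w₃ w₄)
      swap₃ = map-TwoOf (adj-sym {D = D′}) (adj-sym {D = D′}) id
      swap₄ : TwoOf (Adj D′ w₄ w₁) (Adj D′ w₄ w₂) (Adj D′ w₄ w₃) → TwoOf (Adj D′ w₁ w₄) (Adj D′ w₂ w₄) (Adj D′ w₃ w₄)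
      swap₄ = map-TwoOf (adj-sym {D = D′}) (adj-sym {D = D′}) (adj-sym {D = D′})
      a₁∈ = here refl
      a₂∈ = there (here refl)
      b₁∈ = here refl
      b₂∈ = there (here refl)
      ab : ∀ {a b} → a ∈ a₁ ∷ a₂ ∷ [] → b ∈ b₁ ∷ b₂ ∷ [] → a ≢ b
      ab p q = apart {x = x} (proj₂ (memA p)) (proj₂ (memB q)) λ ()
      aw : ∀ {a w} → a ∈ a₁ ∷ a₂ ∷ [] → w ∈ Ws → a ≢ w
      aw p q = apart {x = x} (proj₂ (memA p)) (proj₂ (memW q)) λ ()
      bw : ∀ {b w} → b ∈ b₁ ∷ b₂ ∷ [] → w ∈ Ws → b ≢ w
      bw p q = apart {x = x} (proj₂ (memB p)) (proj₂ (memW q)) λ ()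
      cycle : ∀ {p q r s} → p ∈ Ws → q ∈ Ws → r ∈ Ws → s ∈ Ws → Unique (p ∷ q ∷ r ∷ s ∷ []) →
        Adj D′ p q → Adj D′ q r → Adj D′ r s → Adj D′ p s → ∃[ φ ] (image φ 2C₄ ⊆ D′)
      cycle p∈ q∈ r∈ s∈ u pq qr rs ps = 2C₄-⊆ {D = D′}
        ((ab a₁∈ b₁∈ ∷ a₁≢a₂ ∷ ab a₁∈ b₂∈ ∷ aw a₁∈ p∈ ∷ aw a₁∈ q∈ ∷ aw a₁∈ r∈ ∷ aw a₁∈ s∈ ∷ []) ∷
         ((ab a₂∈ b₁∈ ∘ sym) ∷ b₁≢b₂ ∷ bw b₁∈ p∈ ∷ bw b₁∈ q∈ ∷ bw b₁∈ r∈ ∷ bw b₁∈ s∈ ∷ []) ∷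
         (ab a₂∈ b₂∈ ∷ aw a₂∈ p∈ ∷ aw a₂∈ q∈ ∷ aw a₂∈ r∈ ∷ aw a₂∈ s∈ ∷ []) ∷
         (bw b₂∈ p∈ ∷ bw b₂∈ q∈ ∷ bw b₂∈ r∈ ∷ bw b₂∈ s∈ ∷ []) ∷ u)
        (proj₁ (adjA a₁∈)) (adj-sym {D = D′} (proj₁ (adjA a₂∈))) (proj₂ (adjA a₂∈)) (proj₂ (adjA a₁∈)) pq qr rs ps
      m₁ : w₁ ∈ Ws
      m₁ = here refl
      m₂ : w₂ ∈ Ws
      m₂ = there (here refl)
      m₃ : w₃ ∈ Ws
      m₃ = there (there (here refl))
      m₄ : w₄ ∈ Ws
      m₄ = there (there (there (here refl)))
      E = Adj D′
      finish : (E w₁ w₂ × E w₂ w₃ × E w₃ w₄ × E w₁ w₄) ⊎ (E w₁ w₂ × E w₂ w₄ × E w₃ w₄ × E w₁ w₃) ⊎ (E w₁ w₃ × E w₂ w₃ × E w₂ w₄ × E w₁ w₄) →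
        ∃[ φ ] (image φ 2C₄ ⊆ D′)
      finish (inj₁ (p , q , r , s)) = cycle m₁ m₂ m₃ m₄ ((w₁₂ ∷ w₁₃ ∷ w₁₄ ∷ []) ∷ (w₂₃ ∷ w₂₄ ∷ []) ∷ (w₃₄ ∷ []) ∷ [] ∷ []) p q r s
      finish (inj₂ (inj₁ (p , q , r , s))) = cycle m₁ m₂ m₄ m₃ ((w₁₂ ∷ w₁₄ ∷ w₁₃ ∷ []) ∷ (w₂₄ ∷ w₂₃ ∷ []) ∷ ((w₃₄ ∘ sym) ∷ []) ∷ [] ∷ []) p q (adj-sym {D = D′} r) s
      finish (inj₂ (inj₂ (p , q , r , s))) = cycle m₁ m₃ m₂ m₄ ((w₁₃ ∷ w₁₂ ∷ w₁₄ ∷ []) ∷ ((w₂₃ ∘ sym) ∷ w₃₄ ∷ []) ∷ (w₂₄ ∷ []) ∷ [] ∷ []) p (adj-sym {D = D′} q) r s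

  -- A kernel vector vanishing at a vertex has at least three zeros.  If there are exactly three,
  -- they form a triangle, on which every kernel vector vanishes; so a kernel vector that also
  -- vanishes at a further vertex has four zeros.
  large-kernel⇒2C₄ : length vs ≤ 8 → (∀ Z → length Z ≤ 1 → ∃[ x ] (Ker x D′ × (∀ {z} → z ∈ Z → x z ≡ 𝟎) × ∃[ v ] (v ∈ vs × x v ≡ 𝟏))) →
    ∃[ φ ] (image φ 2C₄ ⊆ D′)
  large-kernel⇒2C₄ le kernel =
    -- This first vector only supplies a vertex `v` at which the next one is made to vanish.
    let _ , _ , _ , v , v∈ , _ = kernel [] z≤n
        x , kx , zero-at , u , u∈ , xu = kernel (v ∷ []) (s≤s z≤n)
    in first x kx v v∈ (zero-at (here refl)) u u∈ xu (4 ≤? length (level x vs 𝟎))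
    where
    one⇒nonzero : ∀ {x : V n} {v} → x v ≡ 𝟏 → x v ≢ 𝟎
    one⇒nonzero p q = 𝟏≢𝟎 (trans (sym p) q)
    triangle : ∀ a b c → a ⊕ b ≡ 𝟎 → a ⊕ c ≡ 𝟎 → b ⊕ c ≡ 𝟎 → a ≡ 𝟎 × b ≡ 𝟎 × c ≡ 𝟎
    triangle = toWitness {a? = all₃? λ a → all₃? λ b → all₃? λ c → (a ⊕ b ≟₃ 𝟎) →-dec ((a ⊕ c ≟₃ 𝟎) →-dec ((b ⊕ c ≟₃ 𝟎) →-dec
      ((a ≟₃ 𝟎) ×-dec (b ≟₃ 𝟎) ×-dec (c ≟₃ 𝟎))))} _
    second : ∀ x → Ker x D′ → ∀ u → u ∈ vs → x u ≡ 𝟏 → ∀ w₁ w₂ w₃ → level x vs 𝟎 ≡ w₁ ∷ w₂ ∷ w₃ ∷ [] → ∃[ φ ] (image φ 2C₄ ⊆ D′)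
    second x kx u u∈ xu w₁ w₂ w₃ eqW =
      let y , ky , zero-at , v , v∈ , yv = kernel (u ∷ []) (s≤s z≤n)
          a₁₂ , a₁₃ = adjacent (here refl) (λ ne → λ { (here refl) → contradiction refl ne ; (there p) → p })
          _ , a₂₃ = adjacent {r = w₁} {w₃} (there (here refl)) (λ ne → λ { (here p) → here p ; (there (here refl)) → contradiction refl ne ; (there (there p)) → there p })
          y₁ , y₂ , y₃ = triangle (y w₁) (y w₂) (y w₃) (killed y ky a₁₂) (killed y ky a₁₃) (killed y ky a₂₃)
      in four-zeros⇒2C₄ le y ky (v , v∈ , one⇒nonzero {y} yv)
           (unique-length-≤ {xs = u ∷ w₁ ∷ w₂ ∷ w₃ ∷ []} ((u≢w (here refl) ∷ u≢w (there (here refl)) ∷ u≢w (there (there (here refl))) ∷ []) ∷ uW)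
             (λ { (here refl) → ∈-level y u∈ (zero-at (here refl))
                ; (there (here refl)) → ∈-level y (proj₁ (memW (here refl))) y₁
                ; (there (there (here refl))) → ∈-level y (proj₁ (memW (there (here refl)))) y₂
                ; (there (there (there (here refl)))) → ∈-level y (proj₁ (memW (there (there (here refl))))) y₃ }))
      where
      Ws = w₁ ∷ w₂ ∷ w₃ ∷ []
      uW : Unique Ws
      uW = subst Unique eqW (level-unique x 𝟎 unique)
      memW : ∀ {v} → v ∈ Ws → v ∈ vs × x v ≡ 𝟎
      memW p = level-∈ x vs (subst (_ ∈_) (sym eqW) p)
      u≢w : ∀ {w} → w ∈ Ws → u ≢ w
      u≢w p refl = one⇒nonzero {x} xu (proj₂ (memW p))
      adjacent : ∀ {v r s} → v ∈ Ws → (∀ {p} → v ≢ p → p ∈ Ws → p ∈ r ∷ s ∷ []) → Adj D′ v r × Adj D′ v s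
      adjacent v∈ others = let p , q , ne , (ap , p∈) , (aq , q∈) = neighbours c x kx (proj₁ (memW v∈)) (proj₂ (memW v∈)) in
        both-of-two {P = Adj D′ _} (others (adj-≢ ap) (subst (p ∈_) eqW p∈)) (others (adj-≢ aq) (subst (q ∈_) eqW q∈)) ne ap aq
      killed : ∀ y → Ker y D′ → ∀ {u v} → Adj D′ u v → y u ⊕ y v ≡ 𝟎
      killed y ky (e , e∈ , jn) = trans (sym (∙-joins y jn)) (ky e e∈)
    first : ∀ x → Ker x D′ → ∀ v → v ∈ vs → x v ≡ 𝟎 → ∀ u → u ∈ vs → x u ≡ 𝟏 → Dec (4 ≤ length (level x vs 𝟎)) → ∃[ φ ] (image φ 2C₄ ⊆ D′)
    first x kx v v∈ xv u u∈ xu (yes 4≤) = four-zeros⇒2C₄ le x kx (u , u∈ , one⇒nonzero {x} xu) 4≤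
    first x kx v v∈ xv u u∈ xu (no 4≰) =
      let w₁ , w₂ , w₃ , eqW = length-three (level x vs 𝟎) (≤-antisym (≤-pred (≰⇒> 4≰)) (three-zeros c x kx v∈ xv))
      in second x kx u u∈ xu w₁ w₂ w₃ eqW

-- One edge more than `rank-complete` allows on `vs`, or one more than `rank-flat` allows on the
-- hyperplane of `x`.
Overfull : ESet n → List (Fin n) → Set
Overfull D vs = 2 + length vs ≤ size D ⊎ (1 + length vs ≤ size D × ∃[ x ] (Ker x D × ∃[ v ] (v ∈ vs × x v ≢ 𝟎)))

Is2C₄ : ESet n → Set
Is2C₄ D = ∃[ φ ] (D ≐ image φ 2C₄)

-- For a core of nullity at least two, compare edges with vertices. If edges do not outnumber
-- vertices, kernel vectors can also be made to vanish at a prescribed vertex, and a C₄ ∪ C₄ uses up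
-- all eight edges. An excess of one still leaves a nonzero kernel vector, and a larger excess is
-- too many edges for any graph on these vertices.
classify : (D : ESet n) → size D ≤ 8 → 𝓔 D ⊎ Is2C₄ D ⊎ (∃[ D′ ] ∃[ vs ] (Core D D′ vs × Overfull D′ vs))
classify {n} D le = let D′ , vs , c = core D in by-kernel D′ vs c (𝓔-or-kernel D′)
  where
  Result : Set
  Result = 𝓔 D ⊎ Is2C₄ D ⊎ (∃[ D′ ] ∃[ vs ] (Core D D′ vs × Overfull D′ vs))
  by-size : ∀ D′ vs → Core D D′ vs → KernelVectors D′ → Dec (size D′ ≤ length vs) → Dec (2 + length vs ≤ size D′) → Result
  by-size D′ vs c kernels (yes small) _ =
    let open Core c
        φ , sub = large-kernel⇒2C₄ c (≤-trans (handshake c) (≤-trans (size-mono {S = D′} {D} core-⊆) le))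
                    (λ Z len → kernels vs Z unique (+-mono-≤ len small))
        sub′ = ⊆-trans {S = image φ 2C₄} {D′} {D} sub core-⊆
    in inj₂ (inj₁ (φ , ⊆-full {S = image φ 2C₄} {D} sub′ (≤-trans le (≤-reflexive (sym (size-image φ 2C₄-unique)))) , sub′))
  by-size D′ vs c kernels (no _) (yes large) = inj₂ (inj₂ (D′ , vs , c , inj₁ large))
  by-size D′ vs c kernels (no ¬small) (no ¬large) =
    let x , kx , _ , v , v∈ , xv = kernels vs [] (Core.unique c) (≤-pred (≰⇒> ¬large))
    in inj₂ (inj₂ (D′ , vs , c , inj₂ (≰⇒> ¬small , x , kx , v , v∈ , (λ xv≡0 → 𝟏≢𝟎 (trans (sym xv) xv≡0)))))
  by-kernel : ∀ D′ vs → Core D D′ vs → 𝓔 D′ ⊎ KernelVectors D′ → Result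
  by-kernel D′ vs c (inj₁ m) = inj₁ (Core.lift c m)
  by-kernel D′ vs c (inj₂ kernels) = by-size D′ vs c kernels (size D′ ≤? length vs) (2 + length vs ≤? size D′)

-- Edge sets with at most six edges

K₂₃-pattern : 𝔽₃ → 𝔽₃ → V 5
K₂₃-pattern a b 0F = a
K₂₃-pattern a b 1F = a
K₂₃-pattern a b _  = b

opaque
  -- Both sign choices occur, because the side of size two may carry the value 1 or the value 2.
  K₂₃-flat : ∀ e → K₂₃-pattern 𝟏 𝟐 ∙ e ≡ 𝟎 ⊎ K₂₃-pattern 𝟐 𝟏 ∙ e ≡ 𝟎 → e ∈ K₂₃
  K₂₃-flat = checkEdges (λ e → ((K₂₃-pattern 𝟏 𝟐 ∙ e ≟₃ 𝟎) ⊎-dec (K₂₃-pattern 𝟐 𝟏 ∙ e ≟₃ 𝟎)) →-dec (e ∈ᵉ? K₂₃)) _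

module _ {D D′ : ESet n} {vs : List (Fin n)} (c : Core D D′ vs) (size-D : size D ≤ 6) where
  open Core c

  size-D′ : size D′ ≤ 6
  size-D′ = ≤-trans (size-mono {S = D′} {D} core-⊆) size-D

  fills : (φ : Embedding k n) {L : List (Edge k)} → Unique L → length L ≡ 6 → D′ ⊆ image φ L → 6 ≤ size D′ → D ≐ image φ L
  fills φ {L} uL len sub 6≤ =
      ⊆-trans {S = D} {D′} {image φ L} (⊆-full {S = D′} {D} core-⊆ (≤-trans size-D 6≤)) sub ,
      ⊆-trans {S = image φ L} {D′} {D} (⊆-full {S = D′} {image φ L} sub (≤-trans (≤-reflexive (trans (size-image φ uL) len)) 6≤)) core-⊆

  in-image : {us : List (Fin n)} (uu : Unique us) → (∀ {v} → v ∈ vs → v ∈ us) → (L : List (Edge (length us))) →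
    (∀ e′ → D′ (embed (fromUnique us uu) e′) ≡ true → e′ ∈ L) → D′ ⊆ image (fromUnique us uu) L
  in-image {us} uu vs⊆ L h e e∈ =
    let p , q = within e e∈
        e′ , eq = within-embed uu {e} (vs⊆ p , vs⊆ q)
    in subst (λ f → image (fromUnique us uu) L f ≡ true) (sym eq) (∈-image (fromUnique us uu) (h e′ (subst (λ f → D′ f ≡ true) eq e∈)))

  -- Six edges allow at most four vertices; three or fewer vertices have too few edges, and on four
  -- vertices all six must be present.
  dense⇒InX : 2 + length vs ≤ size D′ → InX D
  dense⇒InX large = go vs unique id large (length vs ≤? 3)
    where
    bound : ∀ {us} (uu : Unique us) → (∀ {v} → v ∈ vs → v ∈ us) → size D′ ≤ length (allEdges (length us))
    bound {us} uu vs⊆ = ≤-trans (size-mono {S = D′} {image (fromUnique us uu) (allEdges (length us))} (in-image uu vs⊆ (allEdges (length us)) (λ e′ _ → ∈-allEdges e′)))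
      (size-image-≤ (fromUnique us uu) (allEdges (length us)))
    go : ∀ us → Unique us → (∀ {v} → v ∈ vs → v ∈ us) → 2 + length us ≤ size D′ → Dec (length us ≤ 3) → InX D
    go us uu sub le (yes small) = contradiction (≤-trans (n≤1+n _) (≤-trans le (≤-trans (bound uu sub) (allEdges-length-≤ (length us) small)))) (<-irrefl refl)
    go [] uu sub le (no many) = contradiction z≤n many
    go (_ ∷ []) uu sub le (no many) = contradiction (s≤s z≤n) many
    go (_ ∷ _ ∷ []) uu sub le (no many) = contradiction (s≤s (s≤s z≤n)) many
    go (_ ∷ _ ∷ _ ∷ []) uu sub le (no many) = contradiction ≤-refl many
    go us@(_ ∷ _ ∷ _ ∷ _ ∷ []) uu sub le (no _) = inj₁ (K4Copies.image⇒copy (fromUnique us uu) {D}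
      (fills (fromUnique us uu) K₄-unique refl (in-image uu sub K₄ (λ e′ _ → ∈-K₄ e′)) le))
    go (_ ∷ _ ∷ _ ∷ _ ∷ _ ∷ us) uu sub le (no _) = contradiction (≤-trans le size-D′) λ { (s≤s (s≤s (s≤s (s≤s (s≤s (s≤s ())))))) }

  -- At most five vertices, with at least two of each nonzero value; a zero would bring three zeros
  -- and make seven. Of the remaining shapes, K₂₂ has four edges where five are required, and K₂₃
  -- must be filled completely.
  bipartite⇒InX : 1 + length vs ≤ size D′ → (x : V n) → Ker x D′ → ∃[ v ] (v ∈ vs × x v ≢ 𝟎) → InX D
  bipartite⇒InX large x kx nz =
    let 2≤A , 2≤B = two-and-two c x kx nz in
    go (level x vs 𝟏) (level x vs 𝟐) (level x vs 𝟎) (level-unique x 𝟏 unique) (level-unique x 𝟐 unique)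
      (level-∈ x vs) (level-∈ x vs) 2≤A 2≤B (λ {v} p → let v∈ , xv = level-∈ x vs {v = v} p in three-zeros c x kx v∈ xv) cover (level-length x vs)
    where
    cover : ∀ {v} → v ∈ vs → v ∈ level x vs 𝟏 ⊎ v ∈ level x vs 𝟐 ⊎ v ∈ level x vs 𝟎
    cover {v} v∈ with x v in eq
    ... | 𝟎 = inj₂ (inj₂ (∈-level x v∈ eq))
    ... | 𝟏 = inj₁ (∈-level x v∈ eq)
    ... | 𝟐 = inj₂ (inj₁ (∈-level x v∈ eq))
    vs≤5 : length vs ≤ 5
    vs≤5 = ≤-pred (≤-trans large size-D′)
    killed : ∀ {us} (uu : Unique us) (y : V (length us)) → (∀ i → x (lookup us i) ≡ y i) → ∀ e → D′ (embed (fromUnique us uu) e) ≡ true → y ∙ e ≡ 𝟎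
    killed uu y values e e∈ = trans (sym (∙-cong values e)) (trans (sym (∙-embed x (fromUnique _ uu) e)) (kx _ e∈))
    module _ {a b : 𝔽₃} (a≢b : a ≢ b) {p₁ p₂ : Fin n} (p₁≢p₂ : p₁ ≢ p₂) (xp₁ : x p₁ ≡ a) (xp₂ : x p₂ ≡ a) where
      K₂₂-case : (∀ e → K₂₃-pattern a b ∙ e ≡ 𝟎 → e ∈ K₂₃) → ∀ {q₁ q₂} → Unique (q₁ ∷ q₂ ∷ []) → x q₁ ≡ b → x q₂ ≡ b →
        length vs ≡ 4 → (∀ {v} → v ∈ vs → v ∈ p₁ ∷ p₂ ∷ q₁ ∷ q₂ ∷ []) → InX D
      K₂₂-case flat {q₁} {q₂} ((q₁₂ ∷ []) ∷ _) xq₁ xq₂ len sub = contradiction (≤-trans (subst (λ m → suc m ≤ size D′) len large) bound) λ { (s≤s (s≤s (s≤s (s≤s ())))) }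
        where
        uu : Unique (p₁ ∷ p₂ ∷ q₁ ∷ q₂ ∷ [])
        uu = (p₁≢p₂ ∷ apart {x = x} xp₁ xq₁ a≢b ∷ apart {x = x} xp₁ xq₂ a≢b ∷ []) ∷ (apart {x = x} xp₂ xq₁ a≢b ∷ apart {x = x} xp₂ xq₂ a≢b ∷ []) ∷ (q₁₂ ∷ []) ∷ [] ∷ []
        y : V 4
        y 0F = a
        y 1F = a
        y 2F = b
        y 3F = b
        values : ∀ i → x (lookup (p₁ ∷ p₂ ∷ q₁ ∷ q₂ ∷ []) i) ≡ y i
        values 0F = xp₁
        values 1F = xp₂
        values 2F = xq₁
        values 3F = xq₂
        L : List (Edge 4)
        L = (0F — 2F) ∷ (0F — 3F) ∷ (1F — 2F) ∷ (1F — 3F) ∷ []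
        -- The four-vertex pattern is the five-vertex one without its last vertex, so `flat` also
        -- rules out the two edges inside a side.
        absurd : ∀ (i j : Fin 5) {i<j} → K₂₃-pattern a b ∙ ((i — j) {i<j}) ≡ 𝟎 → ¬ ((i — j) {i<j} ∈ K₂₃) → ⊥
        absurd i j eq ∉ = ∉ (flat (i — j) eq)
        in-L : ∀ e → y ∙ e ≡ 𝟎 → e ∈ L
        in-L e with ∈-K₄ e
        ... | here refl = λ eq → ⊥-elim (absurd 0F 1F eq (toWitness {a? = ¬? ((0F — 1F) ∈ᵉ? K₂₃)} _))
        ... | there (here refl) = λ _ → here refl
        ... | there (there (here refl)) = λ _ → there (here refl)
        ... | there (there (there (here refl))) = λ _ → there (there (here refl))
        ... | there (there (there (there (here refl)))) = λ _ → there (there (there (here refl)))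
        ... | there (there (there (there (there (here refl))))) = λ eq → ⊥-elim (absurd 2F 3F eq (toWitness {a? = ¬? ((2F — 3F) ∈ᵉ? K₂₃)} _))
        bound : size D′ ≤ 4
        bound = ≤-trans (size-mono {S = D′} {image (fromUnique _ uu) L} (in-image uu sub L (λ e e∈ → in-L e (killed uu y values e e∈)))) (size-image-≤ (fromUnique _ uu) L)
      K₂₃-case : (∀ e → K₂₃-pattern a b ∙ e ≡ 𝟎 → e ∈ K₂₃) → ∀ {q₁ q₂ q₃} → Unique (q₁ ∷ q₂ ∷ q₃ ∷ []) → x q₁ ≡ b → x q₂ ≡ b → x q₃ ≡ b →
        length vs ≡ 5 → (∀ {v} → v ∈ vs → v ∈ p₁ ∷ p₂ ∷ q₁ ∷ q₂ ∷ q₃ ∷ []) → InX D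
      K₂₃-case flat {q₁} {q₂} {q₃} uq xq₁ xq₂ xq₃ len sub = inj₂ (K23Copies.image⇒copy (fromUnique _ uu) {D}
          (fills (fromUnique _ uu) K₂₃-unique refl (in-image uu sub K₂₃ (λ e e∈ → flat e (killed uu (K₂₃-pattern a b) values e e∈))) (subst (λ m → suc m ≤ size D′) len large)))
        where
        uu : Unique (p₁ ∷ p₂ ∷ q₁ ∷ q₂ ∷ q₃ ∷ [])
        uu = (p₁≢p₂ ∷ apart {x = x} xp₁ xq₁ a≢b ∷ apart {x = x} xp₁ xq₂ a≢b ∷ apart {x = x} xp₁ xq₃ a≢b ∷ []) ∷ (apart {x = x} xp₂ xq₁ a≢b ∷ apart {x = x} xp₂ xq₂ a≢b ∷ apart {x = x} xp₂ xq₃ a≢b ∷ []) ∷ uq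
        values : ∀ i → x (lookup (p₁ ∷ p₂ ∷ q₁ ∷ q₂ ∷ q₃ ∷ []) i) ≡ K₂₃-pattern a b i
        values 0F = xp₁
        values 1F = xp₂
        values 2F = xq₁
        values 3F = xq₂
        values 4F = xq₃
    too-many : ∀ a b c {r s t} → r ≤ a → s ≤ b → t ≤ c → a + b + c ≡ length vs → ¬ (r + s + t ≤ 5) → InX D
    too-many a b c p q r eq ¬le = contradiction (≤-trans (+-mono-≤ (+-mono-≤ p q) r) (≤-trans (≤-reflexive eq) vs≤5)) ¬le
    go : ∀ As Bs Ws → Unique As → Unique Bs → (∀ {v} → v ∈ As → v ∈ vs × x v ≡ 𝟏) → (∀ {v} → v ∈ Bs → v ∈ vs × x v ≡ 𝟐) →
      2 ≤ length As → 2 ≤ length Bs → (∀ {v} → v ∈ Ws → 3 ≤ length Ws) → (∀ {v} → v ∈ vs → v ∈ As ⊎ v ∈ Bs ⊎ v ∈ Ws) →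
      length As + length Bs + length Ws ≡ length vs → InX D
    go As Bs (w ∷ Ws) _ _ _ _ 2≤A 2≤B 3≤W _ eq = too-many (length As) (length Bs) (suc (length Ws)) 2≤A 2≤B (3≤W (here refl)) eq λ { (s≤s (s≤s (s≤s (s≤s (s≤s ()))))) }
    go (a₁ ∷ a₂ ∷ []) (b₁ ∷ b₂ ∷ []) [] ((a₁₂ ∷ _) ∷ _) uB A⁻ B⁻ _ _ _ cover eq =
      K₂₂-case (λ ()) a₁₂ (proj₂ (A⁻ (here refl))) (proj₂ (A⁻ (there (here refl)))) (λ e p → K₂₃-flat e (inj₁ p)) uB
        (proj₂ (B⁻ (here refl))) (proj₂ (B⁻ (there (here refl)))) (sym eq) sub
      where
      sub : ∀ {v} → v ∈ vs → v ∈ a₁ ∷ a₂ ∷ b₁ ∷ b₂ ∷ []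
      sub v∈ with cover v∈
      ... | inj₁ p = ∈-++⁺ˡ p
      ... | inj₂ (inj₁ p) = there (there p)
    go (a₁ ∷ a₂ ∷ []) (b₁ ∷ b₂ ∷ b₃ ∷ []) [] ((a₁₂ ∷ _) ∷ _) uB A⁻ B⁻ _ _ _ cover eq =
      K₂₃-case (λ ()) a₁₂ (proj₂ (A⁻ (here refl))) (proj₂ (A⁻ (there (here refl)))) (λ e p → K₂₃-flat e (inj₁ p)) uB
        (proj₂ (B⁻ (here refl))) (proj₂ (B⁻ (there (here refl)))) (proj₂ (B⁻ (there (there (here refl))))) (sym eq) sub
      where
      sub : ∀ {v} → v ∈ vs → v ∈ a₁ ∷ a₂ ∷ b₁ ∷ b₂ ∷ b₃ ∷ []
      sub v∈ with cover v∈
      ... | inj₁ p = ∈-++⁺ˡ p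
      ... | inj₂ (inj₁ p) = there (there p)
    go (a₁ ∷ a₂ ∷ a₃ ∷ []) (b₁ ∷ b₂ ∷ []) [] uA ((b₁₂ ∷ _) ∷ _) A⁻ B⁻ _ _ _ cover eq =
      K₂₃-case (λ ()) b₁₂ (proj₂ (B⁻ (here refl))) (proj₂ (B⁻ (there (here refl)))) (λ e p → K₂₃-flat e (inj₂ p)) uA
        (proj₂ (A⁻ (here refl))) (proj₂ (A⁻ (there (here refl)))) (proj₂ (A⁻ (there (there (here refl))))) (sym eq) sub
      where
      sub : ∀ {v} → v ∈ vs → v ∈ b₁ ∷ b₂ ∷ a₁ ∷ a₂ ∷ a₃ ∷ []
      sub v∈ with cover v∈
      ... | inj₁ p = there (there p)
      ... | inj₂ (inj₁ p) = ∈-++⁺ˡ p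
    go (_ ∷ _ ∷ _ ∷ As) (_ ∷ _ ∷ _ ∷ Bs) [] _ _ _ _ _ _ _ _ eq = too-many (3 + length As) (3 + length Bs) 0 {3} {3} {0} (s≤s (s≤s (s≤s z≤n))) (s≤s (s≤s (s≤s z≤n))) z≤n eq λ { (s≤s (s≤s (s≤s (s≤s (s≤s ()))))) }
    go (_ ∷ _ ∷ _ ∷ _ ∷ As) Bs [] _ _ _ _ _ 2≤B _ _ eq = too-many (4 + length As) (length Bs) 0 {4} {2} {0} (s≤s (s≤s (s≤s (s≤s z≤n)))) 2≤B z≤n eq λ { (s≤s (s≤s (s≤s (s≤s (s≤s ()))))) }
    go As (_ ∷ _ ∷ _ ∷ _ ∷ Bs) [] _ _ _ _ 2≤A _ _ _ eq = too-many (length As) (4 + length Bs) 0 {2} {4} {0} 2≤A (s≤s (s≤s (s≤s (s≤s z≤n)))) z≤n eq λ { (s≤s (s≤s (s≤s (s≤s (s≤s ()))))) }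
    go [] _ [] _ _ _ _ () _ _ _ _
    go (_ ∷ []) _ [] _ _ _ _ (s≤s ()) _ _ _ _
    go _ [] [] _ _ _ _ _ () _ _ _
    go _ (_ ∷ []) [] _ _ _ _ _ (s≤s ()) _ _ _

-- Truncations of the elongation, with U among them

T : ℕ → IndPred n
T r S = 𝓔 S × size S ≤ r

-- With at most six edges C₄ ∪ C₄ does not fit, and an overfull core makes the whole set a K₄ or a
-- K₂₃.
U⪯T₆ : ∀ S → U n S → T 6 S
U⪯T₆ S (le , ¬X) = from (classify S (≤-trans le (s≤s (s≤s (s≤s (s≤s (s≤s (s≤s z≤n)))))))) , le
  where
  from : 𝓔 S ⊎ Is2C₄ S ⊎ (∃[ D′ ] ∃[ vs ] (Core S D′ vs × Overfull D′ vs)) → 𝓔 S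
  from (inj₁ m) = m
  from (inj₂ (inj₁ (φ , eq))) = contradiction (≤-trans (≤-reflexive (sym (trans (size-≐ {S = S} {image φ 2C₄} eq) (size-image φ 2C₄-unique)))) le)
    λ { (s≤s (s≤s (s≤s (s≤s (s≤s (s≤s ())))))) }
  from (inj₂ (inj₂ (D′ , vs , c , inj₁ large))) = contradiction (dense⇒InX c le large) ¬X
  from (inj₂ (inj₂ (D′ , vs , c , inj₂ (large , x , kx , nz)))) = contradiction (bipartite⇒InX c le large x kx nz) ¬X

T₆⪯U : ∀ S → T 6 S → U n S
T₆⪯U S (m , le) = le , (λ inX → InX⇒¬𝓔 {F = S} inX m)

T-matroid : ∀ r → IsMatroid (T {n} r)
T-matroid {n} r = record
  { ind-∅ = ind-∅ , ≤-trans (≤-reflexive (size-∅ {n})) z≤n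
  ; ind-down = λ S T sub (m , le) → ind-down S T sub m , ≤-trans (size-mono {S = S} {T} sub) le
  ; ind-exch = λ S T (m , _) (m′ , le) lt → let e , e∈ , e∉ , me = ind-exch S T m m′ lt in
      e , e∈ , e∉ , me , ≤-trans (≤-reflexive (size-insert {e = e} {S} e∉)) (≤-trans lt le) }
  where open IsMatroid (𝓔-matroid {n})

transport-matroid : {M N : IndPred n} → M ⪯ N → N ⪯ M → IsMatroid M → IsMatroid N
transport-matroid f g isM = record
  { ind-∅ = f ∅ ind-∅
  ; ind-down = λ S T sub m → f S (ind-down S T sub (g T m))
  ; ind-exch = λ S T m m′ lt → let e , e∈ , e∉ , me = ind-exch S T (g S m) (g T m′) lt in e , e∈ , e∉ , f (insert e S) me }
  where open IsMatroid isM

U-matroid : IsMatroid (U n)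
U-matroid = transport-matroid T₆⪯U U⪯T₆ (T-matroid 6)

-- The relaxation of rank 8

ThreeOf : Set → Set → Set → Set → Set
ThreeOf A B C D = (B × C × D) ⊎ (A × C × D) ⊎ (A × B × D) ⊎ (A × B × C)

three-of-four : {A : Set} {P : A → Set} (_≟ᴬ_ : (x y : A) → Dec (x ≡ y)) (z : A) {a b c d : A} → Unique (a ∷ b ∷ c ∷ d ∷ []) →
  (∀ {f} → f ∈ a ∷ b ∷ c ∷ d ∷ [] → f ≢ z → P f) → ThreeOf (P a) (P b) (P c) (P d)
three-of-four _≟ᴬ_ z {a} {b} {c} {d} ((ab ∷ ac ∷ ad ∷ []) ∷ (bc ∷ bd ∷ []) ∷ (cd ∷ []) ∷ _) h with a ≟ᴬ z | b ≟ᴬ z | c ≟ᴬ z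
... | yes refl | _ | _ = inj₁ (h (there (here refl)) (ab ∘ sym) , h (there (there (here refl))) (ac ∘ sym) , h (there (there (there (here refl)))) (ad ∘ sym))
... | no a≢ | yes refl | _ = inj₂ (inj₁ (h (here refl) a≢ , h (there (there (here refl))) (bc ∘ sym) , h (there (there (there (here refl)))) (bd ∘ sym)))
... | no a≢ | no b≢ | yes refl = inj₂ (inj₂ (inj₁ (h (here refl) a≢ , h (there (here refl)) b≢ , h (there (there (there (here refl)))) (cd ∘ sym))))
... | no a≢ | no b≢ | no c≢ = inj₂ (inj₂ (inj₂ (h (here refl) a≢ , h (there (here refl)) b≢ , h (there (there (here refl))) c≢)))

-- Three edges of a 4-cycle form a spanning path, along which the zero at `a` propagates.
path-zero : ∀ a b c d → a ≡ 𝟎 → ThreeOf (a ⊕ b ≡ 𝟎) (b ⊕ c ≡ 𝟎) (c ⊕ d ≡ 𝟎) (a ⊕ d ≡ 𝟎) → b ≡ 𝟎 × c ≡ 𝟎 × d ≡ 𝟎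
path-zero = toWitness {a? = all₃? λ a → all₃? λ b → all₃? λ c → all₃? λ d → (a ≟₃ 𝟎) →-dec
  ((three (a ⊕ b ≟₃ 𝟎) (b ⊕ c ≟₃ 𝟎) (c ⊕ d ≟₃ 𝟎) (a ⊕ d ≟₃ 𝟎)) →-dec ((b ≟₃ 𝟎) ×-dec (c ≟₃ 𝟎) ×-dec (d ≟₃ 𝟎)))} _
  where
  three : ∀ {A B C D : Set} → Dec A → Dec B → Dec C → Dec D → Dec (ThreeOf A B C D)
  three a b c d = (b ×-dec c ×-dec d) ⊎-dec (a ×-dec c ×-dec d) ⊎-dec (a ×-dec b ×-dec d) ⊎-dec (a ×-dec b ×-dec c)

-- A vector in the kernel of C₄ ∪ C₄ minus an edge that vanishes at one vertex of each cycle is zero.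
2C₄-remove-𝓔 : (φ : Embedding 8 n) (e : Edge n) → image φ 2C₄ e ≡ true → 𝓔 (remove e (image φ 2C₄))
2C₄-remove-𝓔 {n} φ e e∈ = from (𝓔-or-kernel (remove e (image φ 2C₄)))
  where
  from : 𝓔 (remove e (image φ 2C₄)) ⊎ KernelVectors (remove e (image φ 2C₄)) → 𝓔 (remove e (image φ 2C₄))
  from (inj₁ m) = m
  from (inj₂ kernels) =
    -- One zero per cycle is exactly affordable: two zeros and seven edges make 8 + 1.
    let x , kx , zero-at , v , v∈ , xv = kernels (vertices φ) (at φ 0F ∷ at φ 4F ∷ []) (vertices-unique φ)
          (s≤s (≤-reflexive (trans (size-remove {e = e} {image φ 2C₄} e∈) (size-image φ 2C₄-unique))))
        i , eq = vertices-∈ φ v∈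
    in contradiction (trans (sym xv) (trans (cong x eq) (zeros x kx (zero-at (here refl)) (zero-at (there (here refl))) i))) 𝟏≢𝟎
    where
    zeros : ∀ x → Ker x (remove e (image φ 2C₄)) → x (at φ 0F) ≡ 𝟎 → x (at φ 4F) ≡ 𝟎 → ∀ i → x (at φ i) ≡ 𝟎
    zeros x kx x₀ x₄ = all
      where
      e₀ : ∃[ f ] (f ∈ 2C₄ × e ≡ embed φ f)
      e₀ = image-∈ φ {2C₄} {e} e∈
      y : V 8
      y i = x (at φ i)
      ky : ∀ {f} → f ∈ 2C₄ → f ≢ proj₁ e₀ → y ∙ f ≡ 𝟎
      ky {f} f∈ ne = trans (sym (∙-embed x φ f)) (kx (embed φ f)
        (remove-intro e (image φ 2C₄) (∈-image φ f∈) (λ eq → ne (embed-injective φ (trans eq (proj₂ (proj₂ e₀)))))))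
      first = path-zero (y 0F) (y 1F) (y 2F) (y 3F) x₀ (three-of-four {P = λ f → y ∙ f ≡ 𝟎} _≟ᵉ_ (proj₁ e₀)
        (toWitness {a? = unique? ((0F — 1F) ∷ (1F — 2F) ∷ (2F — 3F) ∷ (0F — 3F) ∷ [])} _) (λ p → ky (∈-++⁺ˡ p)))
      second = path-zero (y 4F) (y 5F) (y 6F) (y 7F) x₄ (three-of-four {P = λ f → y ∙ f ≡ 𝟎} _≟ᵉ_ (proj₁ e₀)
        (toWitness {a? = unique? ((4F — 5F) ∷ (5F — 6F) ∷ (6F — 7F) ∷ (4F — 7F) ∷ [])} _) (λ p → ky (there (there (there (there p))))))
      all : ∀ i → y i ≡ 𝟎
      all 0F = x₀
      all 1F = proj₁ first
      all 2F = proj₁ (proj₂ first)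
      all 3F = proj₂ (proj₂ first)
      all 4F = x₄
      all 5F = proj₁ second
      all 6F = proj₁ (proj₂ second)
      all 7F = proj₂ (proj₂ second)

split-pattern′ : V 8
split-pattern′ 4F = 𝟏
split-pattern′ 5F = 𝟐
split-pattern′ 6F = 𝟏
split-pattern′ 7F = 𝟐
split-pattern′ _  = 𝟎

opaque
  -- The flats of the two vectors are C₄ next to K₄ and K₄ next to C₄; they meet in C₄ ∪ C₄.
  2C₄-closed : ∀ e → (e ∈ 2C₄ ⊎ split-pattern ∙ e ≢ 𝟎) ⊎ split-pattern′ ∙ e ≢ 𝟎
  2C₄-closed = checkEdges (λ e → ((e ∈ᵉ? 2C₄) ⊎-dec ¬? (split-pattern ∙ e ≟₃ 𝟎)) ⊎-dec ¬? (split-pattern′ ∙ e ≟₃ 𝟎)) _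

opaque
  2C₄-split : All (λ e → split-pattern ∙ e ≡ 𝟎 × split-pattern′ ∙ e ≡ 𝟎) 2C₄
  2C₄-split = toWitness {a? = all? (λ e → (split-pattern ∙ e ≟₃ 𝟎) ×-dec (split-pattern′ ∙ e ≟₃ 𝟎)) 2C₄} _

-- C₄ ∪ C₄ is closed, hence a circuit-hyperplane of the truncation of 𝓔 to rank 8.
2C₄-separate : (φ : Embedding 8 n) (g : Edge n) → image φ 2C₄ g ≡ false → ∃[ x ] (Ker x (image φ 2C₄) × x ∙ g ≢ 𝟎)
2C₄-separate {n} φ g g∉ = by-ends (src g ∈ᶠ? vertices φ) (tgt g ∈ᶠ? vertices φ)
  where
  Result : Set
  Result = ∃[ x ] (Ker x (image φ 2C₄) × x ∙ g ≢ 𝟎)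
  outside : ∀ u p → Joins g u p → u ∉ vertices φ → Result
  outside u p jn u∉ = δ u , kernel , (λ eq → 𝟏≢𝟎 (trans (sym (cong₂ _⊕_ (δ-diag u) (δ-off (joins-≢ jn)))) (trans (sym (∙-joins (δ u) jn)) eq)))
    where
    kernel : Ker (δ u) (image φ 2C₄)
    kernel f f∈ with image-∈ φ {2C₄} {f} f∈
    ... | f′ , _ , refl = let p , q = embed-within φ f′ in cong₂ _⊕_ (δ-off {i = u} {src (embed φ f′)} (λ eq → u∉ (subst (_∈ vertices φ) (sym eq) p))) (δ-off {i = u} {tgt (embed φ f′)} (λ eq → u∉ (subst (_∈ vertices φ) (sym eq) q)))
  ext : ∀ y e → extend-by-𝟎 φ y ∙ embed φ e ≡ y ∙ e
  ext y e = trans (∙-embed (extend-by-𝟎 φ y) φ e) (∙-cong (extend-at φ y) e)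
  inside : ∀ g′ → g ≡ embed φ g′ → (g′ ∈ 2C₄ ⊎ split-pattern ∙ g′ ≢ 𝟎) ⊎ split-pattern′ ∙ g′ ≢ 𝟎 → Result
  inside g′ refl (inj₁ (inj₁ p)) = contradiction (∈-image φ p) (false≢true g∉)
  inside g′ refl (inj₁ (inj₂ ne)) = extend-by-𝟎 φ split-pattern ,
    image-Ker φ {2C₄} {image φ 2C₄} (λ _ p → p) (extend-by-𝟎 φ split-pattern) (λ {e} p → trans (∙-cong (extend-at φ split-pattern) e) (proj₁ (All.lookup 2C₄-split p))) ,
    (λ eq → ne (trans (sym (ext split-pattern g′)) eq))
  inside g′ refl (inj₂ ne) = extend-by-𝟎 φ split-pattern′ ,
    image-Ker φ {2C₄} {image φ 2C₄} (λ _ p → p) (extend-by-𝟎 φ split-pattern′) (λ {e} p → trans (∙-cong (extend-at φ split-pattern′) e) (proj₂ (All.lookup 2C₄-split p))) ,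
    (λ eq → ne (trans (sym (ext split-pattern′ g′)) eq))
  by-ends : Dec (src g ∈ vertices φ) → Dec (tgt g ∈ vertices φ) → Result
  by-ends (no p) _ = outside (src g) (tgt g) (fwd (refl , refl)) p
  by-ends (yes _) (no q) = outside (tgt g) (src g) (bwd (refl , refl)) q
  by-ends (yes p) (yes q) = let g′ , eq = within-vertices φ {g} (p , q) in inside g′ eq (2C₄-closed g′)

N₈ : IndPred n
N₈ S = T 8 S ⊎ Is2C₄ S

Is2C₄-size : {S : ESet n} → Is2C₄ S → size S ≡ 8
Is2C₄-size {S = S} (φ , eq) = trans (size-≐ {S = S} {image φ 2C₄} eq) (size-image φ 2C₄-unique)

N₈-size : {S : ESet n} → N₈ S → size S ≤ 8
N₈-size (inj₁ (_ , le)) = le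
N₈-size {S = S} (inj₂ c) = ≤-reflexive (Is2C₄-size {S = S} c)

-- A proper subset misses an edge and is then in `𝓔`, since C₄ ∪ C₄ is a circuit there.
Is2C₄-⊆ : (S T : ESet n) → S ⊆ T → Is2C₄ T → N₈ S
Is2C₄-⊆ S W sub c@(φ , W⊆ , ⊆W) = by (⊆-or-witness S W)
  where
  by : W ⊆ S ⊎ ∃[ e ] (W e ≡ true × S e ≡ false) → N₈ S
  by (inj₁ W⊆S) = inj₂ (φ , ⊆-trans {S = S} {W} {image φ 2C₄} sub W⊆ , ⊆-trans {S = image φ 2C₄} {W} {S} ⊆W W⊆S)
  by (inj₂ (e , e∈ , e∉)) = inj₁ (𝓔-⊆ S (remove e (image φ 2C₄)) (λ f p → remove-intro e (image φ 2C₄) {f} (W⊆ f (sub f p)) (λ { refl → false≢true e∉ p }))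
    (2C₄-remove-𝓔 φ e (W⊆ e e∈)) , ≤-trans (size-mono {S = S} {W} sub) (≤-reflexive (Is2C₄-size {S = W} c)))

N₈-below : {S : ESet n} → size S < 8 → N₈ S → 𝓔 S
N₈-below lt (inj₁ (m , _)) = m
N₈-below {S = S} lt (inj₂ c) = contradiction (subst (_< 8) (Is2C₄-size {S = S} c) lt) (<-irrefl refl)

-- A relaxed set has the maximum size 8, so it matters only as the larger set W. If S contains some
-- g outside W, replace an edge of W by g: since W is closed, the result is in `𝓔` and still has
-- eight edges. Exchange with it cannot return g, which is in S, so it returns an edge of W.
N₈-matroid : IsMatroid (N₈ {n})
N₈-matroid {n} = record { ind-∅ = inj₁ (T.ind-∅) ; ind-down = down ; ind-exch = exch }
  where
  module M = IsMatroid (𝓔-matroid {n})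
  module T = IsMatroid (T-matroid {n} 8)
  down : ∀ S W → S ⊆ W → N₈ W → N₈ S
  down S W sub (inj₁ t) = inj₁ (T.ind-down S W sub t)
  down S W sub (inj₂ c) = Is2C₄-⊆ S W sub c
  Exchange : ESet n → ESet n → Set
  Exchange S W = ∃[ e ] (W e ≡ true × S e ≡ false × N₈ (insert e S))
  relaxed : ∀ S W → 𝓔 S → (c : Is2C₄ W) → size S < 8 → S ⊆ W ⊎ ∃[ g ] (S g ≡ true × W g ≡ false) → Exchange S W
  relaxed S W m c lt (inj₁ S⊆W) =
    let e , e∈ , e∉ = larger {S = S} {W} (≤-trans lt (≤-reflexive (sym (Is2C₄-size {S = W} c))))
    in e , e∈ , e∉ , Is2C₄-⊆ (insert e S) W (insert-⊆ {e = e} {S} {W} S⊆W e∈) c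
  relaxed S W m (φ , W⊆ , ⊆W) lt (inj₂ (g , g∈ , g∉)) =
    let x , kx , xg = 2C₄-separate φ g g∉′
        e , e∈ , e∉ , me = M.ind-exch S W′ m (𝓔-insert {S = remove f (image φ 2C₄)} {g} {x} (2C₄-remove-𝓔 φ f f∈)
            (Ker-⊆ {x = x} {remove f (image φ 2C₄)} {image φ 2C₄} (remove-⊆ f (image φ 2C₄)) kx) xg)
            (≤-trans lt (≤-reflexive (sym size-W′)))
    in e , in-W e e∈ e∉ , e∉ , inj₁ (me , ≤-trans (≤-reflexive (size-insert {e = e} {S} e∉)) lt)
    where
    f : Edge n
    f = embed φ (0F — 1F)
    f∈ : image φ 2C₄ f ≡ true
    f∈ = ∈-image φ {2C₄} (here refl)
    W′ : ESet n
    W′ = insert g (remove f (image φ 2C₄))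
    g∉′ : image φ 2C₄ g ≡ false
    g∉′ = Boolₚ.¬-not (λ p → false≢true g∉ (⊆W g p))
    size-W′ : size W′ ≡ 8
    size-W′ = trans (size-insert {e = g} {remove f (image φ 2C₄)} (Boolₚ.¬-not (λ p → false≢true g∉′ (remove-⊆ f (image φ 2C₄) g p))))
      (trans (size-remove {e = f} {image φ 2C₄} f∈) (size-image φ 2C₄-unique))
    in-W : ∀ e → W′ e ≡ true → S e ≡ false → W e ≡ true
    in-W e e∈ e∉ with insert-inv g (remove f (image φ 2C₄)) {e} e∈
    ... | inj₁ p    = ⊆W e (remove-⊆ f (image φ 2C₄) e p)
    ... | inj₂ refl = contradiction g∈ (false≢true e∉)
  exch : ∀ S W → N₈ S → N₈ W → size S < size W → Exchange S W
  exch S W nS (inj₁ (m , le)) lt = let e , e∈ , e∉ , t = T.ind-exch S W (N₈-below {S = S} (<-≤-trans lt le) nS , <⇒≤ (<-≤-trans lt le)) (m , le) lt in e , e∈ , e∉ , inj₁ t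
  exch S W nS (inj₂ c) lt = relaxed S W (N₈-below {S = S} lt′ nS) c lt′ (⊆-or-witness W S)
    where
    lt′ : size S < 8
    lt′ = <-≤-trans lt (≤-reflexive (Is2C₄-size {S = W} c))

-- Independent sets that attain the rank

initial : ∀ {m} → m ≤ n → Embedding m n
initial m≤n = embedding (λ i → inject≤ i m≤n) (λ {i} {j} → inject≤-injective m≤n m≤n i j)

opaque
  triangle-zero : ∀ a b c → a ⊕ b ≡ 𝟎 → a ⊕ c ≡ 𝟎 → b ⊕ c ≡ 𝟎 → a ≡ 𝟎
  triangle-zero = toWitness {a? = all₃? λ a → all₃? λ b → all₃? λ c → (a ⊕ b ≟₃ 𝟎) →-dec ((a ⊕ c ≟₃ 𝟎) →-dec ((b ⊕ c ≟₃ 𝟎) →-dec (a ≟₃ 𝟎)))} _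

-- Each vertex lies on a triangle, so only the zero vector is killed by all edges and a linear basis
-- has at least n edges. One more edge exists because a K₄ is dependent.
𝓔-full-rank : 4 ≤ n → ∃[ B ] (𝓔 {n} B × size B ≡ suc n)
𝓔-full-rank {n} 4≤n =
  let B , _ , ind , kr = basis {n} (λ _ → true)
      e , _ , e∉ = missing B ind (⊆-or-witness B (λ _ → true))
      -- Only the lower bound for the basis has been shown, so the set is cut down to the exact
      -- size.
      B′ , sub , eq = shrink (suc n) (insert e B) (≤-trans (s≤s (spans B kr)) (≤-reflexive (sym (size-insert {e = e} {B} e∉))))
  in B′ , 𝓔-⊆ B′ (insert e B) sub (inj₂ (e , Indep-⊆ {S = remove e (insert e B)} {B} (remove-insert-⊆ e B) ind)) , eq
  where
  φ : Embedding 4 n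
  φ = initial 4≤n
  spans : ∀ B → (∀ x → Ker x B → Ker x (λ _ → true)) → n ≤ size B
  spans B kr = ≮⇒≥ λ lt →
    let x , kx , _ , v , _ , xv = kernel-vector (allFin n) (Uniqueₚ.allFin⁺ n) [] B (≤-trans lt (≤-reflexive (sym (length-tabulate id))))
        p , q , _ , _ , p≢q , (p≢v , _) , (q≢v , _) = avoid-two (vertices φ) (vertices-unique φ) ≤-refl v v
        pair : ∀ {a b} → a ≢ b → x a ⊕ x b ≡ 𝟎
        pair ne = let e , jn = edge-between ne in trans (sym (∙-joins x jn)) (kr x kx e refl)
    in 𝟏≢𝟎 (trans (sym xv) (triangle-zero (x v) (x p) (x q) (pair (p≢v ∘ sym)) (pair (q≢v ∘ sym)) (pair p≢q)))
  missing : ∀ B → Indep B → (λ _ → true) ⊆ B ⊎ (∃[ e ] (true ≡ true × B e ≡ false)) → ∃[ e ] (true ≡ true × B e ≡ false)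
  missing B ind (inj₂ w) = w
  missing B ind (inj₁ full) = contradiction (inj₁ (Indep-⊆ {S = image φ K₄} {B} (λ e _ → full e refl) ind))
    (InX⇒¬𝓔 {F = image φ K₄} (inj₁ (K4Copies.image⇒copy φ {image φ K₄} ((λ _ p → p) , (λ _ p → p)))))

-- A triangle with pendant edges at 0F, a linear basis of K₇ with seven edges, plus the one surplus
-- edge 1F - 3F that `𝓔` allows.
K₇-basis : List (Edge 7)
K₇-basis = (0F — 1F) ∷ (0F — 2F) ∷ (1F — 2F) ∷ (0F — 3F) ∷ (0F — 4F) ∷ (0F — 5F) ∷ (0F — 6F) ∷ (1F — 3F) ∷ []

opaque
  K₇-basis-unique : Unique K₇-basis
  K₇-basis-unique = toWitness {a? = unique? K₇-basis} _

K₇-basis-𝓔 : (ψ : Embedding 7 n) → 𝓔 (image ψ K₇-basis)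
K₇-basis-𝓔 ψ = from (𝓔-or-kernel (image ψ K₇-basis))
  where
  from : 𝓔 (image ψ K₇-basis) ⊎ KernelVectors (image ψ K₇-basis) → 𝓔 (image ψ K₇-basis)
  from (inj₁ m) = m
  from (inj₂ kernels) =
    let x , kx , _ , v , v∈ , xv = kernels (vertices ψ) [] (vertices-unique ψ) (≤-reflexive (size-image ψ K₇-basis-unique))
        i , eq = vertices-∈ ψ v∈
    in contradiction (trans (sym xv) (trans (cong x eq) (zeros (λ i → x (at ψ i)) (λ {f} f∈ → trans (sym (∙-embed x ψ f)) (kx (embed ψ f) (∈-image ψ f∈))) i))) 𝟏≢𝟎
    where
    zeros : ∀ (y : V 7) → (∀ {f} → f ∈ K₇-basis → y ∙ f ≡ 𝟎) → ∀ i → y i ≡ 𝟎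
    zeros y ky = all
      where
      y₀ : y 0F ≡ 𝟎
      y₀ = triangle-zero (y 0F) (y 1F) (y 2F) (ky (here refl)) (ky (there (here refl))) (ky (there (there (here refl))))
      next : ∀ {i} → y 0F ⊕ y i ≡ 𝟎 → y i ≡ 𝟎
      next eq = opposite (trans (⊕-comm _ (y 0F)) eq) y₀
      all : ∀ i → y i ≡ 𝟎
      all 0F = y₀
      all 1F = next (ky (here refl))
      all 2F = next (ky (there (here refl)))
      all 3F = next (ky (there (there (there (here refl)))))
      all 4F = next (ky (there (there (there (there (here refl))))))
      all 5F = next (ky (there (there (there (there (there (here refl)))))))
      all 6F = next (ky (there (there (there (there (there (there (here refl))))))))

-- Partial elevations

-- The property that erections preserve: the independent sets with at most six edges are those of
-- `U`. It supplies the two hypotheses of `XMatroid`.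
record ExtendsU (M : IndPred n) : Set where
  field
    matroid : IsMatroid M
    above   : ∀ S → U n S → M S
    agrees  : ∀ S → M S → size S ≤ 6 → U n S

  small : ∀ S → size S ≤ 5 → M S
  small S le = above S (≤-trans le (n≤1+n 5) , λ inX → <-irrefl refl (≤-trans (≤-reflexive (sym (InX-size {F = S} inX))) le))

  X-dependent : ∀ S → InX S → ¬ M S
  X-dependent S inX m = proj₂ (agrees S m (≤-reflexive (InX-size {F = S} inX))) inX

module Elevations (n : ℕ) (36≤n : 36 ≤ n) where

  below : ∀ m {t : True (m ≤? 36)} → m ≤ n
  below m {t} = ≤-trans (toWitness t) 36≤n

  B : ESet n
  B = proj₁ (𝓔-full-rank (below 4))
  B-𝓔 : 𝓔 B
  B-𝓔 = proj₁ (proj₂ (𝓔-full-rank (below 4)))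
  B-size : size B ≡ suc n
  B-size = proj₂ (proj₂ (𝓔-full-rank (below 4)))

  T-witness : ∀ r → r ≤ suc n → ∃[ S ] (T {n} r S × size S ≡ r)
  T-witness r le = let S , sub , eq = shrink r B (≤-trans le (≤-reflexive (sym B-size))) in
    S , (𝓔-⊆ S B sub B-𝓔 , ≤-reflexive eq) , eq

  T-rank : ∀ r → r ≤ suc n → HasRank (T {n} r) r
  T-rank r le = T-witness r le , (λ S → proj₂)

  -- `U` and `T 6` agree only up to logical equivalence, so the erection of `U` itself is treated
  -- apart from the later ones.
  U→T₇ : Erects (U n) (T 7)
  U→T₇ = inj₁ (T-matroid 7 , 6 , T-rank 7 (s≤s (below 6)) ,
    λ S → (λ u → let m , le = U⪯T₆ S u in (m , ≤-trans le (n≤1+n 6)) , le) , (λ ((m , _) , le) → T₆⪯U S (m , le)))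

  T→T : ∀ r → suc r ≤ suc n → Erects (T {n} r) (T (suc r))
  T→T r le = inj₁ (T-matroid (suc r) , r , T-rank (suc r) le ,
    λ S → (λ (m , le) → (m , ≤-trans le (n≤1+n r)) , le) , (λ ((m , _) , le) → m , le))

  T-elevation : ∀ d → 7 + d ≤ suc n → IsPartialElevation (U n) (T (7 + d))
  T-elevation zero le = U→T₇ ◅ ε
  T-elevation (suc d) le = subst (λ r → IsPartialElevation (U n) (T r)) (sym (+-suc 7 d))
    (T-elevation d (≤-trans (n≤1+n _) le′) ◅◅ (T→T (7 + d) le′ ◅ ε))
    where
    le′ : suc (7 + d) ≤ suc n
    le′ = ≤-trans (≤-reflexive (sym (+-suc 7 d))) le

  Tₙ₊₁-elevation : IsPartialElevation (U n) (T (suc n))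
  Tₙ₊₁-elevation = subst (λ r → IsPartialElevation (U n) (T r)) eq (T-elevation (n ∸ 6) (≤-reflexive eq))
    where
    eq : 7 + (n ∸ 6) ≡ suc n
    eq = cong suc (m+[n∸m]≡n (below 6))

  -- The relaxed sets have eight edges, so truncation to rank seven erases them and leaves `T 7`.
  N₈-elevation : IsPartialElevation (U n) N₈
  N₈-elevation = U→T₇ ◅ inj₁ (N₈-matroid , 7 , rank , λ S → (λ (m , le) → inj₁ (m , ≤-trans le (n≤1+n 7)) , le) ,
      (λ (nS , le) → N₈-below {S = S} (s≤s le) nS , le)) ◅ ε
    where
    rank : HasRank (N₈ {n}) 8
    rank = (let S , t , eq = T-witness 8 (s≤s (below 7)) in S , inj₁ t , eq) , (λ S → N₈-size {S = S})

  elevation-extendsU : ∀ {M} → IsPartialElevation (U n) M → ExtendsU M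
  elevation-extendsU = go (record { matroid = U-matroid ; above = λ _ u → u ; agrees = λ _ u _ → u })
    where
    step : ∀ {M N} → ExtendsU M → Erects M N → ExtendsU N
    step {M} {N} ext (inj₁ (isN , r , _ , trunc)) = record
      { matroid = isN ; above = λ S u → proj₁ (proj₁ (trunc S) (above S u))
      ; agrees = λ S m le → agrees S (proj₂ (trunc S) (m , ≤-trans le 6≤r)) le }
      where
      open ExtendsU ext
      6≤r : 6 ≤ r
      -- An independent set of `U` with six edges survives in the truncation, so the truncation does
      -- not cut below six.
      6≤r = let S , t , eq = T-witness 6 (≤-trans (below 6) (n≤1+n n)) in
        ≤-trans (≤-reflexive (sym eq)) (proj₂ (proj₁ (trunc S) (above S (T₆⪯U S t))))
    step ext (inj₂ (f , g)) = record
      { matroid = transport-matroid f g matroid ; above = λ S u → f S (above S u) ; agrees = λ S m → agrees S (g S m) }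
      where open ExtendsU ext
    go : ∀ {M N} → ExtendsU M → Star Erects M N → ExtendsU N
    go ext ε = ext
    go ext (s ◅ ss) = go (step ext s) ss

  Tₙ₊₁-maximal : IsMaximalElevation (U n) (T (suc n))
  Tₙ₊₁-maximal = Tₙ₊₁-elevation , maximal
    where
    maximal : ∀ M → IsPartialElevation (U n) M → T (suc n) ⪯ M → M ⪯ T (suc n)
    maximal M el T⪯M S mS =
      -- S is first enlarged to n + 1 edges. If D were not in `𝓔`, it would lie in the hyperplane of
      -- a kernel vector, where at most n edges can be independent.
      let D , mD , S⊆D , _ , le = extend S B mS mB
      in 𝓔-⊆ S D S⊆D (in-𝓔 D mD (≤-trans (≤-reflexive (sym B-size)) le) (𝓔-or-kernel D)) , size-bound S mS
      where
      open ExtendsU (elevation-extendsU el)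
      open XMatroid M matroid small X-dependent
      mB : M B
      mB = T⪯M B (B-𝓔 , ≤-reflexive B-size)
      length-n : length (allFin n) ≡ n
      length-n = length-tabulate id
      everywhere : ∀ (e : Edge n) → Within (allFin n) e
      everywhere e = ∈-allFin (src e) , ∈-allFin (tgt e)
      size-bound : ∀ S → M S → size S ≤ suc n
      size-bound S m = ≤-trans (rank-complete (allFin n) (Uniqueₚ.allFin⁺ n) S (λ e _ → everywhere e) m) (≤-reflexive (cong suc length-n))
      2C₄-dependent : ∀ (φ : Embedding 8 n) → ¬ M (image φ 2C₄)
      2C₄-dependent φ m = <-irrefl refl (≤-trans (≤-reflexive (sym B-size)) (2C₄-independent⇒rank≤n φ m B (λ _ _ → tt) mB))
      in-𝓔 : ∀ D → M D → suc n ≤ size D → 𝓔 D ⊎ KernelVectors D → 𝓔 D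
      in-𝓔 D mD le (inj₁ m) = m
      in-𝓔 D mD le (inj₂ kernels) =
        let x , kx , _ , v , v∈ , xv = kernels (allFin n) [] (Uniqueₚ.allFin⁺ n) (≤-trans (size-bound D mD) (≤-reflexive (cong suc (sym length-n))))
            bound = rank-flat x (allFin n) (Uniqueₚ.allFin⁺ n) (v , v∈ , (λ eq → 𝟏≢𝟎 (trans (sym xv) eq))) (λ φ _ _ → 2C₄-dependent φ)
                      D (λ e p → everywhere e , kx e p) mD
        in contradiction (≤-trans le (≤-trans bound (≤-reflexive length-n))) (<-irrefl refl)

  N₈-maximal : IsMaximalElevation (U n) N₈
  N₈-maximal = N₈-elevation , maximal
    where
    maximal : ∀ M → IsPartialElevation (U n) M → N₈ ⪯ M → M ⪯ N₈
    maximal M el N⪯M S mS = by (classify S size-S)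
      where
      open ExtendsU (elevation-extendsU el)
      open IsMatroid matroid
      open XMatroid M matroid small X-dependent
      ι : Embedding 8 n
      ι = initial (below 8)
      ψ : Embedding 7 n
      -- The first seven of eight vertices; the eighth is the outside vertex needed for the rank
      -- bound.
      ψ = ι ∘ᵉ embedding Fin.inject₁ Finₚ.inject₁-injective
      7∉ : at ι 7F ∉ vertices ψ
      7∉ p = let i , eq = vertices-∈ ψ p in Finₚ.fromℕ≢inject₁ (injective ι eq)
      size-S : size S ≤ 8
      size-S = 2C₄-independent⇒rank≤8 (λ φ → N⪯M (image φ 2C₄) (inj₂ (φ , (λ _ p → p) , (λ _ p → p)))) ψ (at ι 7F) 7∉
        K₇-basis K₇-basis-unique refl (N⪯M (image ψ K₇-basis) (inj₁ (K₇-basis-𝓔 ψ , size-image-≤ ψ K₇-basis))) S (λ _ _ → tt) mS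
      by : 𝓔 S ⊎ Is2C₄ S ⊎ (∃[ D ] ∃[ vs ] (Core S D vs × Overfull D vs)) → N₈ S
      by (inj₁ m) = inj₁ (m , size-S)
      by (inj₂ (inj₁ c)) = inj₂ c
      by (inj₂ (inj₂ (D , vs , c , inj₁ large))) =
        contradiction (≤-trans large (rank-complete vs (Core.unique c) D (Core.within c) (ind-down D S (Core.core-⊆ c) mS))) (<-irrefl refl)
      by (inj₂ (inj₂ (D , vs , c , inj₂ (large , x , kx , nz)))) =
        contradiction (≤-trans large (rank-flat x vs unique nz too-few D (λ e p → within e p , kx e p) (ind-down D S core-⊆ mS))) (<-irrefl refl)
        where
        open Core c
        -- The eight vertices of φ would lie in `vs`, while |vs| + 1 ≤ |D| ≤ 8.
        too-few : (φ : Embedding 8 n) → (∀ i → at φ i ∈ vs) → _ → ¬ M (image φ 2C₄)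
        too-few φ in-vs _ _ = <-irrefl refl (≤-trans (s≤s (unique-length-≤ {xs = vertices φ} (vertices-unique φ) sub))
          (≤-trans large (≤-trans (size-mono {S = D} {S} core-⊆) size-S)))
          where
          sub : ∀ {v} → v ∈ vertices φ → v ∈ vs
          sub p with vertices-∈ φ p
          ... | i , refl = in-vs i

  different : ¬ (T {n} (suc n) ≅ₘ N₈)
  different (T⪯N , _) = <-irrefl refl (≤-trans (below 9) (≤-trans (n≤1+n n) (≤-trans (≤-reflexive (sym B-size)) (N₈-size {S = B} (T⪯N B (B-𝓔 , ≤-reflexive B-size))))))

theorem5p4 : ∀ (n : ℕ) → 36 ≤ n →
    IsMatroid (U n) ×
    ∃[ M₁ ] ∃[ M₂ ] (IsMaximalElevation (U n) M₁ × IsMaximalElevation (U n) M₂ × ¬ (M₁ ≅ₘ M₂))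
theorem5p4 n 36≤n = U-matroid , T (suc n) , N₈ , Tₙ₊₁-maximal , N₈-maximal , different
  where open Elevations n 36≤n
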